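{- There exists an algorithm that, given probe access to an Ising model with Gibbs distribution $\mu$ on a graph $G=(V,E)$ with maximum degree $\Delta\ge1$, arbitrary external fields $\lambda_v$ at each $v\in V$, and edge activity $\beta$ satisfying $$\beta\in\left(\frac{\Delta-0.5}{\Delta},\frac{\Delta}{\Delta-0.5}\right),$$ and given a subset of vertices $\Lambda\subseteq V$, outputs a perfect sample $X\sim\mu_\Lambda$ (that is, $X$ is distributed exactly according to $\mu_\Lambda$) in expected time $O(\Delta\cdot|\Lambda|)$.
   Context: The Ising model with edge activity $\beta>0$ and external fields $\lambda_v\in\mathbb R_{\ge0}^2$ on a finite graph $G=(V,E)$ is the $2$-spin system with interaction matrix $A_e=\begin{pmatrix}\beta&1\\1&\beta\end{pmatrix}$ at each edge $e\in E$. Its Gibbs distribution on $\{1,2\}^V$ is $\mu(\sigma)=w(\sigma)/Z$, where $w(\sigma)=\prod_{v\in V}\lambda_v(\sigma(v))\prod_{e=(u,v)\in E}A_e(\sigma(u),\sigma(v))$ and $Z=\sum_\sigma w(\sigma)$. For $\Lambda\subseteq V$, the marginal distribution is $\mu_\Lambda(\tau)=\sum_{\sigma\in\{1,2\}^V:\sigma_\Lambda=\tau}\mu(\sigma)$ for $\tau\in\{1,2\}^\Lambda$. Probe access means: for each $v\in V$, each neighbor of $v$ can be accessed in $O(1)$ time, and each entry of every $\lambda_v$ and $A_e$ can be retrieved in $O(1)$ time. -}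

module Defs where

open import Algebra.Bundles using (CommutativeRing)
import Algebra.Definitions.RawMonoid
open import Data.Bool.Base using (Bool; if_then_else_; _∧_)
open import Data.Fin.Base as Fin using (Fin; toℕ)
open import Data.Fin.Properties as Fin using (all?)
open import Data.List.Base as List
  using (List; []; _∷_; length; map; concatMap; foldr; filter; allFin; head; drop)
open import Data.List.Membership.Propositional using (_∈_; _∉_)
open import Data.List.Relation.Unary.Unique.Propositional using (Unique)
open import Data.Maybe.Base using (Maybe; maybe′)
open import Data.Nat.Base as ℕ using (ℕ; zero; suc)
open import Data.Nat.Properties as ℕ using (_≟_; _<?_)
open import Data.Product.Base as Prod using (_×_; _,_; Σ; ∃; proj₁)
open import Data.Vec.Base as Vec using (Vec; lookup)
open import Data.Vec.Properties using (≡-dec)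
open import Level using (Level; _⊔_) renaming (suc to lsuc)
open import Relation.Binary.Core using (Rel)
open import Relation.Binary.Structures using (IsDecTotalOrder)
open import Relation.Binary.PropositionalEquality.Core using (_≡_)
open import Relation.Nullary.Decidable.Core using (Dec; yes; no; does)
open import Relation.Nullary.Negation.Core using (¬_)

-- The standard library has no real numbers.  Everything below is relative
-- to an arbitrary Archimedean ordered field with decidable comparison: this
-- is what the reals (classically) are, and comparisons between reals are
-- unit-cost branching instructions of a real RAM.  Completeness is not
-- required, because every limit below is stated to equal a given element.

record ArchimedeanOrderedField c ℓ₁ ℓ₂ : Set (lsuc (c ⊔ ℓ₁ ⊔ ℓ₂)) where
  field
    commutativeRing : CommutativeRing c ℓ₁

  open CommutativeRing commutativeRing public

  infix 4 _≤_

  field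
    _≤_             : Rel Carrier ℓ₂
    isDecTotalOrder : IsDecTotalOrder _≈_ _≤_
    0≉1             : ¬ (0# ≈ 1#)
    inverse         : ∀ x → ¬ (x ≈ 0#) → ∃ λ y → x * y ≈ 1#
    +-monoˡ-≤       : ∀ z {x y} → x ≤ y → x + z ≤ y + z
    *-nonNegative   : ∀ {x y} → 0# ≤ x → 0# ≤ y → 0# ≤ x * y

  private
    module RawMonoid = Algebra.Definitions.RawMonoid +-rawMonoid

  fromℕ : ℕ → Carrier
  fromℕ n = n RawMonoid.× 1#

  field
    archimedean : ∀ x → ∃ λ n → x ≤ fromℕ n

  open IsDecTotalOrder isDecTotalOrder public
    using (_≤?_) renaming (_≟_ to _≈?_)

  infix 4 _<_
  _<_ : Rel Carrier (ℓ₁ ⊔ ℓ₂)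
  x < y = (x ≤ y) × ¬ (x ≈ y)

  -- Total division, with x ÷ 0 = 0.
  infixl 7 _÷_
  _÷_ : Carrier → Carrier → Carrier
  x ÷ y with y ≈? 0#
  ... | yes _  = 0#
  ... | no y≉0 = x * proj₁ (inverse y y≉0)

  ½ : Carrier
  ½ = 1# ÷ fromℕ 2

  clip : Carrier → Carrier
  clip x with x ≤? 0# | 1# ≤? x
  ... | yes _ | _     = 0#
  ... | no  _ | yes _ = 1#
  ... | no  _ | no  _ = x

  ∑ ∏ : ∀ {a} {A : Set a} → List A → (A → Carrier) → Carrier
  ∑ xs f = foldr (λ x s → f x + s) 0# xs
  ∏ xs f = foldr (λ x s → f x * s) 1# xs

  ⟦_⟧ : ∀ {p} {P : Set p} → Dec P → Carrier
  ⟦ P? ⟧ = if does P? then 1# else 0#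

  Converges : (ℕ → Carrier) → Carrier → Set _
  Converges a ℓ = ∀ ε → 0# < ε → ∃ λ N → ∀ t → N ℕ.≤ t →
                  (a t - ℓ ≤ ε) × (ℓ - a t ≤ ε)

-- A finite simple graph, given by adjacency lists (in arbitrary order, as
-- probe access enumerates the neighbours of a vertex in arbitrary order).
record Graph (n : ℕ) : Set where
  field
    neighbors : Fin n → List (Fin n)
    unique    : ∀ v → Unique (neighbors v)
    symmetric : ∀ {u v} → v ∈ neighbors u → u ∈ neighbors v
    loopless  : ∀ v → v ∉ neighbors v

  degree : Fin n → ℕ
  degree v = length (neighbors v)

  -- Each undirected edge occurs once, with its smaller endpoint first.
  edges : List (Fin n × Fin n)
  edges = concatMap (λ u → map (u ,_) (filter (u Fin.<?_) (neighbors u)))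
                    (allFin n)

MaxDegree : ∀ {n} → Graph n → ℕ → Set
MaxDegree G Δ = (∀ v → degree v ℕ.≤ Δ) × (∃ λ v → degree v ≡ Δ)
  where open Graph G

-- The spins 1 and 2 are the two elements 0 and 1 of Fin 2.
Spin : Set
Spin = Fin 2

configurations : ∀ n → List (Vec Spin n)
configurations zero    = Vec.[] ∷ []
configurations (suc n) =
  concatMap (λ a → map (a Vec.∷_) (configurations n)) (allFin 2)

-- The restriction of σ to Λ, in the order in which Λ is listed.
_↾_ : ∀ {n} → Vec Spin n → (Λ : List (Fin n)) → Vec Spin (length Λ)
σ ↾ Λ = Vec.map (lookup σ) (Vec.fromList Λ)

-- Algorithms are while programs for a randomised unit-cost real RAM.
--
-- The memory consists of arrays of naturals and arrays of field elements,
-- indexed by ℕ and initially zero; array names are literals, so a program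
-- uses finitely many arrays.  A scalar variable is cell 0 of an array.
-- A program is a finite piece of syntax that mentions neither the instance
-- nor any field element besides 0 and 1; the instance is reached only
-- through the probes.  Vertices of the instance appear as naturals below n,
-- but n itself, the maximum degree and β are not supplied as inputs.

data NExp : Set where
  lit         : ℕ → NExp
  natAt       : ℕ → NExp → NExp
  _⊕_ _⊖_ _⊗_ : NExp → NExp → NExp
  sizeΛ       : NExp                    -- |Λ|
  vertexΛ     : NExp → NExp             -- i-th listed element of Λ
  deg         : NExp → NExp
  nbr         : NExp → NExp → NExp      -- nbr v i: i-th neighbour of v

data RExp : Set where
  zeroᴿ oneᴿ      : RExp
  realAt          : ℕ → NExp → RExp
  _⊞_ _⊟_ _⊠_ _⊘_ : RExp → RExp → RExp
  field-entry     : NExp → NExp → RExp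
    -- field-entry v a: the entry λ_v(a)
  edge-entry      : NExp → NExp → NExp → NExp → RExp
    -- edge-entry v i a b: the entry A_e(a , b), where e joins v to its i-th
    -- neighbour

data BExp : Set where
  _≤ᴺ_ : NExp → NExp → BExp
  _≤ᴿ_ : RExp → RExp → BExp

infixr 5 _⨾_

data Cmd : Set where
  setNat  : ℕ → NExp → NExp → Cmd         -- a [ i ] := e
  setReal : ℕ → NExp → RExp → Cmd
  flip    : ℕ → NExp → RExp → Cmd         -- a [ i ] := Bernoulli (p)
  _⨾_     : Cmd → Cmd → Cmd
  ifThen  : BExp → Cmd → Cmd → Cmd
  while   : BExp → Cmd → Cmd

_‼_ : ∀ {a} {A : Set a} → List A → ℕ → Maybe A
xs ‼ i = head (drop i xs)

infixl 6 _[_,_]≔_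
_[_,_]≔_ : ∀ {a} {A : Set a} → (ℕ → ℕ → A) → ℕ → ℕ → A → (ℕ → ℕ → A)
(m [ a , i ]≔ x) b j = if does (b ≟ a) ∧ does (j ≟ i) then x else m b j

module Over {c ℓ₁ ℓ₂} (F : ArchimedeanOrderedField c ℓ₁ ℓ₂) where

  open ArchimedeanOrderedField F

  record IsingModel : Set (c ⊔ ℓ₁ ⊔ ℓ₂) where
    field
      n          : ℕ
      graph      : Graph n
      β          : Carrier
      β-positive : 0# < β
      field-of   : Fin n → Spin → Carrier
      field-nonNegative : ∀ v a → 0# ≤ field-of v a

    open Graph graph public

    A : Spin → Spin → Carrier
    A a b = if does (a Fin.≟ b) then β else 1#

    w : Vec Spin n → Carrier
    w σ = ∏ (allFin n) (λ v → field-of v (lookup σ v))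
        * ∏ edges (λ (u , v) → A (lookup σ u) (lookup σ v))

    Z : Carrier
    Z = ∑ (configurations n) w

    μ : Vec Spin n → Carrier
    μ σ = w σ ÷ Z

    marginal : (Λ : List (Fin n)) → Vec Spin (length Λ) → Carrier
    marginal Λ τ =
      ∑ (filter (λ σ → ≡-dec Fin._≟_ (σ ↾ Λ) τ) (configurations n)) μ

  module Run (I : IsingModel) (Λ : List (Fin (IsingModel.n I))) where

    open IsingModel I

    record Memory : Set c where
      constructor mem
      field
        nats  : ℕ → ℕ → ℕ
        reals : ℕ → ℕ → Carrier

    open Memory

    -- Out-of-range probes return 0.

    vertex : ℕ → Maybe (Fin n)
    vertex i = allFin n ‼ i

    spin : ℕ → Maybe Spin
    spin i = allFin 2 ‼ i

    probe-deg : ℕ → ℕ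
    probe-deg v = maybe′ degree 0 (vertex v)

    probe-nbr : ℕ → ℕ → ℕ
    probe-nbr v i =
      maybe′ (λ v′ → maybe′ toℕ 0 (neighbors v′ ‼ i)) 0 (vertex v)

    probe-field : ℕ → ℕ → Carrier
    probe-field v a =
      maybe′ (λ v′ → maybe′ (field-of v′) 0# (spin a)) 0# (vertex v)

    probe-edge : ℕ → ℕ → ℕ → ℕ → Carrier
    probe-edge v i a b =
      if does (i <? probe-deg v)
      then maybe′ (λ a′ → maybe′ (A a′) 0# (spin b)) 0# (spin a)
      else 0#

    evalN : NExp → Memory → ℕ
    evalN (lit k)     m = k
    evalN (natAt a e) m = nats m a (evalN e m)
    evalN (d ⊕ e)     m = evalN d m ℕ.+ evalN e m
    evalN (d ⊖ e)     m = evalN d m ℕ.∸ evalN e m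
    evalN (d ⊗ e)     m = evalN d m ℕ.* evalN e m
    evalN sizeΛ       m = length Λ
    evalN (vertexΛ e) m = maybe′ toℕ 0 (Λ ‼ evalN e m)
    evalN (deg e)     m = probe-deg (evalN e m)
    evalN (nbr d e)   m = probe-nbr (evalN d m) (evalN e m)

    evalR : RExp → Memory → Carrier
    evalR zeroᴿ             m = 0#
    evalR oneᴿ              m = 1#
    evalR (realAt a e)      m = reals m a (evalN e m)
    evalR (p ⊞ q)           m = evalR p m + evalR q m
    evalR (p ⊟ q)           m = evalR p m - evalR q m
    evalR (p ⊠ q)           m = evalR p m * evalR q m
    evalR (p ⊘ q)           m = evalR p m ÷ evalR q m
    evalR (field-entry d e) m = probe-field (evalN d m) (evalN e m)
    evalR (edge-entry d e a b) m =
      probe-edge (evalN d m) (evalN e m) (evalN a m) (evalN b m)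

    evalB : BExp → Memory → Bool
    evalB (d ≤ᴺ e) m = does (evalN d m ℕ.≤? evalN e m)
    evalB (p ≤ᴿ q) m = does (evalR p m ≤? evalR q m)

    -- A machine state: the commands still to be executed, and the memory.
    -- The machine has halted when no command is left.
    State : Set c
    State = List Cmd × Memory

    data Next : Set c where
      go   : State → Next
      toss : Carrier → State → State → Next

    -- Every step takes one unit of time.  Expressions occurring in a program
    -- contain boundedly many operations and probes, so charging one unit for
    -- each evaluation changes running times by a constant factor only.
    step : Cmd → List Cmd → Memory → Next
    step (setNat a i e) k m =
      go (k , mem (nats m [ a , evalN i m ]≔ evalN e m) (reals m))
    step (setReal a i e) k m =
      go (k , mem (nats m) (reals m [ a , evalN i m ]≔ evalR e m))
    step (flip a i p) k m =
      toss (clip (evalR p m))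
           (k , mem (nats m [ a , evalN i m ]≔ 1) (reals m))
           (k , mem (nats m [ a , evalN i m ]≔ 0) (reals m))
    step (c₁ ⨾ c₂)       k m = go (c₁ ∷ c₂ ∷ k , m)
    step (ifThen b c₁ c₂) k m = go ((if evalB b m then c₁ else c₂) ∷ k , m)
    step (while b c₁)     k m =
      go ((if evalB b m then c₁ ∷ while b c₁ ∷ k else k) , m)

    -- 𝔼 t f s: the expectation of f at the state reached from s after t
    -- steps, where a halted state stays as it is.
    𝔼 : ℕ → (State → Carrier) → State → Carrier
    𝔼 zero    f s            = f s
    𝔼 (suc t) f s@([] , _)   = f s
    𝔼 (suc t) f (c₁ ∷ k , m) with step c₁ k m
    ... | go s        = 𝔼 t f s
    ... | toss p s s′ = p * 𝔼 t f s + (1# - p) * 𝔼 t f s′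

    initial : Cmd → State
    initial alg = alg ∷ [] , mem (λ _ _ → 0) (λ _ _ → 0#)

    -- The output is read off from the array 0 of naturals: its i-th cell
    -- holds the spin of the i-th listed element of Λ.
    Outputs : Vec Spin (length Λ) → Memory → Set
    Outputs τ m = ∀ i → nats m 0 (toℕ i) ≡ toℕ (lookup τ i)

    outputs? : ∀ τ m → Dec (Outputs τ m)
    outputs? τ m = all? λ i → nats m 0 (toℕ i) ≟ toℕ (lookup τ i)

    halted-with : Vec Spin (length Λ) → State → Carrier
    halted-with τ ([]    , m) = ⟦ outputs? τ m ⟧
    halted-with τ (_ ∷ _ , _) = 0#

    running : State → Carrier
    running ([]    , _) = 0#
    running (_ ∷ _ , _) = 1#

    -- Pr[ T ≤ t and X = τ ], for the halting time T and the output X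
    Pr-output : Cmd → Vec Spin (length Λ) → ℕ → Carrier
    Pr-output alg τ t = 𝔼 t (halted-with τ) (initial alg)

    -- Pr[ T > t ]
    Pr-running : Cmd → ℕ → Carrier
    Pr-running alg t = 𝔼 t running (initial alg)

    -- Pr[ T < ∞ and X = τ ] = marginal Λ τ for all τ.  Since the marginal
    -- sums to 1, this includes almost sure termination.
    PerfectSampler : Cmd → Set _
    PerfectSampler alg = ∀ τ → Converges (Pr-output alg τ) (marginal Λ τ)

    -- E[ T ] ≤ b.  As T takes values in ℕ ∪ {∞}, E[ T ] is the supremum of
    -- the partial sums of Σ_{t ≥ 0} Pr[ T > t ].
    ExpectedTime≤ : Cmd → Carrier → Set _
    ExpectedTime≤ alg b = ∀ N → ∑ (List.upTo N) (Pr-running alg) ≤ b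

{-# OPTIONS --safe #-}

-- The spin of a vertex v is sampled by rejection.  Delete v, propose a
-- colour a with probability proportional to λ_v(a), and write each edge
-- matrix divided by its maximum as κ J + (1 − κ) D, where J is the all-ones
-- matrix and D the 0-1 matrix of the compatible pairs.  The edge from v to a
-- neighbour u passes with probability κ without looking at u; otherwise u is
-- sampled recursively in the smaller graph, stays pinned for the rest of the
-- trial, and the trial fails unless its spin is compatible with a.  A failed
-- trial is undone and repeated.  Since 2Δ(1 − κ) ≤ 1 and a recursive call
-- sees at most Δ − 1 live neighbours, a trial succeeds with probability at
-- least 9/16 and makes at most 1/2 recursive calls on average, so that the
-- branching process is subcritical uniformly in Δ.
--
-- Both exactness and running time follow from one superharmonic function of
-- the recursion stack, which bounds the expected reward collected within t
-- steps.  Upper bounds suffice for exactness: applied to the event X = τ and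
-- to its complement they enclose Pr[T ≤ t, X = τ] up to Pr[T > t].

module Submission where

open import Defs
open import Algebra.Bundles using (RawRing)
import Algebra.Properties.Ring
import Algebra.Properties.Semiring.Mult
import Algebra.Properties.Semiring.Mult.TCOptimised
import Algebra.Solver.Ring
open import Algebra.Solver.Ring.AlmostCommutativeRing
  using (fromCommutativeRing; _-Raw-AlmostCommutative⟶_)
import Algebra.Solver.Ring.NaturalCoefficients.Default
open import Data.Bool.Base using (Bool; true; false; if_then_else_; _∧_; _∨_)
open import Data.Empty using (⊥-elim; ⊥)
open import Data.Fin.Base as Fin using (Fin; zero; suc; toℕ)
import Data.Fin.Properties as Fin
open import Data.List.Base as List
  using (List; []; _∷_; _++_; map; concatMap; filter; allFin; length; drop)
import Data.List.Membership.DecPropositional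
open import Data.List.Membership.Propositional using (_∈_)
open import Data.List.Membership.Propositional.Properties using (∈-allFin; ∈-map⁺; ∈-++⁺ˡ; ∈-++⁺ʳ)
open import Data.List.Relation.Unary.All as All using (All; []; _∷_)
open import Data.List.Relation.Unary.AllPairs using ([]; _∷_)
open import Data.List.Relation.Unary.Any using (here; there)
open import Data.List.Relation.Unary.Unique.Propositional using (Unique)
open import Data.List.Relation.Unary.Unique.Propositional.Properties using (allFin⁺)
open import Data.Maybe.Base using (Maybe; just; nothing; maybe′)
open import Data.Nat.Base as ℕ using (ℕ; zero; suc)
import Data.Nat.Properties as ℕ
open import Data.Nat.Solver using (module +-*-Solver)
open import Data.Product.Base using (∃; _×_; _,_; proj₁; proj₂)
open import Data.Sum.Base using (_⊎_; inj₁; inj₂)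
open import Data.Unit.Base using (⊤)
open import Data.Vec.Base as Vec using (Vec; lookup; tabulate) renaming (_[_]≔_ to _at_≔_)
open import Data.Vec.Properties as Vec using (≡-dec)
open import Function.Base using (_∘_)
open import Level using (Lift)
open import Relation.Binary.Bundles using (Poset)
open import Relation.Binary.Definitions using (tri<; tri≈; tri>)
open import Relation.Binary.PropositionalEquality.Core as ≡ using (_≡_; _≢_)
import Relation.Binary.Reasoning.PartialOrder
open import Relation.Binary.Structures using (IsDecTotalOrder)
open import Relation.Nullary.Decidable using (dec-true; dec-false)
open import Relation.Nullary.Decidable.Core using (Dec; yes; no; does)
open import Relation.Nullary.Negation.Core using (¬_)
open import Relation.Unary using (Decidable)

-- Bernoulli's inequality alone is too weak. With m ≤ Δ - 1 live neighbours it bounds the success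
-- probability from below by 1/2 + 1/(2Δ), against 1/2 - 1/(2Δ) expected calls; the gap 1/Δ would
-- cost another factor Δ in the running time. Applied to half the exponent and squared, it gives
-- (3/4)² instead, a gap that does not depend on Δ. This needs ⌈m/2⌉ ≤ Δ/2, which fails for odd m =
-- Δ; hence a top-level call, all of whose neighbours may be live, only gets 1/2. It is not called
-- recursively, so a larger constant `Tᵣ` beside `Tₛ` suffices. Rejection is exact because, once v
-- is deleted, the total weight does not depend on the colour proposed for it. Neighbours stay
-- pinned so that the next one is sampled from its law given the previous ones, as the chain rule
-- demands. The restart after a failed trial is not unfolded: the value of a call has a closed form,
-- and it remains to check that one trial costs no more than the time released by its success.

-- Ordered-field arithmetic, finite sums and finite products.

module OrderedField {c ℓ₁ ℓ₂} (F : ArchimedeanOrderedField c ℓ₁ ℓ₂) where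

  open ArchimedeanOrderedField F public hiding (zero)
  open IsDecTotalOrder isDecTotalOrder public
    using (antisym; total; ≤-respˡ-≈; ≤-respʳ-≈)
    renaming (refl to ≤-refl; reflexive to ≤-reflexive; trans to ≤-trans)

  poset : Poset _ _ _
  poset = record { isPartialOrder = IsDecTotalOrder.isPartialOrder isDecTotalOrder }

  module ≤-Reasoning = Relation.Binary.Reasoning.PartialOrder poset

  open Algebra.Properties.Ring ring public
    using (-‿distribˡ-*; -‿distribʳ-*; -‿involutive; -0#≈0#)

  private
    module M  = Algebra.Properties.Semiring.Mult semiring
    module M′ = Algebra.Properties.Semiring.Mult.TCOptimised semiring
    module ℕSolver = Algebra.Solver.Ring.NaturalCoefficients.Default commutativeSemiring

    -- Coefficients are formal differences of naturals, kept in lowest terms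
    -- so that equal normal forms are syntactically equal.
    norm : ℕ → ℕ → ℕ × ℕ
    norm a b = a ℕ.∸ b , b ℕ.∸ a

    Coeff : RawRing _ _
    Coeff = record
      { Carrier = ℕ × ℕ
      ; _≈_     = _≡_
      ; _+_     = λ { (a , b) (c , d) → norm (a ℕ.+ c) (b ℕ.+ d) }
      ; _*_     = λ { (a , b) (c , d) → norm (a ℕ.* c ℕ.+ b ℕ.* d) (a ℕ.* d ℕ.+ b ℕ.* c) }
      ; -_      = λ { (a , b) → b , a }
      ; 0#      = 0 , 0
      ; 1#      = 1 , 0
      }

    -- The separate clause for `zero` makes `con (0 , 0)` and `con (1 , 0)` evaluate to exactly `0#`
    -- and `1#`, so that solved identities match their goals by computation.
    ⟦_⟧ᶜ : ℕ × ℕ → Carrier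
    ⟦ a , zero  ⟧ᶜ = a M′.× 1#
    ⟦ a , suc b ⟧ᶜ = a M′.× 1# - suc b M′.× 1#

    ⟦⟧ᶜ-diff : ∀ a b → ⟦ a , b ⟧ᶜ ≈ a M′.× 1# - b M′.× 1#
    ⟦⟧ᶜ-diff a zero    = sym (trans (+-congˡ -0#≈0#) (+-identityʳ _))
    ⟦⟧ᶜ-diff a (suc b) = refl

    neg-+ : ∀ x y → - (x + y) ≈ - x + - y
    neg-+ x y = sym (⁻¹-∙-comm x y)
      where open import Algebra.Properties.AbelianGroup +-abelianGroup

    diff-+ : ∀ a b c d → (a + c) - (b + d) ≈ (a - b) + (c - d)
    diff-+ a b c d = trans (+-congˡ (neg-+ b d))
      (solve 4 (λ a b c d → (a :+ c) :+ (b :+ d) := (a :+ b) :+ (c :+ d)) refl a (- b) c (- d))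
      where open ℕSolver

    diff-* : ∀ a b c d → (a * c + b * d) - (a * d + b * c) ≈ (a - b) * (c - d)
    diff-* a b c d = trans
      (+-cong (+-congˡ (trans (sym (-‿involutive _))
                 (trans (-‿cong (-‿distribˡ-* b d)) (-‿distribʳ-* (- b) d))))
              (trans (neg-+ _ _) (+-cong (-‿distribʳ-* a d) (-‿distribˡ-* b c))))
      (solve 4 (λ a b c d → (a :* c :+ b :* d) :+ (a :* d :+ b :* c) := (a :+ b) :* (c :+ d))
         refl a (- b) c (- d))
      where open ℕSolver

    diff-neg : ∀ a b → b - a ≈ - (a - b)
    diff-neg a b = sym (trans (neg-+ a (- b)) (trans (+-congˡ (-‿involutive b)) (+-comm (- a) b)))

    cancel-diff : ∀ a b c d → a + d ≈ c + b → a - b ≈ c - d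
    cancel-diff a b c d eq = begin-equality
      a - b                   ≈⟨ +-identityʳ _ ⟨
      (a - b) + 0#            ≈⟨ +-congˡ (-‿inverseʳ d) ⟨
      (a - b) + (d - d)       ≈⟨ solve 4 (λ a b d e → (a :+ b) :+ (d :+ e) := (a :+ d) :+ (b :+ e)) refl a (- b) d (- d) ⟩
      (a + d) + (- b - d)     ≈⟨ +-congʳ eq ⟩
      (c + b) + (- b - d)     ≈⟨ solve 4 (λ c b e d → (c :+ b) :+ (e :+ d) := (c :+ d) :+ (b :+ e)) refl c b (- b) (- d) ⟩
      (c - d) + (b - b)       ≈⟨ +-congˡ (-‿inverseʳ b) ⟩
      (c - d) + 0#            ≈⟨ +-identityʳ _ ⟩
      c - d                   ∎
      where open ≤-Reasoning
            open ℕSolver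

    infixr 8 _×′_
    _×′_ : ℕ → Carrier → Carrier
    _×′_ = M′._×_

    ⟦norm⟧ : ∀ a b → (let (x , y) = norm a b in ⟦ x , y ⟧ᶜ) ≈ a ×′ 1# - b ×′ 1#
    ⟦norm⟧ a b = trans (⟦⟧ᶜ-diff (a ℕ.∸ b) (b ℕ.∸ a))
      (cancel-diff ((a ℕ.∸ b) ×′ 1#) ((b ℕ.∸ a) ×′ 1#) (a ×′ 1#) (b ×′ 1#)
        (trans (sym (M′.×-homo-+ 1# (a ℕ.∸ b) b))
          (trans (reflexive (≡.cong (_×′ 1#) (∸-+ a b))) (M′.×-homo-+ 1# a (b ℕ.∸ a)))))
      where
      ∸-+ : ∀ a b → a ℕ.∸ b ℕ.+ b ≡ a ℕ.+ (b ℕ.∸ a)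
      ∸-+ zero    zero    = ≡.refl
      ∸-+ zero    (suc b) = ≡.refl
      ∸-+ (suc a) zero    = ≡.refl
      ∸-+ (suc a) (suc b) = ≡.trans (ℕ.+-suc (a ℕ.∸ b) b) (≡.cong suc (∸-+ a b))

    morphism : Coeff -Raw-AlmostCommutative⟶ fromCommutativeRing commutativeRing
    morphism = record
      { ⟦_⟧    = ⟦_⟧ᶜ
      ; +-homo = λ { (a , b) (c , d) → trans (⟦norm⟧ (a ℕ.+ c) (b ℕ.+ d)) (trans
          (+-cong (M′.×-homo-+ 1# a c) (-‿cong (M′.×-homo-+ 1# b d))) (trans
          (diff-+ (a ×′ 1#) (b ×′ 1#) (c ×′ 1#) (d ×′ 1#))
          (+-cong (sym (⟦⟧ᶜ-diff a b)) (sym (⟦⟧ᶜ-diff c d))))) }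
      ; *-homo = λ { (a , b) (c , d) → trans (⟦norm⟧ (a ℕ.* c ℕ.+ b ℕ.* d) (a ℕ.* d ℕ.+ b ℕ.* c)) (trans
          (+-cong (trans (M′.×-homo-+ 1# (a ℕ.* c) (b ℕ.* d)) (+-cong (M′.×1-homo-* a c) (M′.×1-homo-* b d)))
                  (-‿cong (trans (M′.×-homo-+ 1# (a ℕ.* d) (b ℕ.* c)) (+-cong (M′.×1-homo-* a d) (M′.×1-homo-* b c)))))
          (trans (diff-* (a ×′ 1#) (b ×′ 1#) (c ×′ 1#) (d ×′ 1#))
          (*-cong (sym (⟦⟧ᶜ-diff a b)) (sym (⟦⟧ᶜ-diff c d))))) }
      ; -‿homo = λ { (a , b) → trans (⟦⟧ᶜ-diff b a) (trans (diff-neg (a ×′ 1#) (b ×′ 1#))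
                   (-‿cong (sym (⟦⟧ᶜ-diff a b)))) }
      ; 0-homo = refl
      ; 1-homo = refl
      }

    _coeff≟_ : ∀ x y → Maybe (⟦ x ⟧ᶜ ≈ ⟦ y ⟧ᶜ)
    (a , b) coeff≟ (c , d) with a ℕ.+ d ℕ.≟ c ℕ.+ b
    ... | no _   = nothing
    ... | yes eq = just (trans (⟦⟧ᶜ-diff a b) (trans
            (cancel-diff (a ×′ 1#) (b ×′ 1#) (c ×′ 1#) (d ×′ 1#)
              (trans (sym (M′.×-homo-+ 1# a d)) (trans (reflexive (≡.cong (_×′ 1#) eq)) (M′.×-homo-+ 1# c b))))
            (sym (⟦⟧ᶜ-diff c d))))

  module Solver where
    open Algebra.Solver.Ring Coeff (fromCommutativeRing commutativeRing) morphism _coeff≟_ public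
      using (solve; _:=_; _:+_; _:*_; _:-_; :-_; con)
      renaming (Polynomial to Poly)
    :1 : ∀ {n} → Poly n
    :1 = con (1 , 0)
  open Solver


  -- Certifies an inequality by an explicit nonnegative slack `d`; what remains is a ring identity
  -- for the solver.
  ≤-by : ∀ {a b d} → 0# ≤ d → a + d ≈ b → a ≤ b
  ≤-by {a} {b} {d} 0≤d eq = begin
    a       ≈⟨ +-identityˡ a ⟨
    0# + a  ≤⟨ +-monoˡ-≤ a 0≤d ⟩
    d + a   ≈⟨ +-comm d a ⟩
    a + d   ≈⟨ eq ⟩
    b       ∎
    where open ≤-Reasoning

  +-mono-≤ : ∀ {a b x y} → a ≤ b → x ≤ y → a + x ≤ b + y
  +-mono-≤ {a} {b} {x} {y} a≤b x≤y = begin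
    a + x  ≤⟨ +-monoˡ-≤ x a≤b ⟩
    b + x  ≈⟨ +-comm b x ⟩
    x + b  ≤⟨ +-monoˡ-≤ b x≤y ⟩
    y + b  ≈⟨ +-comm y b ⟩
    b + y  ∎
    where open ≤-Reasoning

  +-monoʳ-≤ : ∀ z {x y} → x ≤ y → z + x ≤ z + y
  +-monoʳ-≤ z = +-mono-≤ ≤-refl

  x≤y⇒0≤y-x : ∀ {x y} → x ≤ y → 0# ≤ y - x
  x≤y⇒0≤y-x {x} x≤y = ≤-respˡ-≈ (-‿inverseʳ x) (+-monoˡ-≤ (- x) x≤y)

  +-nonNegative : ∀ {x y} → 0# ≤ x → 0# ≤ y → 0# ≤ x + y
  +-nonNegative p q = ≤-respˡ-≈ (+-identityʳ 0#) (+-mono-≤ p q)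

  *-monoʳ-≤ : ∀ z {x y} → 0# ≤ z → x ≤ y → z * x ≤ z * y
  *-monoʳ-≤ z {x} {y} 0≤z x≤y = ≤-by (*-nonNegative 0≤z (x≤y⇒0≤y-x x≤y))
    (solve 3 (λ x y z → z :* x :+ z :* (y :- x) := z :* y) refl x y z)

  *-monoˡ-≤ : ∀ z {x y} → 0# ≤ z → x ≤ y → x * z ≤ y * z
  *-monoˡ-≤ z {x} {y} 0≤z x≤y = ≤-respˡ-≈ (*-comm z x) (≤-respʳ-≈ (*-comm z y) (*-monoʳ-≤ z 0≤z x≤y))

  *-mono-≤ : ∀ {a b x y} → 0# ≤ b → 0# ≤ x → a ≤ b → x ≤ y → a * x ≤ b * y
  *-mono-≤ 0≤b 0≤x a≤b x≤y = ≤-trans (*-monoˡ-≤ _ 0≤x a≤b) (*-monoʳ-≤ _ 0≤b x≤y)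

  square-nonNegative : ∀ x → 0# ≤ x * x
  square-nonNegative x with total 0# x
  ... | inj₁ 0≤x = *-nonNegative 0≤x 0≤x
  ... | inj₂ x≤0 = ≤-respʳ-≈ (solve 1 (λ x → (con (0 , 0) :- x) :* (con (0 , 0) :- x) := x :* x) refl x)
                     (*-nonNegative (x≤y⇒0≤y-x x≤0) (x≤y⇒0≤y-x x≤0))

  0≤1 : 0# ≤ 1#
  0≤1 = ≤-respʳ-≈ (*-identityʳ 1#) (square-nonNegative 1#)

  0<1 : 0# < 1#
  0<1 = 0≤1 , 0≉1

  <-≤-trans : ∀ {x y z} → x < y → y ≤ z → x < z
  <-≤-trans (x≤y , x≉y) y≤z = ≤-trans x≤y y≤z ,
    λ x≈z → x≉y (antisym x≤y (≤-respʳ-≈ (sym x≈z) y≤z))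

  <⇒≉0 : ∀ {x} → 0# < x → ¬ (x ≈ 0#)
  <⇒≉0 (_ , 0≉x) x≈0 = 0≉x (sym x≈0)

  ≉0⇒< : ∀ {x} → 0# ≤ x → ¬ (x ≈ 0#) → 0# < x
  ≉0⇒< 0≤x x≉0 = 0≤x , λ 0≈x → x≉0 (sym 0≈x)

  *-positive : ∀ {x y} → 0# < x → 0# < y → 0# < x * y
  *-positive {x} {y} (0≤x , 0≉x) (0≤y , 0≉y) = *-nonNegative 0≤x 0≤y , λ 0≈xy →
    let (x⁻¹ , xx⁻¹≈1) = inverse x (λ x≈0 → 0≉x (sym x≈0)) in
    0≉y (begin-equality
      0#              ≈⟨ zeroˡ x⁻¹ ⟨
      0# * x⁻¹        ≈⟨ *-congʳ 0≈xy ⟩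
      x * y * x⁻¹     ≈⟨ solve 3 (λ x y z → x :* y :* z := x :* z :* y) refl x y x⁻¹ ⟩
      x * x⁻¹ * y     ≈⟨ *-congʳ xx⁻¹≈1 ⟩
      1# * y          ≈⟨ *-identityˡ y ⟩
      y               ∎)
    where open ≤-Reasoning

  *-cancelˡ-≤ : ∀ h {x y} → 0# < h → h * x ≤ h * y → x ≤ y
  *-cancelˡ-≤ h {x} {y} (0≤h , 0≉h) hx≤hy with total x y
  ... | inj₁ x≤y = x≤y
  ... | inj₂ y≤x = ≤-reflexive (begin-equality
    x                ≈⟨ *-identityˡ x ⟨
    1# * x           ≈⟨ *-congʳ hh⁻¹≈1 ⟨
    h * h⁻¹ * x      ≈⟨ rot h⁻¹ x ⟩
    h * x * h⁻¹      ≈⟨ *-congʳ (antisym hx≤hy (*-monoʳ-≤ h 0≤h y≤x)) ⟩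
    h * y * h⁻¹      ≈⟨ rot h⁻¹ y ⟨
    h * h⁻¹ * y      ≈⟨ *-congʳ hh⁻¹≈1 ⟩
    1# * y           ≈⟨ *-identityˡ y ⟩
    y                ∎)
    where
    open ≤-Reasoning
    h⁻¹ = proj₁ (inverse h λ h≈0 → 0≉h (sym h≈0))
    hh⁻¹≈1 = proj₂ (inverse h λ h≈0 → 0≉h (sym h≈0))
    rot : ∀ i x → h * i * x ≈ h * x * i
    rot i x = solve 3 (λ h i x → h :* i :* x := h :* x :* i) refl h i x

  *-cancelˡ-≈ : ∀ h {x y} → 0# < h → h * x ≈ h * y → x ≈ y
  *-cancelˡ-≈ h 0<h eq = antisym (*-cancelˡ-≤ h 0<h (≤-reflexive eq))
                                 (*-cancelˡ-≤ h 0<h (≤-reflexive (sym eq)))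

  ÷-* : ∀ x {y} → ¬ (y ≈ 0#) → (x ÷ y) * y ≈ x
  ÷-* x {y} y≉0 with y ≈? 0#
  ... | yes y≈0 = ⊥-elim (y≉0 y≈0)
  ... | no  y≉  = let (i , yi≈1) = inverse y y≉ in begin-equality
    x * i * y    ≈⟨ solve 3 (λ x i y → x :* i :* y := y :* i :* x) refl x i y ⟩
    y * i * x    ≈⟨ *-congʳ yi≈1 ⟩
    1# * x       ≈⟨ *-identityˡ x ⟩
    x            ∎
    where open ≤-Reasoning

  ÷-unique : ∀ {x y z} → 0# < y → z * y ≈ x → x ÷ y ≈ z
  ÷-unique {x} {y} {z} 0<y eq = *-cancelˡ-≈ y 0<y
    (trans (*-comm y _) (trans (÷-* x (<⇒≉0 0<y)) (trans (sym eq) (*-comm z y))))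

  0≤÷ : ∀ {x y} → 0# ≤ x → 0# < y → 0# ≤ x ÷ y
  0≤÷ {x} {y} 0≤x 0<y = *-cancelˡ-≤ y 0<y
    (≤-respˡ-≈ (sym (zeroʳ y)) (≤-respʳ-≈ (sym (trans (*-comm y _) (÷-* x (<⇒≉0 0<y)))) 0≤x))

  fromℕ-+ : ∀ m n → fromℕ (m ℕ.+ n) ≈ fromℕ m + fromℕ n
  fromℕ-+ = M.×-homo-+ 1#

  fromℕ-* : ∀ m n → fromℕ (m ℕ.* n) ≈ fromℕ m * fromℕ n
  fromℕ-* = M.×1-homo-*

  0≤fromℕ : ∀ n → 0# ≤ fromℕ n
  0≤fromℕ zero    = ≤-refl
  0≤fromℕ (suc n) = +-nonNegative 0≤1 (0≤fromℕ n)

  fromℕ-mono : ∀ {m n} → m ℕ.≤ n → fromℕ m ≤ fromℕ n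
  fromℕ-mono {n = n} ℕ.z≤n = 0≤fromℕ n
  fromℕ-mono (ℕ.s≤s m≤n)   = +-monoʳ-≤ 1# (fromℕ-mono m≤n)

  0<fromℕ-suc : ∀ n → 0# < fromℕ (suc n)
  0<fromℕ-suc n = <-≤-trans 0<1 (≤-by (0≤fromℕ n) refl)

  0≤⟦⟧ : ∀ {p} {P : Set p} (P? : Dec P) → 0# ≤ ⟦ P? ⟧
  0≤⟦⟧ (yes _) = 0≤1
  0≤⟦⟧ (no  _) = ≤-refl

  0≤1-x : ∀ {x} → x ≤ 1# → 0# ≤ 1# - x
  0≤1-x = x≤y⇒0≤y-x

  clip-id : ∀ {x} → 0# ≤ x → x ≤ 1# → clip x ≈ x
  clip-id {x} 0≤x x≤1 with x ≤? 0# | 1# ≤? x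
  ... | yes x≤0 | _       = antisym 0≤x x≤0
  ... | no  _   | yes 1≤x = antisym 1≤x x≤1
  ... | no  _   | no  _   = refl

  0≤clip : ∀ x → 0# ≤ clip x
  0≤clip x with x ≤? 0# | 1# ≤? x
  ... | yes x≤0 | _       = ≤-refl
  ... | no  _   | yes 1≤x = 0≤1
  ... | no  x≰0 | no  _ with total 0# x
  ...   | inj₁ 0≤x = 0≤x
  ...   | inj₂ x≤0 = ⊥-elim (x≰0 x≤0)

  clip≤1 : ∀ x → clip x ≤ 1#
  clip≤1 x with x ≤? 0# | 1# ≤? x
  ... | yes x≤0 | _       = 0≤1
  ... | no  _   | yes 1≤x = ≤-refl
  ... | no  _   | no  1≰x with total x 1#
  ...   | inj₁ x≤1 = x≤1
  ...   | inj₂ 1≤x = ⊥-elim (1≰x 1≤x)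

  clip-1 : ∀ {x} → 1# ≤ x → clip x ≈ 1#
  clip-1 {x} 1≤x with x ≤? 0# | 1# ≤? x
  ... | yes x≤0 | _       = ⊥-elim (0≉1 (antisym 0≤1 (≤-trans 1≤x x≤0)))
  ... | no  _   | yes _   = refl
  ... | no  _   | no  1≰x = ⊥-elim (1≰x 1≤x)

  -- The case split inside `clip` does not respect `≈` by computation, so the two arguments are
  -- compared within each of the three ranges.
  clip-cong : ∀ {x y} → x ≈ y → clip x ≈ clip y
  clip-cong {x} {y} x≈y with total x 0#
  ... | inj₁ x≤0 = trans (low x≤0) (sym (low (≤-respˡ-≈ x≈y x≤0)))
    where
    low : ∀ {x} → x ≤ 0# → clip x ≈ 0#
    low {x} x≤0 with x ≤? 0# | 1# ≤? x
    ... | yes _   | _ = refl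
    ... | no  x≰0 | _ = ⊥-elim (x≰0 x≤0)
  ... | inj₂ 0≤x with total x 1#
  ...   | inj₁ x≤1 = trans (clip-id 0≤x x≤1)
                       (trans x≈y (sym (clip-id (≤-respʳ-≈ x≈y 0≤x) (≤-respˡ-≈ x≈y x≤1))))
  ...   | inj₂ 1≤x = trans (clip-1 1≤x) (sym (clip-1 (≤-respʳ-≈ x≈y 1≤x)))

  mix : Carrier → Carrier → Carrier → Carrier
  mix p x y = p * x + (1# - p) * y

  mix-mono : ∀ {p x x′ y y′} → 0# ≤ p → p ≤ 1# → x ≤ x′ → y ≤ y′ → mix p x y ≤ mix p x′ y′
  mix-mono {p} 0≤p p≤1 x≤x′ y≤y′ = +-mono-≤ (*-monoʳ-≤ p 0≤p x≤x′) (*-monoʳ-≤ _ (0≤1-x p≤1) y≤y′)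

  0≤mix : ∀ {p x y} → 0# ≤ p → p ≤ 1# → 0# ≤ x → 0# ≤ y → 0# ≤ mix p x y
  0≤mix 0≤p p≤1 0≤x 0≤y = +-nonNegative (*-nonNegative 0≤p 0≤x) (*-nonNegative (0≤1-x p≤1) 0≤y)

  mix-congᵖ : ∀ {p p′ x y} → p ≈ p′ → mix p x y ≈ mix p′ x y
  mix-congᵖ p≈p′ = +-cong (*-congʳ p≈p′) (*-congʳ (+-congˡ (-‿cong p≈p′)))

  module _ {a} {A : Set a} where

    ∑-cong : ∀ (xs : List A) {f g} → (∀ x → f x ≈ g x) → ∑ xs f ≈ ∑ xs g
    ∑-cong []       eq = refl
    ∑-cong (x ∷ xs) eq = +-cong (eq x) (∑-cong xs eq)

    ∑-+ : ∀ (xs : List A) f g → ∑ xs (λ x → f x + g x) ≈ ∑ xs f + ∑ xs g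
    ∑-+ []       f g = sym (+-identityʳ 0#)
    ∑-+ (x ∷ xs) f g = trans (+-congˡ (∑-+ xs f g))
      (solve 4 (λ a b c d → (a :+ b) :+ (c :+ d) := (a :+ c) :+ (b :+ d)) refl _ _ _ _)

    ∑-*ˡ : ∀ (xs : List A) c f → ∑ xs (λ x → c * f x) ≈ c * ∑ xs f
    ∑-*ˡ []       c f = sym (zeroʳ c)
    ∑-*ˡ (x ∷ xs) c f = trans (+-congˡ (∑-*ˡ xs c f)) (sym (distribˡ c _ _))

    ∑-mono : ∀ (xs : List A) {f g} → (∀ x → f x ≤ g x) → ∑ xs f ≤ ∑ xs g
    ∑-mono []       f≤g = ≤-refl
    ∑-mono (x ∷ xs) f≤g = +-mono-≤ (f≤g x) (∑-mono xs f≤g)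

    ∑-zero : ∀ (xs : List A) → ∑ xs (λ _ → 0#) ≈ 0#
    ∑-zero []       = refl
    ∑-zero (x ∷ xs) = trans (+-identityˡ _) (∑-zero xs)

    ∑-nonNegative : ∀ (xs : List A) {f} → (∀ x → 0# ≤ f x) → 0# ≤ ∑ xs f
    ∑-nonNegative xs 0≤f = ≤-respˡ-≈ (∑-zero xs) (∑-mono xs 0≤f)

    ∑-++ : ∀ (xs ys : List A) f → ∑ (xs ++ ys) f ≈ ∑ xs f + ∑ ys f
    ∑-++ []       ys f = sym (+-identityˡ _)
    ∑-++ (x ∷ xs) ys f = trans (+-congˡ (∑-++ xs ys f)) (sym (+-assoc _ _ _))

    ∑-map : ∀ {b} {B : Set b} (h : B → A) (xs : List B) f → ∑ (map h xs) f ≈ ∑ xs (λ x → f (h x))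
    ∑-map h []       f = refl
    ∑-map h (x ∷ xs) f = +-congˡ (∑-map h xs f)

    ∑-filter : ∀ {p} {P : A → Set p} (P? : Decidable P) (xs : List A) f →
               ∑ (filter P? xs) f ≈ ∑ xs (λ x → f x * ⟦ P? x ⟧)
    ∑-filter P? []       f = refl
    ∑-filter P? (x ∷ xs) f with P? x
    ... | yes _ = +-cong (sym (*-identityʳ _)) (∑-filter P? xs f)
    ... | no  _ = trans (∑-filter P? xs f) (trans (sym (+-identityˡ _)) (+-congʳ (sym (zeroʳ _))))

    ∏-cong : ∀ (xs : List A) {f g} → (∀ x → f x ≈ g x) → ∏ xs f ≈ ∏ xs g
    ∏-cong []       eq = refl
    ∏-cong (x ∷ xs) eq = *-cong (eq x) (∏-cong xs eq)

    ∏-* : ∀ (xs : List A) f g → ∏ xs (λ x → f x * g x) ≈ ∏ xs f * ∏ xs g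
    ∏-* []       f g = sym (*-identityʳ 1#)
    ∏-* (x ∷ xs) f g = trans (*-congˡ (∏-* xs f g))
      (solve 4 (λ a b c d → (a :* b) :* (c :* d) := (a :* c) :* (b :* d)) refl _ _ _ _)

    ∏-one : ∀ (xs : List A) → ∏ xs (λ _ → 1#) ≈ 1#
    ∏-one []       = refl
    ∏-one (x ∷ xs) = trans (*-identityˡ _) (∏-one xs)

    ∏-positive : ∀ (xs : List A) {f} → (∀ x → 0# < f x) → 0# < ∏ xs f
    ∏-positive []       0<f = 0<1
    ∏-positive (x ∷ xs) 0<f = *-positive (0<f x) (∏-positive xs 0<f)

    ∏-nonNegative : ∀ (xs : List A) {f} → (∀ x → 0# ≤ f x) → 0# ≤ ∏ xs f
    ∏-nonNegative []       0≤f = 0≤1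
    ∏-nonNegative (x ∷ xs) 0≤f = *-nonNegative (0≤f x) (∏-nonNegative xs 0≤f)

    ∏≤1 : ∀ (xs : List A) {f} → (∀ x → 0# ≤ f x) → (∀ x → f x ≤ 1#) → ∏ xs f ≤ 1#
    ∏≤1 []       0≤f f≤1 = ≤-refl
    ∏≤1 (x ∷ xs) 0≤f f≤1 = ≤-respʳ-≈ (*-identityʳ 1#)
      (*-mono-≤ 0≤1 (∏-nonNegative xs 0≤f) (f≤1 x) (∏≤1 xs 0≤f f≤1))

    ∏-++ : ∀ (xs ys : List A) f → ∏ (xs ++ ys) f ≈ ∏ xs f * ∏ ys f
    ∏-++ []       ys f = sym (*-identityˡ _)
    ∏-++ (x ∷ xs) ys f = trans (*-congˡ (∏-++ xs ys f)) (sym (*-assoc _ _ _))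

    ∏-map : ∀ {b} {B : Set b} (h : B → A) (xs : List B) f → ∏ (map h xs) f ≈ ∏ xs (λ x → f (h x))
    ∏-map h []       f = refl
    ∏-map h (x ∷ xs) f = *-congˡ (∏-map h xs f)

    ∏-concatMap : ∀ {b} {B : Set b} (h : B → List A) (xs : List B) f →
                  ∏ (concatMap h xs) f ≈ ∏ xs (λ x → ∏ (h x) f)
    ∏-concatMap h []       f = refl
    ∏-concatMap h (x ∷ xs) f = trans (∏-++ (h x) _ f) (*-congˡ (∏-concatMap h xs f))

    ∏-filter : ∀ {p} {P : A → Set p} (P? : Decidable P) (xs : List A) f →
               ∏ (filter P? xs) f ≈ ∏ xs (λ x → if does (P? x) then f x else 1#)
    ∏-filter P? []       f = refl
    ∏-filter P? (x ∷ xs) f with P? x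
    ... | yes _ = *-congˡ (∏-filter P? xs f)
    ... | no  _ = trans (∏-filter P? xs f) (sym (*-identityˡ _))

  ∏-const : ∀ {a} {A : Set a} (xs : List A) m f g → (∀ x → f x ≈ m * g x) →
            ∏ xs f ≈ ∏ xs (λ _ → m) * ∏ xs g
  ∏-const xs m f g eq = trans (∏-cong xs eq) (∏-* xs (λ _ → m) g)

-- Marks on vertices.

-- A marked vertex has a colour.  A pinned vertex interacts with its
-- neighbours, an active one does not.
data Mark : Set where
  act pin : Spin → Mark

Marks : ℕ → Set
Marks n = List (Fin n × Mark)

colour : Mark → Spin
colour (act s) = s
colour (pin s) = s

find : ∀ {n} → Marks n → Fin n → Maybe Mark
find []            u = nothing
find ((v , m) ∷ L) u = if does (v Fin.≟ u) then just m else find L u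

isAct : Maybe Mark → Bool
isAct (just (act _)) = true
isAct (just (pin _)) = false
isAct nothing        = false

find-here : ∀ {n} (v : Fin n) m L → find ((v , m) ∷ L) v ≡ just m
find-here v m L rewrite dec-true (v Fin.≟ v) ≡.refl = ≡.refl

find-there : ∀ {n} {v u : Fin n} m L → v ≢ u → find ((v , m) ∷ L) u ≡ find L u
find-there {v = v} {u} m L v≢u rewrite dec-false (v Fin.≟ u) v≢u = ≡.refl

opp : Spin → Spin
opp zero       = suc zero
opp (suc zero) = zero

configurations-complete : ∀ {n} (σ : Vec Spin n) → σ ∈ configurations n
configurations-complete Vec.[]               = here ≡.refl
configurations-complete (zero Vec.∷ σ)       =
  ∈-++⁺ˡ (∈-map⁺ (zero Vec.∷_) (configurations-complete σ))
configurations-complete {suc n} (suc zero Vec.∷ σ) =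
  ∈-++⁺ʳ (map (zero Vec.∷_) (configurations n))
    (∈-++⁺ˡ (∈-map⁺ (suc zero Vec.∷_) (configurations-complete σ)))

-- Products over vertices and sums over configurations.

module Products {c ℓ₁ ℓ₂} (F : ArchimedeanOrderedField c ℓ₁ ℓ₂) where
  open OrderedField F
  open Solver

  private module _ {a} {A : Set a} where

    ∏-cong-∉ : ∀ {u} {xs : List A} {f g} → All (u ≢_) xs →
               (∀ v → v ≢ u → f v ≈ g v) → ∏ xs f ≈ ∏ xs g
    ∏-cong-∉ []           eq = refl
    ∏-cong-∉ (u≢x ∷ u≢xs) eq = *-cong (eq _ (u≢x ∘ ≡.sym)) (∏-cong-∉ u≢xs eq)

  -- `Unique xs` ensures that the changed factor occurs exactly once. Changing a single mark in
  -- `vertexWeight` reduces to this.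
  ∏-scale : ∀ {a} {A : Set a} {xs : List A} {u} x {f g} → Unique xs → u ∈ xs →
            (∀ v → v ≢ u → f v ≈ g v) → f u ≈ x * g u → ∏ xs f ≈ x * ∏ xs g
  ∏-scale x (u≢xs ∷ _) (here ≡.refl) eq eqᵤ =
    trans (*-cong eqᵤ (∏-cong-∉ u≢xs eq)) (*-assoc _ _ _)
  ∏-scale x (y≢xs ∷ uniq) (there u∈xs) eq eqᵤ =
    trans (*-cong (eq _ (All.lookup y≢xs u∈xs)) (∏-scale x uniq u∈xs eq eqᵤ))
      (solve 3 (λ a b c → a :* (b :* c) := b :* (a :* c)) refl _ x _)

  module _ {n : ℕ} where
    open Data.List.Membership.DecPropositional (Fin._≟_ {n}) using (_∈?_) public

    ∏-scaleᶠ : ∀ (u : Fin n) x {f g} → (∀ v → v ≢ u → f v ≈ g v) → f u ≈ x * g u →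
               ∏ (allFin n) f ≈ x * ∏ (allFin n) g
    ∏-scaleᶠ u x = ∏-scale x (allFin⁺ n) (∈-allFin u)

    -- Moves a product along an adjacency list to `allFin n`, where the order of the list disappears
    -- and products over edges can be regrouped by either endpoint.
    ∏-∈ : ∀ {us : List (Fin n)} f → Unique us →
          ∏ us f ≈ ∏ (allFin n) (λ x → if does (x ∈? us) then f x else 1#)
    ∏-∈ f []           = sym (∏-one (allFin n))
    ∏-∈ {u ∷ us} f (u≢us ∷ uniq) = trans (*-congˡ (∏-∈ f uniq)) (sym (∏-scaleᶠ u (f u) off on))
      where
      off : ∀ v → v ≢ u → (if does (v ∈? (u ∷ us)) then f v else 1#) ≈ (if does (v ∈? us) then f v else 1#)
      off v v≢u with v Fin.≟ u
      ... | yes v≡u = ⊥-elim (v≢u v≡u)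
      ... | no  _   = refl
      on : (if does (u ∈? (u ∷ us)) then f u else 1#) ≈ f u * (if does (u ∈? us) then f u else 1#)
      on rewrite dec-true (u ∈? (u ∷ us)) (here ≡.refl)
               | dec-false (u ∈? us) (λ u∈us → All.lookup u≢us u∈us ≡.refl) = sym (*-identityʳ _)

    ∏-select : ∀ (v : Fin n) x → ∏ (allFin n) (λ u → if does (u Fin.≟ v) then x else 1#) ≈ x
    ∏-select v x = trans (∏-scaleᶠ v x {g = λ _ → 1#} off on) (trans (*-congˡ (∏-one (allFin n))) (*-identityʳ x))
      where
      off : ∀ u → u ≢ v → (if does (u Fin.≟ v) then x else 1#) ≈ 1#
      off u u≢v rewrite dec-false (u Fin.≟ v) u≢v = refl
      on : (if does (v Fin.≟ v) then x else 1#) ≈ x * 1#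
      on rewrite dec-true (v Fin.≟ v) ≡.refl = sym (*-identityʳ x)

  ∏-zero : ∀ {a} {A : Set a} {xs : List A} {u f} → u ∈ xs → f u ≈ 0# → ∏ xs f ≈ 0#
  ∏-zero (here ≡.refl) eq = trans (*-congʳ eq) (zeroˡ _)
  ∏-zero (there u∈xs)  eq = trans (*-congˡ (∏-zero u∈xs eq)) (zeroʳ _)

  ∑-positive : ∀ {a} {A : Set a} {xs : List A} {u f} → (∀ x → 0# ≤ f x) → u ∈ xs → 0# < f u → 0# < ∑ xs f
  ∑-positive {xs = x ∷ xs} 0≤f (here ≡.refl) 0<fu =
    <-≤-trans 0<fu (≤-by (∑-nonNegative xs 0≤f) refl)
  ∑-positive {xs = x ∷ xs} 0≤f (there u∈xs) 0<fu =
    <-≤-trans (∑-positive 0≤f u∈xs 0<fu) (≤-by (0≤f x) (+-comm _ _))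

  ∑-≉0 : ∀ {a} {A : Set a} (xs : List A) f → ¬ (∑ xs f ≈ 0#) → ∃ λ x → ¬ (f x ≈ 0#)
  ∑-≉0 []       f ≉0 = ⊥-elim (≉0 refl)
  ∑-≉0 (x ∷ xs) f ≉0 with f x ≈? 0#
  ... | no  fx≉0 = x , fx≉0
  ... | yes fx≈0 = ∑-≉0 xs f λ eq → ≉0 (trans (+-cong fx≈0 eq) (+-identityʳ 0#))

  Σ₂ : (Spin → Carrier) → Carrier
  Σ₂ f = f zero + f (suc zero)

  Σ₂-cong : ∀ {f g} → (∀ s → f s ≈ g s) → Σ₂ f ≈ Σ₂ g
  Σ₂-cong eq = +-cong (eq zero) (eq (suc zero))

  ∑-Σ₂ : ∀ {a} {A : Set a} (xs : List A) (f : Spin → A → Carrier) →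
         ∑ xs (λ x → Σ₂ (λ s → f s x)) ≈ Σ₂ (λ s → ∑ xs (f s))
  ∑-Σ₂ xs f = ∑-+ xs (f zero) (f (suc zero))

  Σ₂-⟦≟⟧ : ∀ (f : Spin → Carrier) s → Σ₂ (λ a → f a * ⟦ s Fin.≟ a ⟧) ≈ f s
  Σ₂-⟦≟⟧ f zero       = solve 2 (λ x y → x :* :1 :+ y :* con (0 , 0) := x) refl _ _
  Σ₂-⟦≟⟧ f (suc zero) = solve 2 (λ x y → x :* con (0 , 0) :+ y :* :1 := y) refl _ _

  ∑-configurations : ∀ n f → ∑ (configurations (suc n)) f ≈
                     Σ₂ (λ a → ∑ (configurations n) (λ ρ → f (a Vec.∷ ρ)))
  ∑-configurations n f = trans (∑-++ (map (zero Vec.∷_) (configurations n)) _ f)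
    (+-cong (∑-map (zero Vec.∷_) (configurations n) f)
      (trans (∑-++ (map (suc zero Vec.∷_) (configurations n)) _ f)
        (trans (+-identityʳ _) (∑-map (suc zero Vec.∷_) (configurations n) f))))

  -- As `r` ignores the spin at `v`, both sides are the sum of `r` over the spins of the other
  -- vertices.
  ∑-recolour : ∀ {n} (v : Fin n) (r : Vec Spin n → Carrier) →
               (∀ σ s → r (σ at v ≔ s) ≈ r σ) → ∀ a b →
               ∑ (configurations n) (λ σ → ⟦ lookup σ v Fin.≟ a ⟧ * r σ) ≈
               ∑ (configurations n) (λ σ → ⟦ lookup σ v Fin.≟ b ⟧ * r σ)
  ∑-recolour {suc n} zero r inv a b = trans (half a) (sym (half b))
    where
    half : ∀ a → ∑ (configurations (suc n)) (λ σ → ⟦ lookup σ zero Fin.≟ a ⟧ * r σ) ≈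
                 ∑ (configurations n) (λ ρ → r (zero Vec.∷ ρ))
    half a = trans (∑-configurations n _) (trans (sym (∑-Σ₂ (configurations n) (λ s ρ → ⟦ s Fin.≟ a ⟧ * r (s Vec.∷ ρ))))
      (∑-cong (configurations n) λ ρ → trans (+-congˡ (*-congˡ (sym (inv (suc zero Vec.∷ ρ) zero)))) (one a _)))
      where
      one : ∀ a x → ⟦ zero Fin.≟ a ⟧ * x + ⟦ suc zero Fin.≟ a ⟧ * x ≈ x
      one zero       = solve 1 (λ x → :1 :* x :+ con (0 , 0) :* x := x) refl
      one (suc zero) = solve 1 (λ x → con (0 , 0) :* x :+ :1 :* x := x) refl
  ∑-recolour {suc n} (suc v) r inv a b = trans (∑-configurations n _)
    (trans (Σ₂-cong (λ s → ∑-recolour v (λ ρ → r (s Vec.∷ ρ)) (λ ρ → inv (s Vec.∷ ρ)) a b))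
      (sym (∑-configurations n _)))

-- The Gibbs weight of a marked graph.

module Gibbs {c ℓ₁ ℓ₂} (F : ArchimedeanOrderedField c ℓ₁ ℓ₂) (I : Over.IsingModel F) where
  open OrderedField F
  open Products F
  open Solver
  open Over F
  open IsingModel I public

  -- The edge activity divided by its maximum M is 1 on the compatible pairs
  -- and κ on the others.
  D : Spin → Spin → Bool
  D a b = does (A a (opp b) ≤? A a b)

  κ : Carrier
  -- Literally the clipped quotients that `freeC` tosses, so that `wp-flipκ` matches them case by
  -- case.
  κ = if does (β ≤? 1#) then clip (β ÷ 1#) else clip (1# ÷ β)

  Â : Spin → Spin → Carrier
  Â a b = if D a b then 1# else κ

  M : Carrier
  M = if does (β ≤? 1#) then 1# else β

  0<β : 0# < β
  0<β = β-positive

  β≰1⇒1≤β : ¬ (β ≤ 1#) → 1# ≤ β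
  β≰1⇒1≤β β≰1 with total β 1#
  ... | inj₁ β≤1 = ⊥-elim (β≰1 β≤1)
  ... | inj₂ 1≤β = 1≤β

  κ-cases : (β ≤ 1# × κ ≈ β) ⊎ (1# ≤ β × β * κ ≈ 1#)
  κ-cases with β ≤? 1#
  ... | yes β≤1 = inj₁ (β≤1 , trans (clip-cong β÷1≈β) (clip-id (proj₁ 0<β) β≤1))
    where β÷1≈β = ÷-unique 0<1 (*-identityʳ β)
  ... | no  β≰1 = inj₂ (1≤β , trans (*-congˡ (clip-id 0≤β⁻¹ β⁻¹≤1)) ββ⁻¹≈1)
    where
    1≤β = β≰1⇒1≤β β≰1
    ββ⁻¹≈1 : β * (1# ÷ β) ≈ 1#
    ββ⁻¹≈1 = trans (*-comm β _) (÷-* 1# (<⇒≉0 0<β))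
    0≤β⁻¹ = 0≤÷ 0≤1 0<β
    β⁻¹≤1 : 1# ÷ β ≤ 1#
    β⁻¹≤1 = *-cancelˡ-≤ β 0<β (≤-respˡ-≈ (sym ββ⁻¹≈1) (≤-respʳ-≈ (sym (*-identityʳ β)) 1≤β))

  0<κ : 0# < κ
  0<κ with κ-cases
  ... | inj₁ (_ , κ≈β) = <-≤-trans 0<β (≤-reflexive (sym κ≈β))
  ... | inj₂ (_ , βκ≈1) = ≉0⇒< (*-cancelˡ-≤ β 0<β (≤-respˡ-≈ (sym (zeroʳ β)) (≤-respʳ-≈ (sym βκ≈1) 0≤1)))
    (λ κ≈0 → 0≉1 (trans (sym (zeroʳ β)) (trans (*-congˡ (sym κ≈0)) βκ≈1)))

  0≤κ : 0# ≤ κ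
  0≤κ = proj₁ 0<κ

  κ≤1 : κ ≤ 1#
  κ≤1 with β ≤? 1#
  ... | yes _ = clip≤1 _
  ... | no  _ = clip≤1 _

  0<Â : ∀ a b → 0# < Â a b
  0<Â a b with D a b
  ... | true  = 0<1
  ... | false = 0<κ

  0≤Â : ∀ a b → 0# ≤ Â a b
  0≤Â a b = proj₁ (0<Â a b)

  Â≤1 : ∀ a b → Â a b ≤ 1#
  Â≤1 a b with D a b
  ... | true  = ≤-refl
  ... | false = κ≤1

  κ≤Â : ∀ a b → κ ≤ Â a b
  κ≤Â a b with D a b
  ... | true  = κ≤1
  ... | false = ≤-refl

  Â-sym : ∀ a b → Â a b ≡ Â b a
  Â-sym zero       zero       = ≡.refl
  Â-sym zero       (suc zero) = ≡.refl
  Â-sym (suc zero) zero       = ≡.refl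
  Â-sym (suc zero) (suc zero) = ≡.refl

  0<M : 0# < M
  0<M with β ≤? 1#
  ... | yes _ = 0<1
  ... | no  _ = 0<β

  private
    A-equal : β ≈ M * (if does (1# ≤? β) then 1# else κ)
    A-equal with β ≤? 1# | 1# ≤? β
    ... | yes β≤1 | yes 1≤β = trans (antisym β≤1 1≤β) (sym (*-identityʳ 1#))
    ... | yes β≤1 | no  1≰β = sym (trans (*-identityˡ _) (trans
            (clip-cong (÷-unique 0<1 (*-identityʳ β))) (clip-id (proj₁ 0<β) β≤1)))
    ... | no  β≰1 | yes _   = sym (*-identityʳ β)
    ... | no  β≰1 | no  1≰β = ⊥-elim (1≰β (β≰1⇒1≤β β≰1))

    A-distinct : 1# ≈ M * (if does (β ≤? 1#) then 1# else κ)
    A-distinct with β ≤? 1# | κ-cases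
    ... | yes _   | _ = sym (*-identityʳ 1#)
    ... | no  β≰1 | inj₁ (β≤1 , _)  = ⊥-elim (β≰1 β≤1)
    ... | no  _   | inj₂ (_ , βκ≈1) = sym βκ≈1

  A≈M*Â : ∀ a b → A a b ≈ M * Â a b
  A≈M*Â zero       zero       = A-equal
  A≈M*Â zero       (suc zero) = A-distinct
  A≈M*Â (suc zero) zero       = A-distinct
  A≈M*Â (suc zero) (suc zero) = A-equal

  0<A : ∀ a b → 0# < A a b
  0<A a b = <-≤-trans (*-positive 0<M (0<Â a b)) (≤-reflexive (sym (A≈M*Â a b)))

  -- A quotient of at least 1 means a compatible pair and is clipped to 1; otherwise it is the
  -- smaller entry over the larger, which is κ. Thus one coin handles a pinned neighbour, whether β
  -- lies below or above 1.
  clip-ratio : ∀ a b → clip (A a b ÷ A a (opp b)) ≈ Â a b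
  clip-ratio a b with A a (opp b) ≤? A a b
  ... | yes le = clip-1 (*-cancelˡ-≤ (A a (opp b)) (0<A a (opp b))
          (≤-respˡ-≈ (sym (*-identityʳ _)) (≤-respʳ-≈ (sym (trans (*-comm _ _) (÷-* _ (<⇒≉0 (0<A a (opp b)))))) le)))
  ... | no nle = off a b nle
    where
    off : ∀ a b → ¬ (A a (opp b) ≤ A a b) → clip (A a b ÷ A a (opp b)) ≈ κ
    off zero       zero       nle = same nle where
      same : ¬ (1# ≤ β) → clip (β ÷ 1#) ≈ κ
      same 1≰β with β ≤? 1#
      ... | yes _   = refl
      ... | no  β≰1 = ⊥-elim (1≰β (β≰1⇒1≤β β≰1))
    off (suc zero) (suc zero) nle = off zero zero nle
    off zero       (suc zero) nle with β ≤? 1#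
    ... | yes β≤1 = ⊥-elim (nle β≤1)
    ... | no  _   = refl
    off (suc zero) zero       nle = off zero (suc zero) nle

  -- A mark replaces the field by an indicator instead of multiplying it. The field of a sampled
  -- spin then appears as an explicit factor in `weight-split`, and marks never make the total
  -- weight vanish, even at a colour of field 0.
  φ : Maybe Mark → Fin n → Spin → Carrier
  φ nothing  v a = field-of v a
  φ (just m) v a = ⟦ a Fin.≟ colour m ⟧

  ψ : Bool → Bool → Spin → Spin → Carrier
  ψ g h a b = if g ∨ h then 1# else Â a b

  adjacent : Fin n → Fin n → Bool
  adjacent u x = does (x ∈? neighbors u)

  ε : Marks n → Vec Spin n → Fin n → Fin n → Carrier
  ε L σ u x = if adjacent u x ∧ does (u Fin.<? x)
              then ψ (isAct (find L u)) (isAct (find L x)) (lookup σ u) (lookup σ x) else 1#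

  vertexWeight edgeWeight weight : Marks n → Vec Spin n → Carrier
  vertexWeight L σ = ∏ (allFin n) (λ v → φ (find L v) v (lookup σ v))
  edgeWeight   L σ = ∏ (allFin n) (λ u → ∏ (allFin n) (ε L σ u))
  weight       L σ = vertexWeight L σ * edgeWeight L σ

  interaction : Marks n → List (Fin n) → Spin → Vec Spin n → Carrier
  interaction L us a σ = ∏ us (λ x → ψ false (isAct (find L x)) a (lookup σ x))

  0≤φ : ∀ m v a → 0# ≤ φ m v a
  0≤φ nothing  v a = field-nonNegative v a
  0≤φ (just m) v a = 0≤⟦⟧ (a Fin.≟ colour m)

  0<ψ : ∀ g h a b → 0# < ψ g h a b
  0<ψ g h a b with g ∨ h
  ... | true  = 0<1
  ... | false = 0<Â a b

  ψ≤1 : ∀ g h a b → ψ g h a b ≤ 1#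
  ψ≤1 g h a b with g ∨ h
  ... | true  = ≤-refl
  ... | false = Â≤1 a b

  0<ε : ∀ L σ u x → 0# < ε L σ u x
  0<ε L σ u x with adjacent u x ∧ does (u Fin.<? x)
  ... | true  = 0<ψ (isAct (find L u)) (isAct (find L x)) (lookup σ u) (lookup σ x)
  ... | false = 0<1

  0<edgeWeight : ∀ L σ → 0# < edgeWeight L σ
  0<edgeWeight L σ = ∏-positive (allFin n) λ u → ∏-positive (allFin n) (0<ε L σ u)

  0≤weight : ∀ L σ → 0# ≤ weight L σ
  0≤weight L σ = *-nonNegative (∏-nonNegative (allFin n) λ v → 0≤φ (find L v) v _)
                               (proj₁ (0<edgeWeight L σ))

  0≤interaction : ∀ L us a σ → 0# ≤ interaction L us a σ
  0≤interaction L us a σ = ∏-nonNegative us λ x → proj₁ (0<ψ false (isAct (find L x)) a (lookup σ x))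

  interaction≤1 : ∀ L us a σ → interaction L us a σ ≤ 1#
  interaction≤1 L us a σ = ∏≤1 us (λ x → proj₁ (0<ψ false (isAct (find L x)) a (lookup σ x)))
                                  (λ x → ψ≤1 false (isAct (find L x)) a (lookup σ x))

  weight-cong-φ : ∀ L L′ σ x → vertexWeight L σ ≈ x * vertexWeight L′ σ →
                  edgeWeight L σ ≈ edgeWeight L′ σ → weight L σ ≈ x * weight L′ σ
  weight-cong-φ L L′ σ x eqᵥ eqₑ = trans (*-cong eqᵥ eqₑ) (*-assoc x _ _)

  edgeWeight-cong : ∀ L L′ σ → (∀ u → isAct (find L u) ≡ isAct (find L′ u)) → edgeWeight L σ ≈ edgeWeight L′ σ
  edgeWeight-cong L L′ σ eq = ∏-cong (allFin n) λ u → ∏-cong (allFin n) λ x →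
    reflexive (≡.cong₂ (λ g h → if adjacent u x ∧ does (u Fin.<? x) then ψ g h (lookup σ u) (lookup σ x) else 1#) (eq u) (eq x))

  isAct-pin : ∀ (L : Marks n) u s → isAct (find L u) ≡ false → ∀ x → isAct (find ((u , pin s) ∷ L) x) ≡ isAct (find L x)
  isAct-pin L u s eq x with u Fin.≟ x
  ... | yes ≡.refl = ≡.sym eq
  ... | no  _      = ≡.refl

  vertexWeight-∷ : ∀ L u m σ → find L u ≡ nothing →
    vertexWeight L σ * ⟦ lookup σ u Fin.≟ colour m ⟧ ≈ field-of u (lookup σ u) * vertexWeight ((u , m) ∷ L) σ
  vertexWeight-∷ L u m σ eq = trans (*-comm _ _) (trans
      (sym (∏-scaleᶠ u (⟦ lookup σ u Fin.≟ colour m ⟧) {f = g} off₁ on₁)) (∏-scaleᶠ u (field-of u (lookup σ u)) off₂ on₂))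
    where
    b = ⟦ lookup σ u Fin.≟ colour m ⟧
    -- At `u`, `g` carries both the indicator and the field; extracting one or the other gives the
    -- two sides.
    g : Fin n → Carrier
    g v = if does (v Fin.≟ u) then b * field-of u (lookup σ u) else φ (find L v) v (lookup σ v)
    off₁ : ∀ v → v ≢ u → g v ≈ φ (find L v) v (lookup σ v)
    off₁ v v≢u rewrite dec-false (v Fin.≟ u) v≢u = refl
    on₁ : g u ≈ b * φ (find L u) u (lookup σ u)
    on₁ rewrite dec-true (u Fin.≟ u) ≡.refl | eq = refl
    off₂ : ∀ v → v ≢ u → g v ≈ φ (find ((u , m) ∷ L) v) v (lookup σ v)
    off₂ v v≢u rewrite dec-false (v Fin.≟ u) v≢u | dec-false (u Fin.≟ v) (v≢u ∘ ≡.sym) = refl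
    on₂ : g u ≈ field-of u (lookup σ u) * φ (find ((u , m) ∷ L) u) u (lookup σ u)
    on₂ rewrite dec-true (u Fin.≟ u) ≡.refl = *-comm _ _

  -- The indicators of the two spins at `u` sum to 1. Multiplying by one of them amounts to pinning
  -- `u`, with the field left over as a prefactor.
  weight-split : ∀ L u σ → find L u ≡ nothing →
                 weight L σ ≈ Σ₂ (λ s → field-of u s * weight ((u , pin s) ∷ L) σ)
  weight-split L u σ eq = begin-equality
    weight L σ
      ≈⟨ Σ₂-⟦≟⟧ (λ _ → weight L σ) (lookup σ u) ⟨
    Σ₂ (λ s → weight L σ * ⟦ lookup σ u Fin.≟ s ⟧)
      ≈⟨ Σ₂-cong one ⟩
    Σ₂ (λ s → field-of u s * weight ((u , pin s) ∷ L) σ)  ∎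
    where
    open ≤-Reasoning
    pinned : ∀ s → ¬ (lookup σ u ≡ s) → vertexWeight ((u , pin s) ∷ L) σ ≈ 0#
    pinned s ne = ∏-zero (∈-allFin u) φ≈0
      where
      φ≈0 : φ (find ((u , pin s) ∷ L) u) u (lookup σ u) ≈ 0#
      φ≈0 rewrite dec-true (u Fin.≟ u) ≡.refl | dec-false (lookup σ u Fin.≟ s) ne = refl
    edges-eq : ∀ s → edgeWeight L σ ≈ edgeWeight ((u , pin s) ∷ L) σ
    edges-eq s = edgeWeight-cong L ((u , pin s) ∷ L) σ λ x → ≡.sym (isAct-pin L u s (≡.cong isAct eq) x)
    one : ∀ s → weight L σ * ⟦ lookup σ u Fin.≟ s ⟧ ≈ field-of u s * weight ((u , pin s) ∷ L) σ
    one s with lookup σ u Fin.≟ s in e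
    ... | yes ≡.refl = trans (*-identityʳ _) (weight-cong-φ L ((u , pin (lookup σ u)) ∷ L) σ (field-of u (lookup σ u))
            (trans (sym (*-identityʳ _)) (trans (*-congˡ (reflexive (≡.cong ⟦_⟧ (≡.sym e)))) (vertexWeight-∷ L u (pin (lookup σ u)) σ eq)))
            (edges-eq (lookup σ u)))
    ... | no ne = trans (zeroʳ _) (sym (trans (*-congˡ (trans (*-congʳ (pinned s ne)) (zeroˡ _))) (zeroʳ _)))

  weight-marked : ∀ L u m σ → find L u ≡ just m → ¬ (lookup σ u ≡ colour m) → weight L σ ≈ 0#
  weight-marked L u m σ eq ne = trans (*-congʳ (∏-zero (∈-allFin u) φ≈0)) (zeroˡ _)
    where
    φ≈0 : φ (find L u) u (lookup σ u) ≈ 0#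
    φ≈0 rewrite eq | dec-false (lookup σ u Fin.≟ colour m) ne = refl

  ψ-sym : ∀ g h a b → ψ g h a b ≡ ψ h g b a
  ψ-sym true  true  a b = ≡.refl
  ψ-sym true  false a b = ≡.refl
  ψ-sym false true  a b = ≡.refl
  ψ-sym false false a b = Â-sym a b

  module _ (L : Marks n) (v : Fin n) (a : Spin) (σ : Vec Spin n) (σv≡a : lookup σ v ≡ a) where
    private
      Lᵖ Lᵃ : Marks n
      Lᵖ = (v , pin a) ∷ L
      Lᵃ = (v , act a) ∷ L

      -- As `ε` counts an edge at its smaller endpoint, an edge at `v` lies in the row or in the
      -- column of `v`, never in both; outside them `Lᵖ` and `Lᵃ` give the same factors.
      row col : Fin n → Carrier
      row x = ε Lᵖ σ v x
      col u = ε Lᵖ σ u v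

      loop : ∀ L → ε L σ v v ≈ 1#
      loop L rewrite dec-false (v ∈? neighbors v) (loopless v) = refl

      inactiveˡ : ∀ x → ε Lᵃ σ v x ≈ 1#
      inactiveˡ x rewrite find-here v (act a) L with adjacent v x ∧ does (v Fin.<? x)
      ... | true  = refl
      ... | false = refl

      inactiveʳ : ∀ x → ε Lᵃ σ x v ≈ 1#
      inactiveʳ x rewrite find-here v (act a) L with adjacent x v ∧ does (x Fin.<? v)
      ... | false = refl
      ... | true with isAct (find Lᵃ x)
      ...   | true  = refl
      ...   | false = refl

      pointwise : ∀ u x → ε Lᵖ σ u x ≈ ε Lᵃ σ u x *
        ((if does (u Fin.≟ v) then row x else 1#) * (if does (x Fin.≟ v) then col u else 1#))
      pointwise u x with u Fin.≟ v | x Fin.≟ v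
      ... | yes ≡.refl | yes ≡.refl = trans (loop Lᵖ) (sym (trans (*-cong (loop Lᵃ)
              (trans (*-cong (loop Lᵖ) (loop Lᵖ)) (*-identityʳ 1#))) (*-identityʳ 1#)))
      ... | yes ≡.refl | no _ = sym (trans (*-cong (inactiveˡ x) (*-identityʳ _)) (*-identityˡ _))
      ... | no _ | yes ≡.refl = sym (trans (*-cong (inactiveʳ u) (*-identityˡ _)) (*-identityˡ _))
      ... | no u≢v | no x≢v = trans (reflexive (≡.cong₂
              (λ g h → if adjacent u x ∧ does (u Fin.<? x) then ψ (isAct g) (isAct h) (lookup σ u) (lookup σ x) else 1#)
              (same u≢v) (same x≢v)))
              (sym (trans (*-congˡ (*-identityʳ 1#)) (*-identityʳ _)))
        where
        same : ∀ {u} → u ≢ v → find Lᵖ u ≡ find Lᵃ u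
        same u≢v = ≡.trans (find-there (pin a) L (u≢v ∘ ≡.sym)) (≡.sym (find-there (act a) L (u≢v ∘ ≡.sym)))

      rows : ∏ (allFin n) (λ u → ∏ (allFin n) (λ x → if does (u Fin.≟ v) then row x else 1#)) ≈ ∏ (allFin n) row
      rows = trans (∏-cong (allFin n) one) (∏-select v _)
        where
        one : ∀ u → ∏ (allFin n) (λ x → if does (u Fin.≟ v) then row x else 1#) ≈
                    (if does (u Fin.≟ v) then ∏ (allFin n) row else 1#)
        one u with does (u Fin.≟ v)
        ... | true  = refl
        ... | false = ∏-one (allFin n)

      incident : ∀ x → row x * col x ≈
        (if does (x ∈? neighbors v) then ψ false (isAct (find Lᵃ x)) a (lookup σ x) else 1#)
      incident x with x ∈? neighbors v
      ... | no  x∉ rewrite dec-false (v ∈? neighbors x) (x∉ ∘ symmetric) = *-identityʳ 1#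
      ... | yes x∈ rewrite dec-true (v ∈? neighbors x) (symmetric x∈) with Fin.<-cmp v x
      ...   | tri≈ _ ≡.refl _ = ⊥-elim (loopless v x∈)
      ...   | tri< v<x v≢x x≮v rewrite dec-true (v Fin.<? x) v<x | dec-false (x Fin.<? v) x≮v
                                     | find-here v (pin a) L | find-there (pin a) L v≢x | find-there (act a) L v≢x | σv≡a
              = *-identityʳ _
      ...   | tri> v≮x v≢x x<v rewrite dec-false (v Fin.<? x) v≮x | dec-true (x Fin.<? v) x<v
                                     | find-here v (pin a) L | find-there (pin a) L v≢x | find-there (act a) L v≢x | σv≡a
              = trans (*-identityˡ _) (reflexive (ψ-sym (isAct (find L x)) false (lookup σ x) a))

    edgeWeight-pin : edgeWeight Lᵖ σ ≈ edgeWeight Lᵃ σ * interaction Lᵃ (neighbors v) a σ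
    edgeWeight-pin = begin-equality
      edgeWeight Lᵖ σ
        ≈⟨ ∏-cong (allFin n) (λ u → trans (∏-cong (allFin n) (pointwise u))
             (trans (∏-* (allFin n) (ε Lᵃ σ u) _) (*-congˡ (∏-* (allFin n) _ _)))) ⟩
      ∏ (allFin n) (λ u → ∏ (allFin n) (ε Lᵃ σ u) *
        (∏ (allFin n) (λ x → if does (u Fin.≟ v) then row x else 1#) *
         ∏ (allFin n) (λ x → if does (x Fin.≟ v) then col u else 1#)))
        ≈⟨ trans (∏-* (allFin n) _ _) (*-congˡ (∏-* (allFin n) _ _)) ⟩
      edgeWeight Lᵃ σ *
        (∏ (allFin n) (λ u → ∏ (allFin n) (λ x → if does (u Fin.≟ v) then row x else 1#)) *
         ∏ (allFin n) (λ u → ∏ (allFin n) (λ x → if does (x Fin.≟ v) then col u else 1#)))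
        ≈⟨ *-congˡ (*-cong rows (∏-cong (allFin n) (λ u → ∏-select v (col u)))) ⟩
      edgeWeight Lᵃ σ * (∏ (allFin n) row * ∏ (allFin n) col)
        ≈⟨ *-congˡ (∏-* (allFin n) row col) ⟨
      edgeWeight Lᵃ σ * ∏ (allFin n) (λ x → row x * col x)
        ≈⟨ *-congˡ (trans (∏-cong (allFin n) incident) (sym (∏-∈ _ (unique v)))) ⟩
      edgeWeight Lᵃ σ * interaction Lᵃ (neighbors v) a σ  ∎
      where open ≤-Reasoning

  φ-act-pin : ∀ (L : Marks n) v a u s → φ (find ((v , act a) ∷ L) u) u s ≡ φ (find ((v , pin a) ∷ L) u) u s
  φ-act-pin L v a u s with does (v Fin.≟ u)
  ... | true  = ≡.refl
  ... | false = ≡.refl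

  -- If `σ` has another spin at `v`, the indicator kills both sides; otherwise the two marks differ
  -- only in the edges at `v`.
  weight-pin : ∀ (L : Marks n) v a σ → weight ((v , pin a) ∷ L) σ ≈
               weight ((v , act a) ∷ L) σ * interaction ((v , act a) ∷ L) (neighbors v) a σ
  weight-pin L v a σ with lookup σ v Fin.≟ a
  ... | no ne = trans (weight-marked ((v , pin a) ∷ L) v (pin a) σ (find-here v (pin a) L) ne)
        (sym (trans (*-congʳ (weight-marked ((v , act a) ∷ L) v (act a) σ (find-here v (act a) L) ne)) (zeroˡ _)))
  ... | yes eq = trans (*-cong
        (∏-cong (allFin n) (λ u → reflexive (≡.sym (φ-act-pin L v a u (lookup σ u)))))
        (edgeWeight-pin L v a σ eq)) (sym (*-assoc _ _ _))

  ⟨_⟩ : (Vec Spin n → Carrier) → Marks n → Carrier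
  ⟨ f ⟩ L = ∑ (configurations n) (λ σ → weight L σ * f σ)

  H : Marks n → Carrier
  H L = ⟨ (λ _ → 1#) ⟩ L

  -- An active vertex has neither edges nor field, so its colour enters only through an indicator,
  -- and `∑-recolour` exchanges the colours. This makes rejection exact: the normalisation of a
  -- trial is the same for both proposals.
  H-act : ∀ (L : Marks n) v a b → H ((v , act a) ∷ L) ≈ H ((v , act b) ∷ L)
  H-act L v a b = trans (∑-cong (configurations n) (factor a))
    (trans (∑-recolour v r inv a b) (sym (∑-cong (configurations n) (factor b))))
    where
    g : Fin n → Bool
    g u = if does (v Fin.≟ u) then true else isAct (find L u)
    r₁ r₂ r : Vec Spin n → Carrier
    r₁ σ = ∏ (allFin n) (λ u → if does (v Fin.≟ u) then 1# else φ (find L u) u (lookup σ u))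
    r₂ σ = ∏ (allFin n) (λ u → ∏ (allFin n) (λ x →
             if adjacent u x ∧ does (u Fin.<? x) then ψ (g u) (g x) (lookup σ u) (lookup σ x) else 1#))
    r σ = r₁ σ * r₂ σ
    isAct-g : ∀ a u → isAct (find ((v , act a) ∷ L) u) ≡ g u
    isAct-g a u with does (v Fin.≟ u)
    ... | true  = ≡.refl
    ... | false = ≡.refl
    factor : ∀ a σ → weight ((v , act a) ∷ L) σ * 1# ≈ ⟦ lookup σ v Fin.≟ a ⟧ * r σ
    factor a σ = trans (*-identityʳ _) (trans (*-cong
        (∏-scaleᶠ v (⟦ lookup σ v Fin.≟ a ⟧) off on)
        (∏-cong (allFin n) λ u → ∏-cong (allFin n) λ x → reflexive (≡.cong₂
          (λ p q → if adjacent u x ∧ does (u Fin.<? x) then ψ p q (lookup σ u) (lookup σ x) else 1#)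
          (isAct-g a u) (isAct-g a x))))
      (*-assoc _ _ _))
      where
      off : ∀ u → u ≢ v → φ (find ((v , act a) ∷ L) u) u (lookup σ u) ≈
                          (if does (v Fin.≟ u) then 1# else φ (find L u) u (lookup σ u))
      off u u≢v rewrite dec-false (v Fin.≟ u) (u≢v ∘ ≡.sym) = refl
      on : φ (find ((v , act a) ∷ L) v) v (lookup σ v) ≈
           ⟦ lookup σ v Fin.≟ a ⟧ * (if does (v Fin.≟ v) then 1# else φ (find L v) v (lookup σ v))
      on rewrite dec-true (v Fin.≟ v) ≡.refl = sym (*-identityʳ _)
    inv : ∀ σ s → r (σ at v ≔ s) ≈ r σ
    inv σ s = *-cong
      (∏-cong (allFin n) inv₁)
      (∏-cong (allFin n) λ u → ∏-cong (allFin n) λ x → inv₂ u x (adjacent u x ∧ does (u Fin.<? x)))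
      where
      inv₁ : ∀ u → (if does (v Fin.≟ u) then 1# else φ (find L u) u (lookup (σ at v ≔ s) u)) ≈
                   (if does (v Fin.≟ u) then 1# else φ (find L u) u (lookup σ u))
      inv₁ u with v Fin.≟ u
      ... | yes _  = refl
      ... | no v≢u = reflexive (≡.cong (φ (find L u) u) (Vec.lookup∘updateAt′ u v (v≢u ∘ ≡.sym) σ))
      inv₂ : ∀ u x (b : Bool) →
        (if b then ψ (g u) (g x) (lookup (σ at v ≔ s) u) (lookup (σ at v ≔ s) x) else 1#) ≈
        (if b then ψ (g u) (g x) (lookup σ u) (lookup σ x) else 1#)
      inv₂ u x false = refl
      inv₂ u x true with v Fin.≟ u | v Fin.≟ x
      ... | yes _ | _ = refl
      ... | no _ | yes _ with isAct (find L u)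
      ...   | true  = refl
      ...   | false = refl
      inv₂ u x true | no v≢u | no v≢x = reflexive (≡.cong₂ (ψ (isAct (find L u)) (isAct (find L x)))
        (Vec.lookup∘updateAt′ u v (v≢u ∘ ≡.sym) σ) (Vec.lookup∘updateAt′ x v (v≢x ∘ ≡.sym) σ))

Nondegenerate : ∀ {c ℓ₁ ℓ₂} (F : ArchimedeanOrderedField c ℓ₁ ℓ₂) → Over.IsingModel F → Set ℓ₁
Nondegenerate F I = ¬ (Z ≈ 0#)
  where
  open ArchimedeanOrderedField F
  open Over.IsingModel I

-- Conditional laws and the survival probability of a trial.

module Conditional {c ℓ₁ ℓ₂} (F : ArchimedeanOrderedField c ℓ₁ ℓ₂) (I : Over.IsingModel F)
                   (Z≉0 : Nondegenerate F I) where
  open OrderedField F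
  open Products F
  open Solver
  open Gibbs F I public

  C : Carrier
  C = ∏ edges (λ _ → M)

  0<C : 0# < C
  0<C = ∏-positive edges λ _ → 0<M

  ∏-edges : ∀ f → ∏ edges f ≈ ∏ (allFin n) (λ u → ∏ (allFin n) (λ x →
              if adjacent u x ∧ does (u Fin.<? x) then f (u , x) else 1#))
  ∏-edges f = trans (∏-concatMap (λ u → map (u ,_) (filter (u Fin.<?_) (neighbors u))) (allFin n) f)
    (∏-cong (allFin n) λ u → trans (∏-map (u ,_) (filter (u Fin.<?_) (neighbors u)) f)
      (trans (∏-filter (u Fin.<?_) (neighbors u) _)
        (trans (∏-∈ _ (unique u)) (∏-cong (allFin n) λ x →
          reflexive (if-∧ (adjacent u x) (does (u Fin.<? x)) (f (u , x)))))))
    where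
    if-∧ : ∀ b b′ (y : Carrier) → (if b then (if b′ then y else 1#) else 1#) ≡ (if b ∧ b′ then y else 1#)
    if-∧ true  b′ y = ≡.refl
    if-∧ false b′ y = ≡.refl

  w≈C*weight : ∀ σ → w σ ≈ C * weight [] σ
  w≈C*weight σ = trans (*-congˡ (trans
      (∏-const edges M _ (λ (u , v) → Â (lookup σ u) (lookup σ v)) (λ (u , v) → A≈M*Â (lookup σ u) (lookup σ v)))
      (*-congˡ (∏-edges (λ (u , v) → Â (lookup σ u) (lookup σ v))))))
    (solve 3 (λ x y z → x :* (y :* z) := y :* (x :* z)) refl _ _ _)

  private
    -- A nonzero summand of `Z` has a spin of positive field at every vertex; hence `proposal` is a
    -- probability and `H` is positive.
    σ⁺-exists : ∃ λ σ → ¬ (w σ ≈ 0#)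
    σ⁺-exists = ∑-≉0 (configurations n) w Z≉0

    σ⁺ : Vec Spin n
    σ⁺ = proj₁ σ⁺-exists

    field⁺ : ∀ v → 0# < field-of v (lookup σ⁺ v)
    field⁺ v = ≉0⇒< (field-nonNegative v _) λ eq → proj₂ σ⁺-exists
      (trans (*-congʳ (∏-zero (∈-allFin v) eq)) (zeroˡ _))

  totalField : Fin n → Carrier
  totalField v = Σ₂ (field-of v)

  0<totalField : ∀ v → 0# < totalField v
  0<totalField v with lookup σ⁺ v | field⁺ v
  ... | zero     | 0<f = <-≤-trans 0<f (≤-by (field-nonNegative v _) refl)
  ... | suc zero | 0<f = <-≤-trans 0<f (≤-by (field-nonNegative v _) (+-comm _ _))

  Agrees : Spin → Maybe Mark → Set
  Agrees s nothing  = ⊤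
  Agrees s (just m) = s ≡ colour m

  agrees? : ∀ s m → Dec (Agrees s m)
  agrees? s nothing  = yes _
  agrees? s (just m) = s Fin.≟ colour m

  Satisfies : Marks n → Vec Spin n → Set
  Satisfies L σ = ∀ v → Agrees (lookup σ v) (find L v)

  satisfies-or-null : ∀ L σ → Satisfies L σ ⊎ (weight L σ ≈ 0#)
  satisfies-or-null L σ with Fin.all? (λ v → agrees? (lookup σ v) (find L v))
  ... | yes all = inj₁ all
  ... | no ¬all with Fin.¬∀⟶∃¬ n (λ v → Agrees (lookup σ v) (find L v)) (λ v → agrees? (lookup σ v) (find L v)) ¬all
  ...   | v , ¬agree with find L v in eq
  ...     | nothing = ⊥-elim (¬agree _)
  ...     | just m  = inj₂ (weight-marked L v m σ eq ¬agree)

  -- One configuration of positive weight suffices: marked vertices take their colours, the others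
  -- their spins in `σ⁺`.
  0<H : ∀ L → 0# < H L
  0<H L = ∑-positive (λ σ → *-nonNegative (0≤weight L σ) 0≤1) (configurations-complete σ)
    (*-positive (*-positive (∏-positive (allFin n) 0<φ) (0<edgeWeight L σ)) 0<1)
    where
    s : Maybe Mark → Fin n → Spin
    s nothing  v = lookup σ⁺ v
    s (just m) v = colour m
    σ : Vec Spin n
    σ = tabulate (λ v → s (find L v) v)
    0<φ : ∀ v → 0# < φ (find L v) v (lookup σ v)
    0<φ v rewrite Vec.lookup∘tabulate (λ v → s (find L v) v) v with find L v
    ... | nothing = field⁺ v
    ... | just m rewrite dec-true (colour m Fin.≟ colour m) ≡.refl = 0<1

  -- From here on `E` and `P` are known only through the laws proved in this block.
  abstract
    private
      H⁻¹ : Marks n → Carrier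
      H⁻¹ L = 1# ÷ H L

      H⁻¹*H : ∀ L → H⁻¹ L * H L ≈ 1#
      H⁻¹*H L = ÷-* 1# (<⇒≉0 (0<H L))

      0≤H⁻¹ : ∀ L → 0# ≤ H⁻¹ L
      0≤H⁻¹ L = 0≤÷ 0≤1 (0<H L)

    -- E conditions on the marks; P is the resulting law of an unmarked spin.
    E : (Vec Spin n → Carrier) → Marks n → Carrier
    E f L = ⟨ f ⟩ L * H⁻¹ L

    P : Marks n → Fin n → Spin → Carrier
    P L u s = field-of u s * H ((u , pin s) ∷ L) * H⁻¹ L

    E-cong : ∀ L {f g} → (∀ σ → Satisfies L σ → f σ ≈ g σ) → E f L ≈ E g L
    E-cong L {f} {g} eq = *-congʳ (∑-cong (configurations n) one)
      where
      one : ∀ σ → weight L σ * f σ ≈ weight L σ * g σ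
      one σ with satisfies-or-null L σ
      ... | inj₁ sat  = *-congˡ (eq σ sat)
      ... | inj₂ null = trans (trans (*-congʳ null) (zeroˡ _)) (sym (trans (*-congʳ null) (zeroˡ _)))

    E-mono : ∀ L {f g} → (∀ σ → f σ ≤ g σ) → E f L ≤ E g L
    E-mono L f≤g = *-monoˡ-≤ (H⁻¹ L) (0≤H⁻¹ L) (∑-mono (configurations n) λ σ → *-monoʳ-≤ _ (0≤weight L σ) (f≤g σ))

    E-one : ∀ L → E (λ _ → 1#) L ≈ 1#
    E-one L = trans (*-comm _ _) (H⁻¹*H L)

    E-* : ∀ L c f → E (λ σ → c * f σ) L ≈ c * E f L
    E-* L c f = trans (*-congʳ (trans (∑-cong (configurations n) λ σ →
        solve 3 (λ x y z → x :* (y :* z) := y :* (x :* z)) refl (weight L σ) c (f σ))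
        (∑-*ˡ (configurations n) c _))) (*-assoc _ _ _)

    E-+ : ∀ L f g → E (λ σ → f σ + g σ) L ≈ E f L + E g L
    E-+ L f g = trans (*-congʳ (trans (∑-cong (configurations n) λ σ → distribˡ (weight L σ) (f σ) (g σ))
      (∑-+ (configurations n) _ _))) (distribʳ (H⁻¹ L) _ _)

    E-empty : ∀ f → E f [] ≈ ∑ (configurations n) (λ σ → μ σ * f σ)
    E-empty f = begin-equality
      ∑ (configurations n) (λ σ → weight [] σ * f σ) * H⁻¹ []
        ≈⟨ trans (*-comm _ _) (sym (∑-*ˡ (configurations n) (H⁻¹ []) _)) ⟩
      ∑ (configurations n) (λ σ → H⁻¹ [] * (weight [] σ * f σ))
        ≈⟨ ∑-cong (configurations n) (λ σ → trans (solve 3 (λ x y z → x :* (y :* z) := (y :* x) :* z) refl (H⁻¹ []) (weight [] σ) (f σ))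
             (*-congʳ (sym (μ≈ σ)))) ⟩
      ∑ (configurations n) (λ σ → μ σ * f σ)  ∎
      where
      open ≤-Reasoning
      Z≈ : Z ≈ C * H []
      Z≈ = trans (∑-cong (configurations n) λ σ → trans (w≈C*weight σ) (*-congˡ (sym (*-identityʳ _))))
                 (∑-*ˡ (configurations n) C _)
      μ≈ : ∀ σ → μ σ ≈ weight [] σ * H⁻¹ []
      μ≈ σ = ÷-unique (<-≤-trans (*-positive 0<C (0<H [])) (≤-reflexive (sym Z≈))) (begin-equality
        weight [] σ * H⁻¹ [] * Z         ≈⟨ *-congˡ Z≈ ⟩
        weight [] σ * H⁻¹ [] * (C * H []) ≈⟨ solve 4 (λ x y z u → x :* y :* (z :* u) := z :* x :* (y :* u)) refl _ _ _ _ ⟩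
        C * weight [] σ * (H⁻¹ [] * H []) ≈⟨ trans (*-congˡ (H⁻¹*H [])) (*-identityʳ _) ⟩
        C * weight [] σ                  ≈⟨ w≈C*weight σ ⟨
        w σ                              ∎)

    0≤P : ∀ L u s → 0# ≤ P L u s
    0≤P L u s = *-nonNegative (*-nonNegative (field-nonNegative u s) (proj₁ (0<H ((u , pin s) ∷ L)))) (0≤H⁻¹ L)

    -- The law of total expectation over the spin of `u`. Iterated, it is the chain rule that lets
    -- vertices be sampled one after another, each given the pins so far.
    E-split : ∀ L u f → find L u ≡ nothing → E f L ≈ Σ₂ (λ s → P L u s * E f ((u , pin s) ∷ L))
    E-split L u f free = begin-equality
      ⟨ f ⟩ L * H⁻¹ L
        ≈⟨ *-congʳ (trans (∑-cong (configurations n) expand) (∑-Σ₂ (configurations n) (λ s σ → field-of u s * (weight (Lˢ s) σ * f σ)))) ⟩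
      Σ₂ (λ s → ∑ (configurations n) (λ σ → field-of u s * (weight (Lˢ s) σ * f σ))) * H⁻¹ L
        ≈⟨ trans (*-comm _ (H⁻¹ L)) (distribˡ (H⁻¹ L) _ _) ⟩
      Σ₂ (λ s → H⁻¹ L * ∑ (configurations n) (λ σ → field-of u s * (weight (Lˢ s) σ * f σ)))
        ≈⟨ Σ₂-cong (λ s → *-congˡ {H⁻¹ L} (∑-*ˡ (configurations n) (field-of u s) (λ σ → weight (Lˢ s) σ * f σ))) ⟩
      Σ₂ (λ s → H⁻¹ L * (field-of u s * ⟨ f ⟩ (Lˢ s)))
        ≈⟨ Σ₂-cong (λ s → normalise s) ⟩
      Σ₂ (λ s → P L u s * E f (Lˢ s))  ∎
      where
      open ≤-Reasoning
      Lˢ : Spin → Marks n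
      Lˢ s = (u , pin s) ∷ L
      expand : ∀ σ → weight L σ * f σ ≈ Σ₂ (λ s → field-of u s * (weight (Lˢ s) σ * f σ))
      expand σ = trans (*-congʳ (weight-split L u σ free))
        (solve 5 (λ a b c d f → (a :* b :+ c :* d) :* f := a :* (b :* f) :+ c :* (d :* f)) refl _ _ _ _ _)
      normalise : ∀ s → H⁻¹ L * (field-of u s * ⟨ f ⟩ (Lˢ s)) ≈ P L u s * E f (Lˢ s)
      normalise s = sym (trans
        (solve 5 (λ a h i g k → a :* h :* i :* (g :* k) := i :* (a :* g) :* (k :* h)) refl
          (field-of u s) (H (Lˢ s)) (H⁻¹ L) (⟨ f ⟩ (Lˢ s)) (H⁻¹ (Lˢ s)))
        (trans (*-congˡ (H⁻¹*H (Lˢ s))) (*-identityʳ _)))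

    -- Since the weights do not depend on the colour of an active vertex, the
    -- last factor is the same for both spins.
    P-act : ∀ L v → ∃ λ h → ∀ a → P L v a ≈
            field-of v a * E (interaction ((v , act a) ∷ L) (neighbors v) a) ((v , act a) ∷ L) * h
    P-act L v = H ((v , act zero) ∷ L) * H⁻¹ L , λ a → let Lᵃ = (v , act a) ∷ L ; K = interaction Lᵃ (neighbors v) a in
      begin-equality
      field-of v a * H ((v , pin a) ∷ L) * H⁻¹ L
        ≈⟨ *-congʳ (*-congˡ (∑-cong (configurations n) (λ σ → trans (*-identityʳ _) (weight-pin L v a σ)))) ⟩
      field-of v a * ⟨ K ⟩ Lᵃ * H⁻¹ L
        ≈⟨ *-congʳ (*-congˡ (trans (*-congˡ (H⁻¹*H Lᵃ)) (*-identityʳ _))) ⟨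
      field-of v a * (⟨ K ⟩ Lᵃ * (H⁻¹ Lᵃ * H Lᵃ)) * H⁻¹ L
        ≈⟨ *-congʳ (*-congˡ (*-congˡ (*-congˡ (H-act L v a zero)))) ⟩
      field-of v a * (⟨ K ⟩ Lᵃ * (H⁻¹ Lᵃ * H ((v , act zero) ∷ L))) * H⁻¹ L
        ≈⟨ solve 5 (λ a b c d e → a :* (b :* (c :* d)) :* e := a :* (b :* c) :* (d :* e)) refl _ _ _ _ _ ⟩
      field-of v a * E K Lᵃ * (H ((v , act zero) ∷ L) * H⁻¹ L)  ∎
      where open ≤-Reasoning

  ΣP≈1 : ∀ L u → find L u ≡ nothing → Σ₂ (P L u) ≈ 1#
  ΣP≈1 L u free = trans (Σ₂-cong {P L u} {λ s → P L u s * E (λ _ → 1#) ((u , pin s) ∷ L)}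
      λ s → trans (sym (*-identityʳ _)) (*-congˡ (sym (E-one ((u , pin s) ∷ L)))))
    (trans (sym (E-split L u (λ _ → 1#) free)) (E-one L))

  -- The probability that a trial of an active vertex of colour a succeeds
  -- when its neighbours us remain to be examined.
  survival : Marks n → List (Fin n) → Spin → Carrier
  survival L us a = E (interaction L us a) L

  survival-[] : ∀ L a → survival L [] a ≈ 1#
  survival-[] L a = E-one L

  0≤survival : ∀ L us a → 0# ≤ survival L us a
  0≤survival L us a = ≤-respˡ-≈ (trans (E-* L 0# (λ _ → 1#)) (zeroˡ _))
    (E-mono L λ σ → ≤-respˡ-≈ (sym (zeroˡ _)) (0≤interaction L us a σ))

  survival≤1 : ∀ L us a → survival L us a ≤ 1#
  survival≤1 L us a = ≤-respʳ-≈ (E-one L) (E-mono L (interaction≤1 L us a))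

  survival-act : ∀ L u us a → isAct (find L u) ≡ true → survival L (u ∷ us) a ≈ survival L us a
  survival-act L u us a eq = E-cong L λ σ _ → trans
    (*-congʳ (reflexive (≡.cong (λ g → ψ false g a (lookup σ u)) eq))) (*-identityˡ _)

  survival-pin : ∀ L u us a s → find L u ≡ just (pin s) → survival L (u ∷ us) a ≈ Â a s * survival L us a
  survival-pin L u us a s eq = trans (E-cong L λ σ sat → *-congʳ (one σ sat)) (E-* L (Â a s) _)
    where
    one : ∀ σ → Satisfies L σ → ψ false (isAct (find L u)) a (lookup σ u) ≈ Â a s
    one σ sat = reflexive (≡.cong₂ (λ m b → ψ false (isAct m) a b) eq (≡.subst (Agrees (lookup σ u)) eq (sat u)))

  -- This is `E-split` over the spin of `u`, combined with `Â = κ + (1 − κ) D`. The two terms are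
  -- the outcomes of the coin: pass unseen, or sample `u` and compare.
  survival-free : ∀ L u us a → find L u ≡ nothing → survival L (u ∷ us) a ≈
    κ * survival L us a + (1# - κ) * Σ₂ (λ s → P L u s * (if D a s then survival ((u , pin s) ∷ L) us a else 0#))
  survival-free L u us a free = begin-equality
    survival L (u ∷ us) a
      ≈⟨ E-split L u _ free ⟩
    Σ₂ (λ s → P L u s * E (interaction L (u ∷ us) a) ((u , pin s) ∷ L))
      ≈⟨ Σ₂-cong (λ s → *-congˡ {P L u s} (pinned s)) ⟩
    Σ₂ (λ s → P L u s * (Â a s * E (interaction L us a) ((u , pin s) ∷ L)))
      ≈⟨ Σ₂-cong (λ s → *-congˡ {P L u s} (dichotomy s)) ⟩
    Σ₂ (λ s → P L u s * (κ * E (interaction L us a) ((u , pin s) ∷ L) +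
       (1# - κ) * (if D a s then survival ((u , pin s) ∷ L) us a else 0#)))
      ≈⟨ solve 7 (λ p q x y k u v → p :* (k :* x :+ (:1 :- k) :* u) :+ q :* (k :* y :+ (:1 :- k) :* v) :=
                   k :* (p :* x :+ q :* y) :+ (:1 :- k) :* (p :* u :+ q :* v)) refl _ _ _ _ _ _ _ ⟩
    κ * Σ₂ (λ s → P L u s * E (interaction L us a) ((u , pin s) ∷ L)) +
    (1# - κ) * Σ₂ (λ s → P L u s * (if D a s then survival ((u , pin s) ∷ L) us a else 0#))
      -- In the first term the spin of `u` is averaged out again, so the trial goes on without a
      -- mark on `u`.
      ≈⟨ +-congʳ (*-congˡ (sym (E-split L u (interaction L us a) free))) ⟩
    κ * survival L us a + (1# - κ) * Σ₂ (λ s → P L u s * (if D a s then survival ((u , pin s) ∷ L) us a else 0#))  ∎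
    where
    open ≤-Reasoning
    pinned : ∀ s → E (interaction L (u ∷ us) a) ((u , pin s) ∷ L) ≈ Â a s * E (interaction L us a) ((u , pin s) ∷ L)
    pinned s = trans (E-cong _ λ σ sat → *-congʳ (one σ (sat u))) (E-* _ (Â a s) _)
      where
      one : ∀ σ → Agrees (lookup σ u) (find ((u , pin s) ∷ L) u) → ψ false (isAct (find L u)) a (lookup σ u) ≈ Â a s
      one σ agree = reflexive (≡.cong₂ (λ m b → ψ false (isAct m) a b) free
        (≡.subst (Agrees (lookup σ u)) (find-here u (pin s) L) agree))
    unpinned : ∀ s → E (interaction L us a) ((u , pin s) ∷ L) ≈ survival ((u , pin s) ∷ L) us a
    unpinned s = E-cong ((u , pin s) ∷ L) λ σ _ → ∏-cong us λ x →
      reflexive (≡.cong (λ g → ψ false g a (lookup σ x)) (≡.sym (isAct-pin L u s (≡.cong isAct free) x)))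
    dichotomy : ∀ s → Â a s * E (interaction L us a) ((u , pin s) ∷ L) ≈
      κ * E (interaction L us a) ((u , pin s) ∷ L) + (1# - κ) * (if D a s then survival ((u , pin s) ∷ L) us a else 0#)
    dichotomy s with D a s
    ... | true  = trans (solve 2 (λ x k → :1 :* x := k :* x :+ (:1 :- k) :* x) refl _ κ) (+-congˡ (*-congˡ (unpinned s)))
    ... | false = solve 2 (λ x k → k :* x := k :* x :+ (:1 :- k) :* con (0 , 0)) refl _ κ

  inactive : Marks n → List (Fin n) → ℕ
  inactive L []       = 0
  inactive L (u ∷ us) = (if isAct (find L u) then 0 else 1) ℕ.+ inactive L us

  infixr 8 _^_
  _^_ : Carrier → ℕ → Carrier
  x ^ zero  = 1#
  x ^ suc k = x * x ^ k

  -- Holds for each configuration separately: an inactive neighbour contributes a factor of at least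
  -- κ whatever its spin, an active one contributes 1.
  survival-lower : ∀ L us a → κ ^ inactive L us ≤ survival L us a
  survival-lower L us a = ≤-respˡ-≈ (trans (E-* L (κ ^ inactive L us) (λ _ → 1#)) (trans (*-congˡ (E-one L)) (*-identityʳ _)))
    (E-mono L λ σ → ≤-respˡ-≈ (sym (*-identityʳ _)) (bound σ us))
    where
    0≤^ : ∀ k → 0# ≤ κ ^ k
    0≤^ zero    = 0≤1
    0≤^ (suc k) = *-nonNegative 0≤κ (0≤^ k)
    bound : ∀ σ us → κ ^ inactive L us ≤ interaction L us a σ
    bound σ []       = ≤-refl
    bound σ (u ∷ us) with isAct (find L u)
    ... | true  = ≤-respʳ-≈ (sym (*-identityˡ _)) (bound σ us)
    ... | false = *-mono-≤ (0≤Â a (lookup σ u)) (0≤^ (inactive L us)) (κ≤Â a (lookup σ u)) (bound σ us)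

  proposal : Fin n → Spin → Carrier
  proposal v a = field-of v a ÷ totalField v

  success : Marks n → Fin n → Spin → Carrier
  success L v a = survival ((v , act a) ∷ L) (neighbors v) a

  proposal* : ∀ v a → proposal v a * totalField v ≈ field-of v a
  proposal* v a = ÷-* (field-of v a) (<⇒≉0 (0<totalField v))

  0≤proposal : ∀ v a → 0# ≤ proposal v a
  0≤proposal v a = 0≤÷ (field-nonNegative v a) (0<totalField v)

  Σproposal≈1 : ∀ v → Σ₂ (proposal v) ≈ 1#
  Σproposal≈1 v = *-cancelˡ-≈ (totalField v) (0<totalField v)
    (trans (distribˡ _ _ _) (trans (+-cong (trans (*-comm _ _) (proposal* v zero)) (trans (*-comm _ _) (proposal* v (suc zero))))
      (sym (*-identityʳ _))))

  -- By `P-act`, `P` is the weight `proposal v a * success L v a` of an accepted proposal times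
  -- `totalField v * h`, where `h` does not depend on `a`. As `P` sums to 1, that factor is the
  -- inverse of the acceptance probability; the cross-multiplied form avoids dividing by the latter.
  rejection : ∀ L v → find L v ≡ nothing → ∀ a →
              P L v a * Σ₂ (λ b → proposal v b * success L v b) ≈ proposal v a * success L v a
  rejection L v free a = begin-equality
    P L v a * p̄              ≈⟨ *-congʳ (trans (P≈ a) (*-congʳ (*-congʳ (sym (proposal* v a))))) ⟩
    proposal v a * totalField v * success L v a * h * p̄
      ≈⟨ solve 5 (λ r t x h p → r :* t :* x :* h :* p := r :* x :* (t :* h :* p)) refl _ _ _ _ _ ⟩
    proposal v a * success L v a * (totalField v * h * p̄)
      ≈⟨ trans (*-congˡ one) (*-identityʳ _) ⟩
    proposal v a * success L v a  ∎
    where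
    open ≤-Reasoning
    p̄ = Σ₂ (λ b → proposal v b * success L v b)
    h = proj₁ (P-act L v)
    P≈ : ∀ a → P L v a ≈ field-of v a * success L v a * h
    P≈ = proj₂ (P-act L v)
    one : totalField v * h * p̄ ≈ 1#
    one = trans (solve 6 (λ t h r x s y → t :* h :* (r :* x :+ s :* y) := r :* t :* x :* h :+ s :* t :* y :* h) refl
                   (totalField v) h _ _ _ _)
      (trans (Σ₂-cong (λ b → trans (*-congʳ (*-congʳ (proposal* v b))) (sym (P≈ b)))) (ΣP≈1 L v free))

-- Upper bounds on the reward collected by a program.

-- For loop-free commands a bound on the number of steps. The branches of `ifThen` are added, a
-- crude bound on their maximum that only affects the constant.
size : Cmd → ℕ
size (setNat _ _ _)    = 1
size (setReal _ _ _)   = 1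
size (flip _ _ _)      = 1
size (c ⨾ d)           = suc (size c ℕ.+ size d)
size (ifThen _ c d)    = suc (size c ℕ.+ size d)
size (while _ c)       = suc (size c)

module Reward {c ℓ₁ ℓ₂} (F : ArchimedeanOrderedField c ℓ₁ ℓ₂) (I : Over.IsingModel F)
              (Λ : List (Fin (Over.IsingModel.n I))) where
  open OrderedField F
  open Solver
  open Over F
  open Run I Λ
  open Memory

  -- The expected reward collected within t steps, when ρ is paid for every
  -- step and h for halting.
  module Value (ρ : Carrier) (h : Memory → Carrier) (0≤ρ : 0# ≤ ρ) (0≤h : ∀ m → 0# ≤ h m) where

    V : ℕ → State → Carrier
    V zero    ([]    , m) = h m
    V zero    (_ ∷ _ , m) = 0#
    V (suc t) ([]    , m) = h m
    V (suc t) (c ∷ k , m) with step c k m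
    ... | go s        = ρ + V t s
    ... | toss p s s′ = ρ + mix p (V t s) (V t s′)

    -- A relation rather than a function of the memory, because a bound is computed from a recursion
    -- stack that the memory represents.
    Claim : Set _
    Claim = Memory → Carrier → Set (c Level.⊔ ℓ₂)

    -- An upper-bound transformer for loop-free commands.
    wp : Cmd → Claim → Claim
    -- The witnesses `j` and `y` allow index and value to be given in simplified form, so that
    -- memories do not accumulate unevaluated expressions.
    wp (setNat a i e)   Q m x = ∃ λ j → ∃ λ y → evalN i m ≡ j × evalN e m ≡ y ×
                                Q (mem (nats m [ a , j ]≔ y) (reals m)) x
    wp (setReal a i e)  Q m x = Lift _ ⊥
    wp (flip a i p)     Q m x = ∃ λ j → evalN i m ≡ j × ∃ λ x₁ → ∃ λ x₀ →
                                Q (mem (nats m [ a , j ]≔ 1) (reals m)) x₁ ×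
                                Q (mem (nats m [ a , j ]≔ 0) (reals m)) x₀ ×
                                mix (clip (evalR p m)) x₁ x₀ ≤ x
    wp (c₁ ⨾ c₂)        Q m x = wp c₁ (wp c₂ Q) m x
    wp (ifThen b c₁ c₂) Q m x = (evalB b m ≡ true × wp c₁ Q m x) ⊎ (evalB b m ≡ false × wp c₂ Q m x)
    wp (while _ _)      Q m x = Lift _ ⊥

    cost : ℕ → Carrier
    cost k = fromℕ k * ρ

    -- Quantified over all times up to `t`: once the command is done, the continuation must be
    -- bounded for whatever time is left.
    Bounded : ℕ → Carrier → List Cmd → Memory → Carrier → Set ℓ₂
    Bounded t r k m x = ∀ t′ → t′ ℕ.≤ t → V t′ (k , m) ≤ r + x

    0≤V : ∀ t s → 0# ≤ V t s
    0≤V zero    ([]    , m) = 0≤h m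
    0≤V zero    (_ ∷ _ , m) = ≤-refl
    0≤V (suc t) ([]    , m) = 0≤h m
    0≤V (suc t) (setNat a i e    ∷ k , m) = +-nonNegative 0≤ρ (0≤V t _)
    0≤V (suc t) (setReal a i e   ∷ k , m) = +-nonNegative 0≤ρ (0≤V t _)
    0≤V (suc t) (flip a i p      ∷ k , m) = +-nonNegative 0≤ρ (0≤mix (0≤clip _) (clip≤1 _) (0≤V t _) (0≤V t _))
    0≤V (suc t) ((c₁ ⨾ c₂)       ∷ k , m) = +-nonNegative 0≤ρ (0≤V t _)
    0≤V (suc t) (ifThen b c₁ c₂  ∷ k , m) = +-nonNegative 0≤ρ (0≤V t _)
    0≤V (suc t) (while b c₁      ∷ k , m) = +-nonNegative 0≤ρ (0≤V t _)

    private
      pay : ∀ {r x v} l → v ≤ r + cost l + x → ρ + v ≤ r + cost (suc l) + x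
      pay {r} {x} {v} l v≤ = ≤-respʳ-≈
        (solve 4 (λ r x k ρ → ρ :+ (r :+ k :* ρ :+ x) := r :+ (:1 :+ k) :* ρ :+ x) refl r x (fromℕ l) ρ)
        (+-monoʳ-≤ ρ v≤)

      free : ∀ {r x v} → v ≤ r + x → v ≤ r + cost 0 + x
      free {r} {x} = ≤-respʳ-≈ (solve 3 (λ r x ρ → r :+ x := r :+ con (0 , 0) :* ρ :+ x) refl r x ρ)

      weaken : ∀ {r x v} l l′ → l ℕ.≤ l′ → v ≤ r + cost l + x → v ≤ r + cost l′ + x
      weaken {r} {x} l l′ l≤l′ v≤ = ≤-trans v≤ (+-monoˡ-≤ x (+-monoʳ-≤ r (*-monoˡ-≤ ρ 0≤ρ (fromℕ-mono l≤l′))))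

      -- A running machine is worth 0 at time 0.
      now : ∀ {r x v} l → 0# ≤ v → v ≤ r + cost l + x → 0# ≤ r + cost (suc l) + x
      now l 0≤v v≤ = ≤-trans (+-nonNegative 0≤ρ 0≤v) (pay l v≤)

    -- Each executed command pays one `ρ` out of `cost (size c)`. Time 0 is a separate case: a
    -- running machine is worth nothing yet, and `now` derives the nonnegativity of the claimed
    -- bound from the bound for what follows.
    wp-sound : ∀ c k t r {Q : Claim} → (∀ m x → Q m x → Bounded t r k m x) →
               ∀ m x → wp c Q m x → Bounded t (r + cost (size c)) (c ∷ k) m x
    wp-sound (setNat a i e) k t r hyp m x (_ , _ , ≡.refl , ≡.refl , q) zero    t′≤t = now 0 (0≤V 0 (k , mem (nats m [ a , evalN i m ]≔ evalN e m) (reals m))) (free (hyp _ x q 0 ℕ.z≤n))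
    wp-sound (setNat a i e) k t r hyp m x (_ , _ , ≡.refl , ≡.refl , q) (suc t′) t′≤t = pay 0 (free (hyp _ x q t′ (ℕ.<⇒≤ t′≤t)))
    wp-sound (flip a i p) k t r hyp m x (_ , ≡.refl , x₁ , x₀ , q₁ , q₀ , mix≤x) = bounded
      where
      p̂ = clip (evalR p m)
      s₁ s₀ : State
      s₁ = k , mem (nats m [ a , evalN i m ]≔ 1) (reals m)
      s₀ = k , mem (nats m [ a , evalN i m ]≔ 0) (reals m)
      mixed : ∀ t′ → t′ ℕ.≤ t → mix p̂ (V t′ s₁) (V t′ s₀) ≤ r + x
      mixed t′ t′≤t = ≤-trans (mix-mono (0≤clip _) (clip≤1 _) (hyp _ x₁ q₁ t′ t′≤t) (hyp _ x₀ q₀ t′ t′≤t))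
        (≤-respˡ-≈ (solve 4 (λ p r x y → r :+ (p :* x :+ (:1 :- p) :* y) := p :* (r :+ x) :+ (:1 :- p) :* (r :+ y)) refl p̂ r x₁ x₀)
          (+-monoʳ-≤ r mix≤x))
      bounded : Bounded t (r + cost 1) (flip a i p ∷ k) m x
      bounded zero     t′≤t = now 0 (0≤mix (0≤clip _) (clip≤1 _) (0≤V 0 s₁) (0≤V 0 s₀)) (free (mixed 0 ℕ.z≤n))
      bounded (suc t′) t′≤t = pay 0 (free (mixed t′ (ℕ.<⇒≤ t′≤t)))
    wp-sound (c₁ ⨾ c₂) k t r hyp m x q = bounded
      where
      inner : Bounded t (r + cost (size c₁ ℕ.+ size c₂)) (c₁ ∷ c₂ ∷ k) m x
      inner t′ t′≤t = ≤-respʳ-≈ (+-congʳ (trans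
          (solve 4 (λ r k l ρ → r :+ l :* ρ :+ k :* ρ := r :+ (k :+ l) :* ρ) refl r (fromℕ (size c₁)) (fromℕ (size c₂)) ρ)
          (+-congˡ (*-congʳ (sym (fromℕ-+ (size c₁) (size c₂)))))))
        (wp-sound c₁ (c₂ ∷ k) t (r + cost (size c₂)) (wp-sound c₂ k t r hyp) m x q t′ t′≤t)
      bounded : Bounded t (r + cost (size (c₁ ⨾ c₂))) ((c₁ ⨾ c₂) ∷ k) m x
      bounded zero     t′≤t = now (size c₁ ℕ.+ size c₂) ≤-refl (inner 0 ℕ.z≤n)
      bounded (suc t′) t′≤t = pay (size c₁ ℕ.+ size c₂) (inner t′ (ℕ.<⇒≤ t′≤t))
    wp-sound (ifThen b c₁ c₂) k t r hyp m x q = bounded q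
      where
      bounded : wp (ifThen b c₁ c₂) _ m x → Bounded t (r + cost (size (ifThen b c₁ c₂))) (ifThen b c₁ c₂ ∷ k) m x
      bounded (inj₁ (eq , q)) zero     t′≤t = now (size c₁ ℕ.+ size c₂) ≤-refl (weaken (size c₁) (size c₁ ℕ.+ size c₂) (ℕ.m≤m+n (size c₁) (size c₂)) (wp-sound c₁ k t r hyp m x q 0 ℕ.z≤n))
      bounded (inj₁ (eq , q)) (suc t′) t′≤t rewrite eq =
        pay (size c₁ ℕ.+ size c₂) (weaken (size c₁) (size c₁ ℕ.+ size c₂) (ℕ.m≤m+n (size c₁) (size c₂)) (wp-sound c₁ k t r hyp m x q t′ (ℕ.<⇒≤ t′≤t)))
      bounded (inj₂ (eq , q)) zero     t′≤t = now (size c₁ ℕ.+ size c₂) ≤-refl (weaken (size c₂) (size c₁ ℕ.+ size c₂) (ℕ.m≤n+m (size c₂) (size c₁)) (wp-sound c₂ k t r hyp m x q 0 ℕ.z≤n))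
      bounded (inj₂ (eq , q)) (suc t′) t′≤t rewrite eq =
        pay (size c₁ ℕ.+ size c₂) (weaken (size c₂) (size c₁ ℕ.+ size c₂) (ℕ.m≤n+m (size c₂) (size c₁)) (wp-sound c₂ k t r hyp m x q t′ (ℕ.<⇒≤ t′≤t)))

    -- The method of superharmonic functions for a main loop: R m x says that
    -- x is a claimed bound at the loop head with memory m.
    while-sound : ∀ b c (R : Claim) →
      (∀ m x → R m x → 0# ≤ x) →
      (∀ m x → R m x → (evalB b m ≡ false × ρ + h m ≤ x) ⊎
                       (evalB b m ≡ true × ∃ λ y → wp c R m y × cost (suc (size c)) + y ≤ x)) →
      ∀ t m x → R m x → V t (while b c ∷ [] , m) ≤ x
    while-sound b c R 0≤R iterate t m x r = loop t m x r t ℕ.≤-refl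
      where
      -- Testing the loop condition already takes a step, so the next visit to the loop head needs
      -- the bound for smaller times only.
      loop : ∀ t m x → R m x → ∀ t′ → t′ ℕ.≤ t → V t′ (while b c ∷ [] , m) ≤ x
      loop t       m x r zero     _           = 0≤R m x r
      loop (suc t) m x r (suc t′) (ℕ.s≤s t′≤t) with iterate m x r
      ... | inj₁ (eq , ≤x) rewrite eq = ≤-trans (+-monoʳ-≤ ρ (halted t′)) ≤x
        where
        halted : ∀ t → V t ([] , m) ≤ h m
        halted zero    = ≤-refl
        halted (suc t) = ≤-refl
      ... | inj₂ (eq , y , q , ≤x) rewrite eq = ≤-trans
        (+-monoʳ-≤ ρ (wp-sound c (while b c ∷ []) t 0# (λ m x r t′ t′≤t → ≤-respʳ-≈ (sym (+-identityˡ x)) (loop t m x r t′ t′≤t))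
           m y q t′ t′≤t))
        (≤-respˡ-≈ (solve 3 (λ ρ k y → (:1 :+ k) :* ρ :+ y := ρ :+ (con (0 , 0) :+ k :* ρ :+ y)) refl ρ (fromℕ (size c)) y) ≤x)

-- The recursion stack and its potential.

Pins : ℕ → Set
Pins n = List (Fin n × Spin)

pin* : ∀ {n} → Pins n → Marks n → Marks n
pin* []            L = L
pin* ((u , s) ∷ P) L = (u , pin s) ∷ pin* P L

-- The recursion stack.  At the bottom are the sampled vertices of Λ, and
-- those that follow the one being sampled.  A frame holds an active vertex,
-- its proposed colour, its neighbours that remain to be examined, and the
-- neighbours sampled in the current trial.
data Stack (n : ℕ) : Set where
  root  : Pins n → List (Fin n) → Stack n
  frame : Stack n → Fin n → Spin → List (Fin n) → Pins n → Stack n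

marks : ∀ {n} → Stack n → Marks n
marks (root D vs)          = pin* D []
marks (frame b v a us P) = pin* P ((v , act a) ∷ marks b)

module Potential {c ℓ₁ ℓ₂} (F : ArchimedeanOrderedField c ℓ₁ ℓ₂) (I : Over.IsingModel F)
                 (Z≉0 : Nondegenerate F I) where
  open OrderedField F
  open Products F
  open Solver
  open Conditional F I Z≉0

  -- ρ is the cost of one iteration of the main loop; Tₛ and Tᵣ bound the
  -- expected numbers of iterations of a recursive and of a top-level call.
  module Bounds (ρ Tₛ Tᵣ : Carrier) (0≤ρ : 0# ≤ ρ) (0≤Tₛ : 0# ≤ Tₛ) (0≤Tᵣ : 0# ≤ Tᵣ)
                (g : Pins n → Carrier) (0≤g : ∀ D → 0# ≤ g D) where

    q : Carrier
    q = 1# - κ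

    0≤q : 0# ≤ q
    0≤q = 0≤1-x κ≤1

    callTime : Stack n → Carrier
    callTime (root _ _)        = Tᵣ
    callTime (frame _ _ _ _ _) = Tₛ

    0≤callTime : ∀ b → 0# ≤ callTime b
    0≤callTime (root _ _)        = 0≤Tᵣ
    0≤callTime (frame _ _ _ _ _) = 0≤Tₛ

    -- One iteration per neighbour. Each inactive one is moreover charged, with weight `q`, for a
    -- call and for one more trail entry to undo.
    scanTime : Marks n → List (Fin n) → Carrier
    scanTime L us = fromℕ (length us) + fromℕ (inactive L us) * (q * (Tₛ + 1#))

    0≤scanTime : ∀ L us → 0# ≤ scanTime L us
    0≤scanTime L us = +-nonNegative (0≤fromℕ (length us))
      (*-nonNegative (0≤fromℕ (inactive L us)) (*-nonNegative 0≤q (+-nonNegative 0≤Tₛ 0≤1)))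

    average : Marks n → Fin n → (Spin → Carrier) → Carrier
    average L v f = Σ₂ (λ s → P L v s * f s)

    call′ : Stack n → Fin n → (Spin → Carrier) → Carrier
    call′ b v f = ρ * callTime b + average (marks b) v f

    -- `length P` iterations undo the trail, one ends the scan and one ends the unwinding. Then the
    -- trial returns with probability `survival`, and otherwise the call starts afresh at its full
    -- value `call′`.
    trial : Stack n → Fin n → Spin → List (Fin n) → Pins n → (Spin → Carrier) → Carrier
    trial b v a us P f = ρ * (fromℕ (length P) + (1# + 1#) + scanTime L us) + mix (survival L us a) (f a) (call′ b v f)
      where L = pin* P ((v , act a) ∷ marks b)

    failure : Stack n → Fin n → Pins n → (Spin → Carrier) → Carrier
    failure b v P f = ρ * (fromℕ (length P) + 1#) + call′ b v f

    rootValue : List (Fin n) → Pins n → Carrier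
    -- One iteration switches to the halting mode; the second `ρ` pays for the last test of the
    -- loop.
    rootValue []       D = ρ + (ρ + g D)
    rootValue (v ∷ vs) D = ρ + (ρ * Tᵣ + average (pin* D []) v (λ s → rootValue vs ((v , s) ∷ D)))

    -- ret, call, scan and unwind bound the expected remaining cost from the
    -- corresponding machine states; ret is the one that recurses on the stack.
    ret : Stack n → Fin n → Spin → Carrier
    ret (root D vs)        v s = rootValue vs ((v , s) ∷ D)
    ret (frame b w a us P) u s = if D a s then trial b w a us ((u , s) ∷ P) (ret b w)
                                          else failure b w ((u , s) ∷ P) (ret b w)

    call : Stack n → Fin n → Carrier
    call b v = call′ b v (ret b v)

    scan : Stack n → Fin n → Spin → List (Fin n) → Pins n → Carrier
    scan b v a us P = trial b v a us P (ret b v)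

    unwind : Bool → Stack n → Fin n → Spin → Pins n → Carrier
    unwind true  b v a P = ρ * (fromℕ (length P) + 1#) + ret b v a
    unwind false b v a P = failure b v P (ret b v)

    0≤average : ∀ L v {f} → (∀ s → 0# ≤ f s) → 0# ≤ average L v f
    0≤average L v 0≤f = +-nonNegative (*-nonNegative (0≤P L v zero) (0≤f zero)) (*-nonNegative (0≤P L v (suc zero)) (0≤f (suc zero)))

    0≤call′ : ∀ b v {f} → (∀ s → 0# ≤ f s) → 0# ≤ call′ b v f
    0≤call′ b v 0≤f = +-nonNegative (*-nonNegative 0≤ρ (0≤callTime b)) (0≤average (marks b) v 0≤f)

    0≤trial : ∀ b v a us P {f} → (∀ s → 0# ≤ f s) → 0# ≤ trial b v a us P f
    0≤trial b v a us P 0≤f = +-nonNegative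
      (*-nonNegative 0≤ρ (+-nonNegative (+-nonNegative (0≤fromℕ (length P)) (+-nonNegative 0≤1 0≤1)) (0≤scanTime _ us)))
      (0≤mix (0≤survival _ us a) (survival≤1 _ us a) (0≤f a) (0≤call′ b v 0≤f))

    0≤failure : ∀ b v P {f} → (∀ s → 0# ≤ f s) → 0# ≤ failure b v P f
    0≤failure b v P 0≤f = +-nonNegative (*-nonNegative 0≤ρ (+-nonNegative (0≤fromℕ (length P)) 0≤1)) (0≤call′ b v 0≤f)

    0≤rootValue : ∀ vs D → 0# ≤ rootValue vs D
    0≤rootValue []       D = +-nonNegative 0≤ρ (+-nonNegative 0≤ρ (0≤g D))
    0≤rootValue (v ∷ vs) D = +-nonNegative 0≤ρ (+-nonNegative (*-nonNegative 0≤ρ 0≤Tᵣ)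
      (0≤average (pin* D []) v (λ s → 0≤rootValue vs ((v , s) ∷ D))))

    0≤ret : ∀ b v s → 0# ≤ ret b v s
    0≤ret (root D vs)        v s = 0≤rootValue vs ((v , s) ∷ D)
    0≤ret (frame b w a us P) u s with D a s
    ... | true  = 0≤trial b w a us ((u , s) ∷ P) (0≤ret b w)
    ... | false = 0≤failure b w ((u , s) ∷ P) (0≤ret b w)

    0≤call : ∀ b v → 0# ≤ call b v
    0≤call b v = 0≤call′ b v (0≤ret b v)

    0≤scan : ∀ b v a us P → 0# ≤ scan b v a us P
    0≤scan b v a us P = 0≤trial b v a us P (0≤ret b v)

    0≤unwind : ∀ ok b v a P → 0# ≤ unwind ok b v a P
    0≤unwind true  b v a P = +-nonNegative (*-nonNegative 0≤ρ (+-nonNegative (0≤fromℕ (length P)) 0≤1)) (0≤ret b v a)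
    0≤unwind false b v a P = 0≤failure b v P (0≤ret b v)

    unwind-pop : ∀ ok b v a u s P → ρ + unwind ok b v a P ≤ unwind ok b v a ((u , s) ∷ P)
    unwind-pop true  b v a u s P = ≤-reflexive (solve 3 (λ ρ l x → ρ :+ (ρ :* (l :+ :1) :+ x) := ρ :* (:1 :+ l :+ :1) :+ x) refl ρ (fromℕ (length P)) _)
    unwind-pop false b v a u s P = ≤-reflexive (solve 3 (λ ρ l x → ρ :+ (ρ :* (l :+ :1) :+ x) := ρ :* (:1 :+ l :+ :1) :+ x) refl ρ (fromℕ (length P)) _)

    unwind-success : ∀ b v a → ρ + ret b v a ≤ unwind true b v a []
    unwind-success b v a = ≤-reflexive (solve 2 (λ ρ x → ρ :+ x := ρ :* (con (0 , 0) :+ :1) :+ x) refl ρ _)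

    unwind-failure : ∀ b v a → ρ + call b v ≤ unwind false b v a []
    unwind-failure b v a = ≤-reflexive (solve 2 (λ ρ x → ρ :+ x := ρ :* (con (0 , 0) :+ :1) :+ x) refl ρ _)

    scan-end : ∀ b v a P → ρ + unwind true b v a P ≤ scan b v a [] P
    scan-end b v a P = ≤-reflexive (sym (trans (+-congˡ (mix-congᵖ (survival-[] _ a)))
      (solve 5 (λ ρ l s f k → ρ :* (l :+ (:1 :+ :1) :+ (con (0 , 0) :+ con (0 , 0) :* k)) :+ (:1 :* s :+ (:1 :- :1) :* f) :=
                      ρ :+ (ρ :* (l :+ :1) :+ s)) refl ρ (fromℕ (length P)) (ret b v a) (call b v) (q * (Tₛ + 1#)))))

    module _ (b : Stack n) (v : Fin n) (a : Spin) (u : Fin n) (us : List (Fin n)) (P₀ : Pins n) where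
      private
        L = pin* P₀ ((v , act a) ∷ marks b)
        l = fromℕ (length P₀)
        k = fromℕ (length us)
        i = fromℕ (inactive L us)
        t = q * (Tₛ + 1#)
        S = ret b v a
        N = call b v
        x = survival L us a

      scan-act : isAct (find L u) ≡ true → ρ + scan b v a us P₀ ≤ scan b v a (u ∷ us) P₀
      scan-act eq = ≤-reflexive (sym (trans
        (+-cong (*-congˡ (+-congˡ (+-congˡ (*-congʳ (reflexive (≡.cong (λ g → fromℕ ((if g then 0 else 1) ℕ.+ inactive L us)) eq))))))
                (mix-congᵖ (survival-act L u us a eq)))
        (solve 6 (λ ρ l k i t m → ρ :* (l :+ (:1 :+ :1) :+ (:1 :+ k :+ i :* t)) :+ m :=
                                  ρ :+ (ρ :* (l :+ (:1 :+ :1) :+ (k :+ i :* t)) :+ m)) refl ρ l k i t _)))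

      private
        scanTime-∷ : isAct (find L u) ≡ false → scanTime L (u ∷ us) ≈ 1# + t + scanTime L us
        scanTime-∷ eq = trans (+-congˡ (*-congʳ (reflexive (≡.cong (λ g → fromℕ ((if g then 0 else 1) ℕ.+ inactive L us)) eq))))
          (solve 3 (λ k i t → :1 :+ k :+ (:1 :+ i) :* t := :1 :+ t :+ (k :+ i :* t)) refl k i t)

      scan-pin : ∀ s → find L u ≡ just (pin s) →
                 ρ + mix (Â a s) (scan b v a us P₀) (unwind false b v a P₀) ≤ scan b v a (u ∷ us) P₀
      scan-pin s eq = ≤-by
        -- The slack is the unspent budget for sampling `u` and, on failure, the rest of the scan.
        (*-nonNegative 0≤ρ (+-nonNegative (*-nonNegative 0≤q (+-nonNegative 0≤Tₛ 0≤1))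
          (*-nonNegative (0≤1-x (Â≤1 a s)) (+-nonNegative 0≤1 (0≤scanTime L us)))))
        (sym (trans (+-cong (*-congˡ (+-congˡ (scanTime-∷ (≡.cong isAct eq)))) (mix-congᵖ (survival-pin L u us a s eq)))
          (solve 8 (λ ρ l c t â x S N →
             ρ :* (l :+ (:1 :+ :1) :+ (:1 :+ t :+ c)) :+ (â :* x :* S :+ (:1 :- â :* x) :* N) :=
             ρ :+ (â :* (ρ :* (l :+ (:1 :+ :1) :+ c) :+ (x :* S :+ (:1 :- x) :* N)) :+ (:1 :- â) :* (ρ :* (l :+ :1) :+ N))
             :+ ρ :* (t :+ (:1 :- â) :* (:1 :+ c)))
             refl ρ l (scanTime L us) t (Â a s) x S N)))

      -- The bound is affine in the survival probability, so averaging over the spin returned by the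
      -- call yields the average survival, which `survival-free` combines with the branch of weight
      -- κ. An incompatible spin counts as survival 0, and failing at once is only cheaper.
      scan-free : find L u ≡ nothing →
                  ρ + mix κ (scan b v a us P₀) (call (frame b v a us P₀) u) ≤ scan b v a (u ∷ us) P₀
      scan-free eq = begin
        ρ + mix κ (scan b v a us P₀) (call (frame b v a us P₀) u)
          ≤⟨ +-monoʳ-≤ ρ (mix-mono 0≤κ κ≤1 ≤-refl (+-monoʳ-≤ _ sampled)) ⟩
        ρ + mix κ (scan b v a us P₀) (ρ * Tₛ + (ρ * (1# + l + (1# + 1#) + C₀) + mix y S N))
          ≈⟨ solve 9 (λ ρ l c T κ x y S N →
             ρ :+ (κ :* (ρ :* (l :+ (:1 :+ :1) :+ c) :+ (x :* S :+ (:1 :- x) :* N)) :+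
                   (:1 :- κ) :* (ρ :* T :+ (ρ :* (:1 :+ l :+ (:1 :+ :1) :+ c) :+ (y :* S :+ (:1 :- y) :* N)))) :=
             ρ :* (l :+ (:1 :+ :1) :+ (:1 :+ (:1 :- κ) :* (T :+ :1) :+ c)) :+
               ((κ :* x :+ (:1 :- κ) :* y) :* S :+ (:1 :- (κ :* x :+ (:1 :- κ) :* y)) :* N)) refl ρ l C₀ Tₛ κ x y S N ⟩
        ρ * (l + (1# + 1#) + (1# + t + C₀)) + mix (κ * x + (1# - κ) * y) S N
          ≈⟨ +-cong (*-congˡ (+-congˡ (scanTime-∷ (≡.cong isAct eq)))) (mix-congᵖ (survival-free L u us a eq)) ⟨
        scan b v a (u ∷ us) P₀  ∎
        where
        open ≤-Reasoning
        C₀ = scanTime L us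
        yˢ : Spin → Carrier
        yˢ s = if D a s then survival ((u , pin s) ∷ L) us a else 0#
        y = average L u yˢ
        inactive-pin : ∀ s us → inactive ((u , pin s) ∷ L) us ≡ inactive L us
        inactive-pin s []       = ≡.refl
        inactive-pin s (x ∷ us) = ≡.cong₂ (λ g k → (if g then 0 else 1) ℕ.+ k) (isAct-pin L u s (≡.cong isAct eq) x) (inactive-pin s us)
        one : ∀ s → ret (frame b v a us P₀) u s ≤ ρ * (1# + l + (1# + 1#) + C₀) + mix (yˢ s) S N
        one s with D a s
        ... | true  = ≤-reflexive (+-congʳ (*-congˡ (+-congˡ (+-congˡ (*-congʳ (reflexive (≡.cong fromℕ (inactive-pin s us))))))))
        ... | false = ≤-by (*-nonNegative 0≤ρ (+-nonNegative 0≤1 (0≤scanTime L us)))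
          (solve 5 (λ ρ l c S N → (ρ :* (:1 :+ l :+ :1) :+ N) :+ ρ :* (:1 :+ c) :=
                    ρ :* (:1 :+ l :+ (:1 :+ :1) :+ c) :+ (con (0 , 0) :* S :+ (:1 :- con (0 , 0)) :* N)) refl ρ l C₀ S N)
        sampled : average L u (ret (frame b v a us P₀) u) ≤ ρ * (1# + l + (1# + 1#) + C₀) + mix y S N
        sampled = begin
          average L u (ret (frame b v a us P₀) u)
            ≤⟨ +-mono-≤ (*-monoʳ-≤ _ (0≤P L u zero) (one zero)) (*-monoʳ-≤ _ (0≤P L u (suc zero)) (one (suc zero))) ⟩
          average L u (λ s → R + mix (yˢ s) S N)
            ≈⟨ solve 7 (λ p p′ R y y′ S N → p :* (R :+ (y :* S :+ (:1 :- y) :* N)) :+ p′ :* (R :+ (y′ :* S :+ (:1 :- y′) :* N)) :=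
                 (p :+ p′) :* (R :+ N) :+ (p :* y :+ p′ :* y′) :* (S :- N)) refl _ _ R _ _ S N ⟩
          Σ₂ (P L u) * (R + N) + y * (S - N)
            ≈⟨ +-congʳ (*-congʳ (ΣP≈1 L u eq)) ⟩
          1# * (R + N) + y * (S - N)
            ≈⟨ solve 4 (λ R y S N → :1 :* (R :+ N) :+ y :* (S :- N) := R :+ (y :* S :+ (:1 :- y) :* N)) refl R y S N ⟩
          R + mix y S N  ∎
          where R = ρ * (1# + l + (1# + 1#) + C₀)

    inactive-act : ∀ (L : Marks n) v a a′ us → inactive ((v , act a) ∷ L) us ≡ inactive ((v , act a′) ∷ L) us
    inactive-act L v a a′ []       = ≡.refl
    inactive-act L v a a′ (u ∷ us) = ≡.cong₂ (λ g k → (if g then 0 else 1) ℕ.+ k) same (inactive-act L v a a′ us)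
      where
      same : isAct (find ((v , act a) ∷ L) u) ≡ isAct (find ((v , act a′) ∷ L) u)
      same with does (v Fin.≟ u)
      ... | true  = ≡.refl
      ... | false = ≡.refl

    -- One trial costs at most the part of callTime b that is refunded when
    -- it succeeds.
    start : ∀ b v → find (marks b) v ≡ nothing →
            (let L = (v , act zero) ∷ marks b in
             1# + (1# + 1# + scanTime L (neighbors v)) ≤ κ ^ inactive L (neighbors v) * callTime b) →
            ρ + Σ₂ (λ a → proposal v a * scan b v a (neighbors v) []) ≤ call b v
    start b v free time = begin
      ρ + Σ₂ (λ a → proposal v a * scan b v a (neighbors v) [])
        ≈⟨ +-congˡ (Σ₂-cong {λ a → proposal v a * scan b v a (neighbors v) []} {λ a → proposal v a * (ρ * c′ + mix (x a) (S a) N)}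
             λ a → *-congˡ {proposal v a} (+-congʳ {mix (x a) (S a) N} (*-congˡ {ρ} (times a)))) ⟩
      ρ + Σ₂ (λ a → proposal v a * (ρ * c′ + mix (x a) (S a) N))
        ≈⟨ solve 9 (λ ρ r r′ c x x′ S S′ N →
             ρ :+ (r :* (ρ :* c :+ (x :* S :+ (:1 :- x) :* N)) :+ r′ :* (ρ :* c :+ (x′ :* S′ :+ (:1 :- x′) :* N))) :=
             ρ :+ (r :+ r′) :* (ρ :* c :+ N) :- (r :* x :+ r′ :* x′) :* N :+ (r :* x :* S :+ r′ :* x′ :* S′))
             refl ρ (proposal v zero) (proposal v (suc zero)) c′ (x zero) (x (suc zero)) (S zero) (S (suc zero)) N ⟩
      ρ + Σ₂ (proposal v) * (ρ * c′ + N) - p̄ * N + Σ₂ (λ a → proposal v a * x a * S a)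
        -- `rejection` turns the accepted proposals into `p̄` times the conditional law of `v`.
        -- Together with the restart term of weight `1 − p̄`, the average of `S` comes out exactly,
        -- and `ρ * (p̄ * callTime b)` is left to pay for the trial.
        ≈⟨ +-cong (+-congʳ (+-congˡ (*-congʳ (Σproposal≈1 v))))
             (Σ₂-cong {λ a → proposal v a * x a * S a} {λ a → P (marks b) v a * p̄ * S a} λ a → *-congʳ {S a} (sym (rejection (marks b) v free a))) ⟩
      ρ + 1# * (ρ * c′ + N) - p̄ * N + Σ₂ (λ a → P (marks b) v a * p̄ * S a)
        ≈⟨ solve 8 (λ ρ c p T r r′ S S′ →
             ρ :+ :1 :* (ρ :* c :+ (ρ :* T :+ (r :* S :+ r′ :* S′))) :- p :* (ρ :* T :+ (r :* S :+ r′ :* S′)) :+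
               (r :* p :* S :+ r′ :* p :* S′) :=
             ρ :* (:1 :+ c) :+ (ρ :* (T :- p :* T) :+ (r :* S :+ r′ :* S′)))
             refl ρ c′ p̄ (callTime b) (P (marks b) v zero) (P (marks b) v (suc zero)) (S zero) (S (suc zero)) ⟩
      ρ * (1# + c′) + (ρ * (callTime b - p̄ * callTime b) + average (marks b) v S)
        ≤⟨ +-monoˡ-≤ _ (*-monoʳ-≤ ρ 0≤ρ time′) ⟩
      ρ * (p̄ * callTime b) + (ρ * (callTime b - p̄ * callTime b) + average (marks b) v S)
        ≈⟨ solve 4 (λ ρ p T A → ρ :* (p :* T) :+ (ρ :* (T :- p :* T) :+ A) := ρ :* T :+ A) refl ρ p̄ (callTime b) _ ⟩
      call b v  ∎
      where
      open ≤-Reasoning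
      x S : Spin → Carrier
      x a = success (marks b) v a
      S a = ret b v a
      N = call b v
      p̄ = Σ₂ (λ b′ → proposal v b′ * success (marks b) v b′)
      L₀ = (v , act zero) ∷ marks b
      m₀ = inactive L₀ (neighbors v)
      c′ = 0# + (1# + 1#) + scanTime L₀ (neighbors v)
      times : ∀ a → 0# + (1# + 1#) + scanTime ((v , act a) ∷ marks b) (neighbors v) ≈ c′
      times a = +-congˡ (+-congˡ (*-congʳ (reflexive (≡.cong fromℕ (inactive-act (marks b) v a zero (neighbors v))))))
      lower : ∀ a → κ ^ m₀ ≤ x a
      lower a = ≤-respˡ-≈ (reflexive (≡.cong (κ ^_) (inactive-act (marks b) v a zero (neighbors v))))
                  (survival-lower ((v , act a) ∷ marks b) (neighbors v) a)
      κ^≤p̄ : κ ^ m₀ ≤ p̄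
      κ^≤p̄ = begin
        κ ^ m₀                                  ≈⟨ trans (sym (*-identityˡ _)) (*-congʳ (sym (Σproposal≈1 v))) ⟩
        Σ₂ (proposal v) * κ ^ m₀                ≈⟨ distribʳ _ _ _ ⟩
        Σ₂ (λ a → proposal v a * κ ^ m₀)        ≤⟨ +-mono-≤ (*-monoʳ-≤ _ (0≤proposal v zero) (lower zero))
                                                            (*-monoʳ-≤ _ (0≤proposal v (suc zero)) (lower (suc zero))) ⟩
        p̄                                       ∎
      time′ : 1# + c′ ≤ p̄ * callTime b
      time′ = ≤-trans (≤-respˡ-≈ (+-congˡ (+-congʳ (sym (+-identityˡ _)))) time) (*-monoˡ-≤ _ (0≤callTime b) κ^≤p̄)

-- The sampling program.

-- Array 0 holds the output, 1 the status of the vertices, 2-5 the frames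
-- (vertex, colour, number of examined neighbours, height of the trail at
-- entry) by depth, 6 the trail of pinned vertices, and 7 the scalars.

scalar : ℕ → NExp
scalar k = natAt 7 (lit k)

-- The values of `mode` are 0 for the next vertex of Λ, 1 for the start of a trial, 2 for the scan,
-- 3 for unwinding and 4 for halting. During unwinding, `okᴱ` tells whether the trial succeeded.
mode depthᴱ heightᴱ positionᴱ okᴱ coinᴱ neighbourᴱ vertexᴱ colourᴱ indexᴱ : NExp
mode       = scalar 0
depthᴱ     = scalar 1
heightᴱ    = scalar 2
positionᴱ  = scalar 3
okᴱ        = scalar 4
coinᴱ      = scalar 5
neighbourᴱ = scalar 6
vertexᴱ    = natAt 2 depthᴱ
colourᴱ    = natAt 3 depthᴱ
indexᴱ     = natAt 4 depthᴱ

-- All edges have the same activity, so the first one at the vertex on top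
-- serves for all.
activity : NExp → NExp → RExp
activity a b = edge-entry vertexᴱ (lit 0) a b

set : ℕ → NExp → Cmd
set k e = setNat 7 (lit k) e

-- Overwrites `neighbourᴱ`, which is reloaded before its next use.
skip : Cmd
skip = set 6 (lit 0)

push : NExp → Cmd
push u = setNat 2 (depthᴱ ⊕ lit 1) u ⨾ setNat 5 (depthᴱ ⊕ lit 1) heightᴱ ⨾
         set 1 (depthᴱ ⊕ lit 1) ⨾ set 0 (lit 1)

rootC startC scanC freeC pinC failC unwindC successC rootRetC frameRetC body sampler : Cmd

rootC = ifThen ((positionᴱ ⊕ lit 1) ≤ᴺ sizeΛ) (push (vertexΛ positionᴱ)) (set 0 (lit 4))

startC =
  flip 3 depthᴱ (field-entry vertexᴱ (lit 1) ⊘ (field-entry vertexᴱ (lit 0) ⊞ field-entry vertexᴱ (lit 1))) ⨾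
  setNat 4 depthᴱ (lit 0) ⨾ setNat 1 vertexᴱ (lit 1) ⨾ set 0 (lit 2)

scanC = ifThen (deg vertexᴱ ≤ᴺ indexᴱ)
  (set 4 (lit 1) ⨾ set 0 (lit 3))
  (set 6 (nbr vertexᴱ indexᴱ) ⨾ setNat 4 depthᴱ (indexᴱ ⊕ lit 1) ⨾
   ifThen (natAt 1 neighbourᴱ ≤ᴺ lit 0) freeC
     (ifThen (natAt 1 neighbourᴱ ≤ᴺ lit 1) skip pinC))

freeC =
  ifThen (activity (lit 0) (lit 0) ≤ᴿ activity (lit 0) (lit 1))
    (flip 7 (lit 5) (activity (lit 0) (lit 0) ⊘ activity (lit 0) (lit 1)))
    (flip 7 (lit 5) (activity (lit 0) (lit 1) ⊘ activity (lit 0) (lit 0))) ⨾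
  ifThen (lit 1 ≤ᴺ coinᴱ) skip (push neighbourᴱ)

pinC =
  -- The status of a pinned vertex is 2 plus its spin, and `lit 1 ⊖ _` is the opposite spin. The
  -- quotient may exceed 1, in which case `flip` clips it.
  flip 7 (lit 5) (activity colourᴱ (natAt 1 neighbourᴱ ⊖ lit 2) ⊘
                  activity colourᴱ (lit 1 ⊖ (natAt 1 neighbourᴱ ⊖ lit 2))) ⨾
  ifThen (lit 1 ≤ᴺ coinᴱ) skip failC

failC = set 4 (lit 0) ⨾ set 0 (lit 3)

unwindC = ifThen (heightᴱ ≤ᴺ natAt 5 depthᴱ)
  (ifThen (lit 1 ≤ᴺ okᴱ) successC (setNat 1 vertexᴱ (lit 0) ⨾ set 0 (lit 1)))
  (set 2 (heightᴱ ⊖ lit 1) ⨾ setNat 1 (natAt 6 heightᴱ) (lit 0))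

successC =
  -- The vertex is left pinned for its caller. Lowering the depth keeps the popped frame readable at
  -- `depthᴱ ⊕ lit 1`, from where the result is fetched.
  setNat 1 vertexᴱ (lit 2 ⊕ colourᴱ) ⨾ set 1 (depthᴱ ⊖ lit 1) ⨾
  ifThen (depthᴱ ≤ᴺ lit 0) rootRetC frameRetC

rootRetC = setNat 0 positionᴱ (natAt 3 (lit 1)) ⨾ set 3 (positionᴱ ⊕ lit 1) ⨾ set 0 (lit 0)

frameRetC =
  setNat 6 heightᴱ (natAt 2 (depthᴱ ⊕ lit 1)) ⨾ set 2 (heightᴱ ⊕ lit 1) ⨾
  ifThen (activity colourᴱ (lit 1 ⊖ natAt 3 (depthᴱ ⊕ lit 1)) ≤ᴿ activity colourᴱ (natAt 3 (depthᴱ ⊕ lit 1)))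
    (set 0 (lit 2)) failC

body = ifThen (mode ≤ᴺ lit 0) rootC (ifThen (mode ≤ᴺ lit 1) startC (ifThen (mode ≤ᴺ lit 2) scanC unwindC))

sampler = while (mode ≤ᴺ lit 3) body

-- Representation of stacks in memory, and simulation of the steps.

Arrays : Set
Arrays = ℕ → ℕ → ℕ

hit : ∀ i {x y : ℕ} → (if does (i ℕ.≟ i) then x else y) ≡ x
hit i rewrite dec-true (i ℕ.≟ i) ≡.refl = ≡.refl

miss : ∀ {j i} {x y : ℕ} → j ≢ i → (if does (j ℕ.≟ i) then x else y) ≡ y
miss {j} {i} j≢i rewrite dec-false (j ℕ.≟ i) j≢i = ≡.refl

code : Maybe Mark → ℕ
code nothing        = 0
code (just (act _)) = 1
code (just (pin s)) = 2 ℕ.+ toℕ s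

-- Makes undoing exact: once the newest mark of a vertex is removed, that vertex is unmarked, so
-- that writing status 0 restores the earlier state.
Distinct : ∀ {n} → Marks n → Set
Distinct []            = ⊤
Distinct ((v , _) ∷ L) = find L v ≡ nothing × Distinct L

distinct-pin* : ∀ {n} P {L : Marks n} → Distinct (pin* P L) → Distinct L
distinct-pin* []      d       = d
distinct-pin* (_ ∷ P) (_ , d) = distinct-pin* P d

find-≢ : ∀ {n} (L : Marks n) {u v m} → find L u ≡ just m → find L v ≡ nothing → v ≢ u
find-≢ L eq eq′ ≡.refl with ≡.trans (≡.sym eq) eq′
... | ()

find-pin* : ∀ {n} P (L : Marks n) w m → Distinct (pin* P ((w , m) ∷ L)) → find (pin* P ((w , m) ∷ L)) w ≡ just m
find-pin* []            L w m d = find-here w m L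
find-pin* ((u , s) ∷ P) L w m (fresh , d) = ≡.trans
  (find-there (pin s) (pin* P ((w , m) ∷ L)) (find-≢ (pin* P ((w , m) ∷ L)) (find-pin* P L w m d) fresh))
  (find-pin* P L w m d)

depth height : ∀ {n} → Stack n → ℕ
depth (root _ _)          = 0
depth (frame b _ _ _ _)   = suc (depth b)
height (root _ _)         = 0
height (frame b _ _ _ P)  = length P ℕ.+ height b

Status : ∀ {n} → Marks n → Arrays → Set
Status L N = ∀ u → N 1 (toℕ u) ≡ code (find L u)

module _ {n : ℕ} where

  status-set : ∀ (L L′ : Marks n) (N : Arrays) v y →
    Status L N → (∀ u → v ≢ u → find L u ≡ find L′ u) → y ≡ code (find L′ v) →
    ∀ u → (if does (toℕ u ℕ.≟ toℕ v) then y else N 1 (toℕ u)) ≡ code (find L′ u)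
  status-set L L′ N v y st off on u with v Fin.≟ u
  ... | yes ≡.refl = ≡.trans (hit (toℕ v)) on
  ... | no v≢u = ≡.trans (miss (λ eq → v≢u (≡.sym (Fin.toℕ-injective eq)))) (≡.trans (st u) (≡.cong code (off u v≢u)))

  Trail : ℕ → Pins n → Arrays → Set
  Trail h []            N = ⊤
  Trail h ((u , _) ∷ P) N = N 6 (length P ℕ.+ h) ≡ toℕ u × Trail h P N

  trail-cong : ∀ h P {N N′} → (∀ i → i ℕ.< length P ℕ.+ h → N′ 6 i ≡ N 6 i) → Trail h P N → Trail h P N′
  trail-cong h []      eq t       = t
  trail-cong h (_ ∷ P) eq (e , t) = ≡.trans (eq _ ℕ.≤-refl) e , trail-cong h P (λ i i< → eq i (ℕ.m≤n⇒m≤1+n i<)) t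

  -- The order in which Λ is sampled: D is its initial segment, reversed.
  revAppend : Pins n → List (Fin n) → List (Fin n)
  revAppend []            vs = vs
  revAppend ((v , _) ∷ D) vs = revAppend D (v ∷ vs)

  OutRep : Pins n → Arrays → Set
  OutRep []            N = ⊤
  OutRep ((v , s) ∷ D) N = N 0 (length D) ≡ toℕ s × OutRep D N

  out-cong : ∀ D {N N′} → (∀ i → i ℕ.< length D → N′ 0 i ≡ N 0 i) → OutRep D N → OutRep D N′
  out-cong []      eq o       = o
  out-cong (_ ∷ D) eq (e , o) = ≡.trans (eq _ ℕ.≤-refl) e , out-cong D (λ i i< → eq i (ℕ.m≤n⇒m≤1+n i<)) o

  length-revAppend : ∀ D vs → length (revAppend D vs) ≡ length D ℕ.+ length vs
  length-revAppend []      vs = ≡.refl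
  length-revAppend (_ ∷ D) vs = ≡.trans (length-revAppend D _) (ℕ.+-suc (length D) (length vs))

  revAppend-‼ : ∀ D v vs → revAppend D (v ∷ vs) ‼ length D ≡ just v
  revAppend-‼ D v vs = ≡.trans (≡.cong (revAppend D (v ∷ vs) ‼_) (≡.sym (ℕ.+-identityʳ (length D)))) (go D (v ∷ vs) 0)
    where
    go : ∀ D vs k → revAppend D vs ‼ (length D ℕ.+ k) ≡ vs ‼ k
    go []      vs k = ≡.refl
    go ((u , _) ∷ D) vs k = ≡.trans (≡.cong (revAppend D (u ∷ vs) ‼_) (≡.sym (ℕ.+-suc (length D) k))) (go D (u ∷ vs) (suc k))

  unique-revAppend : ∀ D vs → Unique (revAppend D vs) → Unique vs × (∀ v → v ∈ vs → find (pin* D []) v ≡ nothing)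
  unique-revAppend []            vs uniq = uniq , λ _ _ → ≡.refl
  unique-revAppend ((u , s) ∷ D) vs uniq with unique-revAppend D (u ∷ vs) uniq
  ... | (u≢vs ∷ uniq′) , fresh = uniq′ , λ v v∈vs →
    ≡.trans (find-there (pin s) (pin* D []) (All.lookup u≢vs v∈vs)) (fresh v (there v∈vs))

‼-allFin : ∀ {m} (v : Fin m) → allFin m ‼ toℕ v ≡ just v
‼-allFin v = go v (λ x → x)
  where
  go : ∀ {a} {A : Set a} {m} (v : Fin m) (f : Fin m → A) → List.tabulate f ‼ toℕ v ≡ just (f v)
  go zero    f = ≡.refl
  go (suc v) f = go v (f ∘ suc)

drop-∷ : ∀ {a} {A : Set a} i (xs : List A) {y ys} → drop i xs ≡ y ∷ ys →
         i ℕ.< length xs × drop (suc i) xs ≡ ys × y ∈ xs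
drop-∷ zero    (x ∷ xs) ≡.refl = ℕ.s≤s ℕ.z≤n , ≡.refl , here ≡.refl
drop-∷ (suc i) (x ∷ xs) eq with drop-∷ i xs eq
... | i< , eq′ , y∈xs = ℕ.s≤s i< , eq′ , there y∈xs

drop-[] : ∀ {a} {A : Set a} i (xs : List A) → drop i xs ≡ [] → length xs ℕ.≤ i
drop-[] zero    []       eq = ℕ.z≤n
drop-[] (suc i) []       eq = ℕ.z≤n
drop-[] (suc i) (x ∷ xs) eq = ℕ.s≤s (drop-[] i xs eq)

module Simulation {c ℓ₁ ℓ₂} (F : ArchimedeanOrderedField c ℓ₁ ℓ₂) (I : Over.IsingModel F)
                  (Z≉0 : Nondegenerate F I)
                  (Λ : List (Fin (Over.IsingModel.n I))) (unique-Λ : Unique Λ) where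
  open OrderedField F
  open Products F
  open Solver
  open Over F
  open Conditional F I Z≉0
  open Run I Λ
  open Memory
  open Reward F I Λ

  probe-deg-toℕ : ∀ v → probe-deg (toℕ v) ≡ degree v
  probe-deg-toℕ v rewrite ‼-allFin v = ≡.refl

  probe-nbr-toℕ : ∀ v i {u us} → drop i (neighbors v) ≡ u ∷ us → probe-nbr (toℕ v) i ≡ toℕ u
  probe-nbr-toℕ v i eq rewrite ‼-allFin v | eq = ≡.refl

  probe-field-toℕ : ∀ v a → probe-field (toℕ v) (toℕ a) ≡ field-of v a
  probe-field-toℕ v a rewrite ‼-allFin v | ‼-allFin a = ≡.refl

  nonempty : ∀ {u} {us : List (Fin n)} → u ∈ us → 0 ℕ.< length us
  nonempty (here _)  = ℕ.s≤s ℕ.z≤n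
  nonempty (there _) = ℕ.s≤s ℕ.z≤n

  probe-edge-toℕ : ∀ v a b {u} → u ∈ neighbors v → probe-edge (toℕ v) 0 (toℕ a) (toℕ b) ≡ A a b
  probe-edge-toℕ v a b u∈ rewrite probe-deg-toℕ v | dec-true (0 ℕ.<? degree v) (nonempty u∈)
    | ‼-allFin a | ‼-allFin b = ≡.refl

  Frames : Stack n → Arrays → Set
  Frames (root _ _)         N = ⊤
  Frames (frame b v a us P) N =
    N 2 (suc (depth b)) ≡ toℕ v × N 3 (suc (depth b)) ≡ toℕ a ×
    drop (N 4 (suc (depth b))) (neighbors v) ≡ us × N 5 (suc (depth b)) ≡ height b ×
    Trail (height b) P N × Frames b N

  -- Agreement on what the frames up to depth `k` and the trail below height `h` occupy; this
  -- survives the writes made while a vertex above them is processed.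
  record Agree (k h : ℕ) (N N′ : Arrays) : Set where
    constructor agree
    field
      a2 : ∀ i → i ℕ.≤ k → N′ 2 i ≡ N 2 i
      a3 : ∀ i → i ℕ.≤ k → N′ 3 i ≡ N 3 i
      a4 : ∀ i → i ℕ.≤ k → N′ 4 i ≡ N 4 i
      a5 : ∀ i → i ℕ.≤ k → N′ 5 i ≡ N 5 i
      a6 : ∀ i → i ℕ.< h → N′ 6 i ≡ N 6 i

  frames-cong : ∀ b {N N′} → Agree (depth b) (height b) N N′ → Frames b N → Frames b N′
  frames-cong (root _ _)         ag f = _
  frames-cong (frame b v a us P) {N} {N′} (agree a2 a3 a4 a5 a6) (e2 , e3 , e4 , e5 , t , f) =
    ≡.trans (a2 _ ℕ.≤-refl) e2 , ≡.trans (a3 _ ℕ.≤-refl) e3 ,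
    ≡.trans (≡.cong (λ i → drop i (neighbors v)) (a4 _ ℕ.≤-refl)) e4 , ≡.trans (a5 _ ℕ.≤-refl) e5 ,
    trail-cong (height b) P {N} {N′} a6 t ,
    frames-cong b (agree (λ i i≤ → a2 i (ℕ.m≤n⇒m≤1+n i≤)) (λ i i≤ → a3 i (ℕ.m≤n⇒m≤1+n i≤))
                         (λ i i≤ → a4 i (ℕ.m≤n⇒m≤1+n i≤)) (λ i i≤ → a5 i (ℕ.m≤n⇒m≤1+n i≤))
                         (λ i i< → a6 i (ℕ.<-≤-trans i< (ℕ.m≤n+m (height b) (length P))))) f

  -- v is the vertex sampled on top of b.
  Base : Stack n → Fin n → Arrays → Set
  Base (root D vs)        v N = revAppend D (v ∷ vs) ≡ Λ × N 7 3 ≡ length D × OutRep D N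
  Base (frame b w _ _ _)  v N = v ∈ neighbors w × Base b w N

  base-cong : ∀ b v {N N′} → N′ 7 3 ≡ N 7 3 → (∀ i → N′ 0 i ≡ N 0 i) → Base b v N → Base b v N′
  base-cong (root D vs)       v {N} {N′} e eq (split , pos , out) =
    split , ≡.trans e pos , out-cong D {N} {N′} (λ i _ → eq i) out
  base-cong (frame b w _ _ _) v e eq (v∈ , base)        = v∈ , base-cong b w e eq base

  record Common (b : Stack n) (v : Fin n) (N : Arrays) : Set where
    constructor common
    field
      depth≡  : N 7 1 ≡ suc (depth b)
      vertex≡ : N 2 (suc (depth b)) ≡ toℕ v
      bottom≡ : N 5 (suc (depth b)) ≡ height b
      frames  : Frames b N
      base    : Base b v N

  record Active (b : Stack n) (v : Fin n) (a : Spin) (P₀ : Pins n) (N : Arrays) : Set where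
    constructor active
    field
      comm     : Common b v N
      colour≡  : N 3 (suc (depth b)) ≡ toℕ a
      height≡  : N 7 2 ≡ length P₀ ℕ.+ height b
      trail    : Trail (height b) P₀ N
      distinct : Distinct (pin* P₀ ((v , act a) ∷ marks b))
      status   : Status (pin* P₀ ((v , act a) ∷ marks b)) N
    open Common comm public

    vertexᵀ : N 2 (N 7 1) ≡ toℕ v
    vertexᵀ = ≡.trans (≡.cong (N 2) depth≡) vertex≡

    colourᵀ : N 3 (N 7 1) ≡ toℕ a
    colourᵀ = ≡.trans (≡.cong (N 3) depth≡) colour≡

    bottomᵀ : N 5 (N 7 1) ≡ height b
    bottomᵀ = ≡.trans (≡.cong (N 5) depth≡) bottom≡

  active-cong : ∀ {b v a P₀ N N′} →
    (∀ i → N′ 0 i ≡ N 0 i) → (∀ i → N′ 1 i ≡ N 1 i) → (∀ i → N′ 2 i ≡ N 2 i) → (∀ i → N′ 3 i ≡ N 3 i) →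
    (∀ i → i ℕ.≤ depth b → N′ 4 i ≡ N 4 i) → (∀ i → N′ 5 i ≡ N 5 i) → (∀ i → N′ 6 i ≡ N 6 i) →
    N′ 7 1 ≡ N 7 1 → N′ 7 2 ≡ N 7 2 → N′ 7 3 ≡ N 7 3 →
    Active b v a P₀ N → Active b v a P₀ N′
  active-cong {b} {v} {a} {P₀} {N} {N′} a0 a1 a2 a3 a4 a5 a6 s1 s2 s3 (active (common d ve bo fr ba) co he tr di st) = active
    (common (≡.trans s1 d) (≡.trans (a2 _) ve) (≡.trans (a5 _) bo)
      (frames-cong b (agree (λ i _ → a2 i) (λ i _ → a3 i) a4 (λ i _ → a5 i) (λ i _ → a6 i)) fr) (base-cong b v s3 a0 ba))
    (≡.trans (a3 _) co) (≡.trans s2 he) (trail-cong (height b) P₀ {N} {N′} (λ i _ → a6 i) tr) di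
    (λ u → ≡.trans (a1 _) (st u))

  ≤⇒≢suc : ∀ {i k} → i ℕ.≤ k → i ≢ suc k
  ≤⇒≢suc i≤k ≡.refl = ℕ.1+n≰n i≤k

  module _ (ρ₀ : Carrier) (h : Memory → Carrier) (0≤ρ₀ : 0# ≤ ρ₀) (0≤h : ∀ m → 0# ≤ h m)
           (Tₛ Tᵣ : Carrier) (0≤Tₛ : 0# ≤ Tₛ) (0≤Tᵣ : 0# ≤ Tᵣ)
           (g : Pins n → Carrier) (0≤g : ∀ D → 0# ≤ g D) where

    open Value ρ₀ h 0≤ρ₀ 0≤h

    ρ : Carrier
    ρ = cost (suc (size body))

    0≤ρ : 0# ≤ ρ
    0≤ρ = *-nonNegative (0≤fromℕ (suc (size body))) 0≤ρ₀

    open Potential F I Z≉0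
    open Bounds ρ Tₛ Tᵣ 0≤ρ 0≤Tₛ 0≤Tᵣ g 0≤g

    bit : Bool → ℕ
    bit true  = 1
    bit false = 0

    -- The loop invariant, with the stack as ghost state: the memory holds it in pieces, and the
    -- bound attached to a memory is read off from it.
    data Reach : Memory → Carrier → Set (c Level.⊔ ℓ₂) where
      at-root : ∀ {m} D vs → nats m 7 0 ≡ 0 → nats m 7 1 ≡ 0 → nats m 7 2 ≡ 0 →
                revAppend D vs ≡ Λ → nats m 7 3 ≡ length D → OutRep D (nats m) →
                Distinct (pin* D []) → Status (pin* D []) (nats m) →
                Reach m (rootValue vs D)
      at-halt : ∀ {m} D → nats m 7 0 ≡ 4 → revAppend D [] ≡ Λ → OutRep D (nats m) →
                Distinct (pin* D []) → Reach m (ρ + g D)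
      at-start : ∀ {m} b v → nats m 7 0 ≡ 1 → Common b v (nats m) → nats m 7 2 ≡ height b →
                 find (marks b) v ≡ nothing → Distinct (marks b) → Status (marks b) (nats m) →
                 Reach m (call b v)
      at-scan : ∀ {m} b v a us P₀ → nats m 7 0 ≡ 2 → Active b v a P₀ (nats m) →
                drop (nats m 4 (suc (depth b))) (neighbors v) ≡ us → Reach m (scan b v a us P₀)
      at-unwind : ∀ {m} ok b v a P₀ → nats m 7 0 ≡ 3 → nats m 7 4 ≡ bit ok → Active b v a P₀ (nats m) →
                  Reach m (unwind ok b v a P₀)

    0≤Reach : ∀ m x → Reach m x → 0# ≤ x
    0≤Reach m _ (at-root D vs _ _ _ _ _ _ _ _)   = 0≤rootValue vs D
    0≤Reach m _ (at-halt D _ _ _ _)              = +-nonNegative 0≤ρ (0≤g D)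
    0≤Reach m _ (at-start b v _ _ _ _ _ _)       = 0≤call b v
    0≤Reach m _ (at-scan b v a us P₀ _ _ _)      = 0≤scan b v a us P₀
    0≤Reach m _ (at-unwind ok b v a P₀ _ _ _)    = 0≤unwind ok b v a P₀

    Step : Cmd → Memory → Carrier → Set (c Level.⊔ ℓ₂)
    Step e m x = ∃ λ y → wp e Reach m y × ρ + y ≤ x

    wp-push : ∀ {Q m x} u k y h′ → nats m 7 1 ≡ k → evalN u m ≡ y → nats m 7 2 ≡ h′ →
      Q (mem (nats m [ 2 , suc k ]≔ y [ 5 , suc k ]≔ h′ [ 7 , 1 ]≔ suc k [ 7 , 0 ]≔ 1) (reals m)) x →
      wp (push u) Q m x
    wp-push {m = m} u k y h′ eqk equ eqh q =
      suc k , y , k+1 , equ , suc k , h′ , k+1 , eqh , 1 , suc k , ≡.refl , k+1 , 0 , 1 , ≡.refl , ≡.refl , q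
      where
      k+1 : nats m 7 1 ℕ.+ 1 ≡ suc k
      k+1 = ≡.trans (ℕ.+-comm _ 1) (≡.cong suc eqk)

    step-root-end : ∀ m D → nats m 7 0 ≡ 0 → revAppend D [] ≡ Λ → nats m 7 3 ≡ length D → OutRep D (nats m) →
                    Distinct (pin* D []) → Step rootC m (rootValue [] D)
    step-root-end m D md split pos out dist = _ ,
      inj₂ (dec-false (_ ℕ.≤? _) full , 0 , 4 , ≡.refl , ≡.refl , at-halt D ≡.refl split (out-cong D {nats m} (λ _ _ → ≡.refl) out) dist) , ≤-refl
      where
      full : ¬ (nats m 7 3 ℕ.+ 1 ℕ.≤ length Λ)
      full le rewrite pos | ≡.sym split | length-revAppend D [] | ℕ.+-identityʳ (length D) | ℕ.+-comm (length D) 1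
        = ℕ.1+n≰n le

    step-root-call : ∀ m D v vs → nats m 7 0 ≡ 0 → nats m 7 1 ≡ 0 → nats m 7 2 ≡ 0 →
                     revAppend D (v ∷ vs) ≡ Λ → nats m 7 3 ≡ length D → OutRep D (nats m) →
                     Distinct (pin* D []) → Status (pin* D []) (nats m) → Step rootC m (rootValue (v ∷ vs) D)
    step-root-call m D v vs md dp ht split pos out dist st = _ ,
      inj₁ (dec-true (_ ℕ.≤? _) more , wp-push {Reach} {m} (vertexΛ positionᴱ) 0 (toℕ v) 0 dp v-eq ht
        (at-start (root D vs) v ≡.refl (common ≡.refl ≡.refl ≡.refl _ (split , pos , out-cong D {nats m} (λ _ _ → ≡.refl) out)) ht
          (proj₂ (unique-revAppend D (v ∷ vs) (≡.subst Unique (≡.sym split) unique-Λ)) v (here ≡.refl)) dist st)) , ≤-refl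
      where
      more : nats m 7 3 ℕ.+ 1 ℕ.≤ length Λ
      more rewrite pos | ≡.sym split | length-revAppend D (v ∷ vs) = ℕ.+-monoʳ-≤ (length D) (ℕ.s≤s ℕ.z≤n)
      v-eq : maybe′ toℕ 0 (Λ ‼ nats m 7 3) ≡ toℕ v
      v-eq = ≡.cong (maybe′ toℕ 0) (≡.trans (≡.cong₂ _‼_ (≡.sym split) pos) (revAppend-‼ D v vs))

    step-start : ∀ m b v → Common b v (nats m) → nats m 7 2 ≡ height b →
                 find (marks b) v ≡ nothing → Distinct (marks b) → Status (marks b) (nats m) →
                 (let L = (v , act zero) ∷ marks b in
                  1# + (1# + 1# + scanTime L (neighbors v)) ≤ κ ^ inactive L (neighbors v) * callTime b) →
                 Step startC m (call b v)
    step-start m b v (common dp ve bo fr ba) ht free dist st time =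
      Σ₂ (λ a → proposal v a * scan b v a (neighbors v) []) ,
      (k , dp , _ , _ , proposed (suc zero) , proposed zero , mix≤) , start b v free time
      where
      k = suc (depth b)
      N = nats m
      vertexᵀ : N 2 (N 7 1) ≡ toℕ v
      vertexᵀ = ≡.trans (≡.cong (N 2) dp) ve
      probe : ∀ a → probe-field (N 2 (N 7 1)) (toℕ a) ≡ field-of v a
      probe a = ≡.trans (≡.cong (λ x → probe-field x (toℕ a)) vertexᵀ) (probe-field-toℕ v a)
      p≈ : clip (probe-field (N 2 (N 7 1)) 1 ÷ (probe-field (N 2 (N 7 1)) 0 + probe-field (N 2 (N 7 1)) 1)) ≈ proposal v (suc zero)
      p≈ = trans (reflexive (≡.cong₂ (λ x y → clip (y ÷ (x + y))) (probe zero) (probe (suc zero))))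
                 (clip-id (0≤proposal v (suc zero)) (≤-by (0≤proposal v zero) (trans (+-comm _ _) (Σproposal≈1 v))))
      mix≤ : mix (clip (probe-field (N 2 (N 7 1)) 1 ÷ (probe-field (N 2 (N 7 1)) 0 + probe-field (N 2 (N 7 1)) 1)))
                 (scan b v (suc zero) (neighbors v) []) (scan b v zero (neighbors v) []) ≤
             Σ₂ (λ a → proposal v a * scan b v a (neighbors v) [])
      mix≤ = ≤-reflexive (trans (mix-congᵖ p≈) (trans (+-congˡ (*-congʳ 1-p≈)) (+-comm _ _)))
        where
        1-p≈ : 1# - proposal v (suc zero) ≈ proposal v zero
        1-p≈ = trans (+-congʳ (sym (Σproposal≈1 v)))
          (solve 2 (λ x y → x :+ y :- y := x) refl (proposal v zero) (proposal v (suc zero)))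
      proposed : ∀ a → wp (setNat 4 depthᴱ (lit 0) ⨾ setNat 1 vertexᴱ (lit 1) ⨾ set 0 (lit 2)) Reach
                          (mem (N [ 3 , k ]≔ toℕ a) (reals m)) (scan b v a (neighbors v) [])
      proposed a = k , 0 , dp , ≡.refl , toℕ v , 1 , vertexᵀ , ≡.refl , 0 , 2 , ≡.refl , ≡.refl ,
        at-scan b v a (neighbors v) [] ≡.refl
          (active (common dp ve bo
              (frames-cong b (agree (λ _ _ → ≡.refl) (λ i i≤ → miss (≤⇒≢suc i≤)) (λ i i≤ → miss (≤⇒≢suc i≤))
                                    (λ _ _ → ≡.refl) (λ _ _ → ≡.refl)) fr)
              (base-cong b v ≡.refl (λ _ → ≡.refl) ba))
            (hit k) ht _ (free , dist)
            (status-set (marks b) ((v , act a) ∷ marks b) N v 1 st (λ u v≢u → ≡.sym (find-there (act a) (marks b) v≢u))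
              (≡.cong code (≡.sym (find-here v (act a) (marks b))))))
          (≡.cong (λ i → drop i (neighbors v)) (hit k))

    scan-cong : ∀ {b v a P₀ N} k i y → k ≡ suc (depth b) → Active b v a P₀ N →
                Active b v a P₀ (N [ 7 , 6 ]≔ y [ 4 , k ]≔ i)
    scan-cong k i y ≡.refl = active-cong r r r r (λ i i≤ → miss (≤⇒≢suc i≤)) r r ≡.refl ≡.refl ≡.refl
      where
      r : ∀ {x : ℕ → ℕ} i → x i ≡ x i
      r _ = ≡.refl

    step-scan-end : ∀ m b v a P₀ → Active b v a P₀ (nats m) →
                    drop (nats m 4 (suc (depth b))) (neighbors v) ≡ [] → Step scanC m (scan b v a [] P₀)
    step-scan-end m b v a P₀ ac dr = unwind true b v a P₀ ,
      inj₁ (dec-true (_ ℕ.≤? _) ended , 4 , 1 , ≡.refl , ≡.refl , 0 , 3 , ≡.refl , ≡.refl ,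
        at-unwind true b v a P₀ ≡.refl ≡.refl (active-cong r r r r (λ i _ → ≡.refl) r r ≡.refl ≡.refl ≡.refl ac)) ,
      scan-end b v a P₀
      where
      open Active ac
      r : ∀ {x : ℕ → ℕ} i → x i ≡ x i
      r _ = ≡.refl
      ended : probe-deg (nats m 2 (nats m 7 1)) ℕ.≤ nats m 4 (nats m 7 1)
      ended = ≡.subst₂ ℕ._≤_ (≡.sym (≡.trans (≡.cong probe-deg vertexᵀ) (probe-deg-toℕ v)))
        (≡.cong (nats m 4) (≡.sym depth≡)) (drop-[] _ (neighbors v) dr)

    wp-flipκ : ∀ {Q m x₁ x₀ y} → (∀ a b → evalR (activity (lit (toℕ a)) (lit (toℕ b))) m ≡ A a b) →
      Q (mem (nats m [ 7 , 5 ]≔ 1) (reals m)) x₁ → Q (mem (nats m [ 7 , 5 ]≔ 0) (reals m)) x₀ → mix κ x₁ x₀ ≤ y →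
      wp (ifThen (activity (lit 0) (lit 0) ≤ᴿ activity (lit 0) (lit 1))
           (flip 7 (lit 5) (activity (lit 0) (lit 0) ⊘ activity (lit 0) (lit 1)))
           (flip 7 (lit 5) (activity (lit 0) (lit 1) ⊘ activity (lit 0) (lit 0)))) Q m y
    wp-flipκ {Q} {m} {x₁} {x₀} {y} eq q₁ q₀ mix≤ with β ≤? 1# in test
    ... | yes _ = inj₁ (≡.trans (≡.cong₂ (λ p q → does (p ≤? q)) (eq zero zero) (eq zero (suc zero))) (≡.cong does test) ,
            5 , ≡.refl , x₁ , x₀ , q₁ , q₀ ,
            ≤-trans (≤-reflexive (mix-congᵖ (reflexive (≡.cong₂ (λ p q → clip (p ÷ q)) (eq zero zero) (eq zero (suc zero)))))) mix≤)
    ... | no _  = inj₂ (≡.trans (≡.cong₂ (λ p q → does (p ≤? q)) (eq zero zero) (eq zero (suc zero))) (≡.cong does test) ,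
            5 , ≡.refl , x₁ , x₀ , q₁ , q₀ ,
            ≤-trans (≤-reflexive (mix-congᵖ (reflexive (≡.cong₂ (λ p q → clip (p ÷ q)) (eq zero (suc zero)) (eq zero zero))))) mix≤)

    opp-∸ : ∀ s → 1 ℕ.∸ toℕ s ≡ toℕ (opp s)
    opp-∸ zero       = ≡.refl
    opp-∸ (suc zero) = ≡.refl

    step-scan-next : ∀ m b v a u us P₀ → nats m 7 0 ≡ 2 → Active b v a P₀ (nats m) →
                     drop (nats m 4 (suc (depth b))) (neighbors v) ≡ u ∷ us → Step scanC m (scan b v a (u ∷ us) P₀)
    step-scan-next m b v a u us P₀ md ac dr = proj₁ next , inj₂ (dec-false (_ ℕ.≤? _) more ,
        6 , toℕ u , ≡.refl , nbr≡ , k , suc i , depth≡ ,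
        ≡.trans (≡.cong (λ j → N 4 j ℕ.+ 1) depth≡) (ℕ.+-comm i 1) , proj₁ (proj₂ next)) ,
      proj₂ (proj₂ next)
      where
      open Active ac
      k = suc (depth b)
      N = nats m
      i = N 4 k
      N₁ : Arrays
      N₁ = N [ 7 , 6 ]≔ toℕ u [ 4 , k ]≔ suc i
      m₁ : Memory
      m₁ = mem N₁ (reals m)
      L = pin* P₀ ((v , act a) ∷ marks b)
      r : ∀ {x : ℕ → ℕ} i → x i ≡ x i
      r _ = ≡.refl
      u∈ : u ∈ neighbors v
      u∈ = proj₂ (proj₂ (drop-∷ i (neighbors v) dr))
      dr′ : drop (suc i) (neighbors v) ≡ us
      dr′ = proj₁ (proj₂ (drop-∷ i (neighbors v) dr))
      more : ¬ (probe-deg (N 2 (N 7 1)) ℕ.≤ N 4 (N 7 1))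
      more le = ℕ.<⇒≱ (proj₁ (drop-∷ i (neighbors v) dr))
        (≡.subst₂ ℕ._≤_ (≡.trans (≡.cong probe-deg vertexᵀ) (probe-deg-toℕ v)) (≡.cong (N 4) depth≡) le)
      nbr≡ : probe-nbr (N 2 (N 7 1)) (N 4 (N 7 1)) ≡ toℕ u
      nbr≡ = ≡.trans (≡.cong₂ probe-nbr vertexᵀ (≡.cong (N 4) depth≡)) (probe-nbr-toℕ v i dr)
      ac₁ : Active b v a P₀ N₁
      ac₁ = scan-cong k (suc i) (toℕ u) ≡.refl ac
      edge : ∀ c d → probe-edge (N 2 (N 7 1)) 0 (toℕ c) (toℕ d) ≡ A c d
      edge c d = ≡.trans (≡.cong (λ x → probe-edge x 0 (toℕ c) (toℕ d)) vertexᵀ) (probe-edge-toℕ v c d u∈)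
      dropped : drop (if does (k ℕ.≟ k) then suc i else N 4 k) (neighbors v) ≡ us
      dropped = ≡.trans (≡.cong (λ j → drop j (neighbors v)) (hit k)) dr′
      advance : ∀ y → Reach (mem (N₁ [ 7 , 5 ]≔ y [ 7 , 6 ]≔ 0) (reals m)) (scan b v a us P₀)
      advance y = at-scan b v a us P₀ md (active-cong r r r r (λ _ _ → ≡.refl) r r ≡.refl ≡.refl ≡.refl ac₁) dropped
      rest : Cmd
      rest = ifThen (natAt 1 neighbourᴱ ≤ᴺ lit 0) freeC (ifThen (natAt 1 neighbourᴱ ≤ᴺ lit 1) skip pinC)
      test : ∀ j {mk} → find L u ≡ mk → does (N 1 (toℕ u) ℕ.≤? j) ≡ does (code mk ℕ.≤? j)
      test j eq = ≡.cong (λ x → does (x ℕ.≤? j)) (≡.trans (status u) (≡.cong code eq))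
      called : find L u ≡ nothing →
        Reach (mem (N₁ [ 7 , 5 ]≔ 0 [ 2 , suc k ]≔ toℕ u [ 5 , suc k ]≔ height (frame b v a us P₀) [ 7 , 1 ]≔ suc k [ 7 , 0 ]≔ 1) (reals m))
              (call (frame b v a us P₀) u)
      -- The index was advanced before the coin toss, so the suspended frame already lists only
      -- `us`.
      called eq = at-start (frame b v a us P₀) u ≡.refl
        (common ≡.refl (hit (suc k)) (hit (suc k))
          (≡.trans (miss ≢) vertex≡ , colour≡ , dropped , ≡.trans (miss ≢) bottom≡ ,
           trail-cong (height b) P₀ {N} (λ _ _ → ≡.refl) trail ,
           frames-cong b (agree (λ i i≤ → miss (≤⇒≢suc (ℕ.m≤n⇒m≤1+n i≤))) (λ _ _ → ≡.refl) (λ i i≤ → miss (≤⇒≢suc i≤))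
                                (λ i i≤ → miss (≤⇒≢suc (ℕ.m≤n⇒m≤1+n i≤))) (λ _ _ → ≡.refl)) frames)
          (u∈ , base-cong b v {N} ≡.refl (λ _ → ≡.refl) base))
        height≡ eq distinct status
        where
        ≢ : k ≢ suc k
        ≢ = ≤⇒≢suc ℕ.≤-refl
      next′ : ∀ mk → find L u ≡ mk → ∃ λ y → wp rest Reach m₁ y × ρ + y ≤ scan b v a (u ∷ us) P₀
      next′ nothing eq = mix κ (scan b v a us P₀) (call (frame b v a us P₀) u) , inj₁ (test 0 eq ,
        wp-flipκ {wp (ifThen (lit 1 ≤ᴺ coinᴱ) skip (push neighbourᴱ)) Reach} {m₁} {scan b v a us P₀} {call (frame b v a us P₀) u} edge
          (inj₁ (≡.refl , 6 , 0 , ≡.refl , ≡.refl , advance 1))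
          (inj₂ (≡.refl , wp-push {Reach} neighbourᴱ k (toℕ u) (height (frame b v a us P₀)) depth≡ ≡.refl height≡ (called eq)))
          ≤-refl) ,
        scan-free b v a u us P₀ eq
      next′ (just (act x)) eq = scan b v a us P₀ , inj₂ (test 0 eq , inj₁ (test 1 eq , 6 , 0 , ≡.refl , ≡.refl ,
          at-scan b v a us P₀ md (active-cong r r r r (λ _ _ → ≡.refl) r r ≡.refl ≡.refl ≡.refl ac₁) dropped)) ,
        scan-act b v a u us P₀ (≡.cong isAct eq)
      next′ (just (pin s)) eq = mix (Â a s) (scan b v a us P₀) (unwind false b v a P₀) , inj₂ (test 0 eq , inj₂ (test 1 eq , 5 , ≡.refl , scan b v a us P₀ , unwind false b v a P₀ ,
          inj₁ (≡.refl , 6 , 0 , ≡.refl , ≡.refl , advance 1) ,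
          inj₂ (≡.refl , 4 , 0 , ≡.refl , ≡.refl , 0 , 3 , ≡.refl , ≡.refl ,
            at-unwind false b v a P₀ ≡.refl ≡.refl (active-cong r r r r (λ _ _ → ≡.refl) r r ≡.refl ≡.refl ≡.refl ac₁)) ,
          ≤-reflexive (mix-congᵖ coin))) ,
        scan-pin b v a u us P₀ s eq
        where
        pinned : N 1 (toℕ u) ℕ.∸ 2 ≡ toℕ s
        pinned = ≡.cong (ℕ._∸ 2) (≡.trans (status u) (≡.cong code eq))
        edge′ : ∀ x d → x ≡ toℕ d → probe-edge (N 2 (N 7 1)) 0 (N 3 (N 7 1)) x ≡ A a d
        edge′ x d eq = ≡.trans (≡.cong₂ (probe-edge (N 2 (N 7 1)) 0) colourᵀ eq) (edge a d)
        coin : clip (probe-edge (N 2 (N 7 1)) 0 (N 3 (N 7 1)) (N 1 (toℕ u) ℕ.∸ 2) ÷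
                     probe-edge (N 2 (N 7 1)) 0 (N 3 (N 7 1)) (1 ℕ.∸ (N 1 (toℕ u) ℕ.∸ 2))) ≈ Â a s
        coin = trans (reflexive (≡.cong₂ (λ p q → clip (p ÷ q)) (edge′ _ s pinned)
                 (edge′ _ (opp s) (≡.trans (≡.cong (1 ℕ.∸_) pinned) (opp-∸ s))))) (clip-ratio a s)
      next : ∃ λ y → wp rest Reach m₁ y × ρ + y ≤ scan b v a (u ∷ us) P₀
      next = next′ (find L u) ≡.refl

    step-scan : ∀ m b v a us P₀ → nats m 7 0 ≡ 2 → Active b v a P₀ (nats m) →
                drop (nats m 4 (suc (depth b))) (neighbors v) ≡ us → Step scanC m (scan b v a us P₀)
    step-scan m b v a []       P₀ md ac dr = step-scan-end m b v a P₀ ac dr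
    step-scan m b v a (u ∷ us) P₀ md ac dr = step-scan-next m b v a u us P₀ md ac dr

    step-pop : ∀ m ok b v a u s P₀ → nats m 7 0 ≡ 3 → nats m 7 4 ≡ bit ok → Active b v a ((u , s) ∷ P₀) (nats m) →
               Step unwindC m (unwind ok b v a ((u , s) ∷ P₀))
    step-pop m ok b v a u s P₀ md okf ac@(active (common dp ve bo fr ba) co ht (top , tr) (free , dist) st) = unwind ok b v a P₀ ,
      inj₂ (dec-false (_ ℕ.≤? _) above , 2 , length P₀ ℕ.+ height b , ≡.refl , ≡.cong (ℕ._∸ 1) ht ,
        toℕ u , 0 , top , ≡.refl ,
        at-unwind ok b v a P₀ md okf
          (active (common dp ve bo (frames-cong b (agree r r r r r) fr) (base-cong b v {nats m} ≡.refl (λ _ → ≡.refl) ba))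
            co ≡.refl (trail-cong (height b) P₀ {nats m} (λ _ _ → ≡.refl) tr) dist
            (status-set ((u , pin s) ∷ L) L (nats m) u 0 st (λ x u≢x → find-there (pin s) L u≢x) (≡.cong code (≡.sym free))))) ,
      unwind-pop ok b v a u s P₀
      where
      L = pin* P₀ ((v , act a) ∷ marks b)
      r : ∀ {x : ℕ → ℕ} {R : ℕ → Set} i → R i → x i ≡ x i
      r _ _ = ≡.refl
      open Active ac using (bottomᵀ)
      above : ¬ (nats m 7 2 ℕ.≤ nats m 5 (nats m 7 1))
      above le = ℕ.<⇒≱ (ℕ.s≤s (ℕ.m≤n+m (height b) (length P₀))) (≡.subst₂ ℕ._≤_ ht bottomᵀ le)

    bottomed : ∀ {b v a} {N : Arrays} → Active b v a [] N → does (N 7 2 ℕ.≤? N 5 (N 7 1)) ≡ true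
    bottomed ac = dec-true (_ ℕ.≤? _) (ℕ.≤-reflexive (≡.trans height≡ (≡.sym bottomᵀ)))
      where open Active ac

    step-failure : ∀ m b v a → nats m 7 4 ≡ 0 → Active b v a [] (nats m) → Step unwindC m (unwind false b v a [])
    step-failure m b v a okf ac@(active (common dp ve bo fr ba) co ht _ (free , dist) st) = call b v ,
      inj₁ (bottomed ac , inj₂ (≡.cong (λ x → does (1 ℕ.≤? x)) okf ,
        toℕ v , 0 , vertexᵀ , ≡.refl , 0 , 1 , ≡.refl , ≡.refl ,
        at-start b v ≡.refl
          (common dp ve bo (frames-cong b (agree r r r r r) fr) (base-cong b v {nats m} ≡.refl (λ _ → ≡.refl) ba))
          ht free dist
          (status-set ((v , act a) ∷ marks b) (marks b) (nats m) v 0 st (λ x v≢x → find-there (act a) (marks b) v≢x)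
            (≡.cong code (≡.sym free))))) ,
      unwind-failure b v a
      where
      open Active ac using (vertexᵀ)
      r : ∀ {x : ℕ → ℕ} {R : ℕ → Set} i → R i → x i ≡ x i
      r _ _ = ≡.refl

    step-success : ∀ m b v a → nats m 7 4 ≡ 1 → Active b v a [] (nats m) → Step unwindC m (unwind true b v a [])
    step-success m b v s okf ac@(active (common dp ve bo fr ba) co ht _ (free , dist) st) = ret b v s ,
      inj₁ (bottomed ac , inj₁ (≡.cong (λ x → does (1 ℕ.≤? x)) okf ,
        toℕ v , 2 ℕ.+ toℕ s , vertexᵀ , ≡.cong (2 ℕ.+_) colourᵀ , 1 , depth b , ≡.refl , ≡.cong (ℕ._∸ 1) dp ,
        returned b fr ba dp co ht free dist pinned)) ,
      unwind-success b v s
      where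
      open Active ac using (vertexᵀ; colourᵀ)
      N = nats m
      N₁ : Stack n → Arrays
      N₁ b = N [ 1 , toℕ v ]≔ (2 ℕ.+ toℕ s) [ 7 , 1 ]≔ depth b
      pinned : Status ((v , pin s) ∷ marks b) (N₁ b)
      pinned = status-set ((v , act s) ∷ marks b) ((v , pin s) ∷ marks b) N v (2 ℕ.+ toℕ s) st
        (λ x v≢x → ≡.trans (find-there (act s) (marks b) v≢x) (≡.sym (find-there (pin s) (marks b) v≢x)))
        (≡.cong code (≡.sym (find-here v (pin s) (marks b))))
      returned : ∀ b → Frames b N → Base b v N → N 7 1 ≡ suc (depth b) → N 3 (suc (depth b)) ≡ toℕ s →
                 N 7 2 ≡ height b → find (marks b) v ≡ nothing → Distinct (marks b) → Status ((v , pin s) ∷ marks b) (N₁ b) →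
                 wp (ifThen (depthᴱ ≤ᴺ lit 0) rootRetC frameRetC) Reach (mem (N₁ b) (reals m)) (ret b v s)
      returned (root D vs) fr (split , pos , out) dp co ht free dist st = inj₁ (≡.refl ,
        length D , toℕ s , pos , co , 3 , suc (length D) , ≡.refl , ≡.trans (ℕ.+-comm _ 1) (≡.cong suc pos) ,
        0 , 0 , ≡.refl , ≡.refl ,
        at-root ((v , s) ∷ D) vs ≡.refl ≡.refl ht split ≡.refl
          (hit (length D) , out-cong D {N} (λ i i< → miss (ℕ.<⇒≢ i<)) out) (free , dist) st)
      returned b′@(frame b w a us P₀) (e2 , e3 , e4 , e5 , tr , fr) (v∈ , ba) dp co ht free dist st = inj₂ (≡.refl ,
          h′ , toℕ v , ht , ≡.trans (≡.cong (N 2) k+1) (≡.subst (λ j → N 2 j ≡ toℕ v) dp vertexᵀ) ,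
          2 , suc h′ , ≡.refl , ≡.trans (ℕ.+-comm _ 1) (≡.cong suc ht) , check (D a s) test)
        where
        k = suc (depth b)
        h′ = height b′
        k+1 : k ℕ.+ 1 ≡ suc k
        k+1 = ℕ.+-comm k 1
        N₂ : Arrays
        N₂ = N₁ b′ [ 6 , h′ ]≔ toℕ v [ 7 , 2 ]≔ suc h′
        resumed : Active b w a ((v , s) ∷ P₀) N₂
        resumed = active
          (common ≡.refl e2 e5
            (frames-cong b (agree (λ _ _ → ≡.refl) (λ _ _ → ≡.refl) (λ _ _ → ≡.refl) (λ _ _ → ≡.refl)
              (λ i i< → miss (ℕ.<⇒≢ (ℕ.<-≤-trans i< (ℕ.m≤n+m (height b) (length P₀)))))) fr)
            (base-cong b w {N} ≡.refl (λ _ → ≡.refl) ba))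
          e3 ≡.refl
          (hit h′ , trail-cong (height b) P₀ {N} (λ i i< → miss (ℕ.<⇒≢ i<)) tr)
          (free , dist) st
        -- The probe at neighbour 0 of `w` is in range because `v` is a neighbour of `w`.
        edge : ∀ x d → x ≡ toℕ d → probe-edge (N 2 k) 0 (N 3 k) x ≡ A a d
        edge x d eq rewrite e2 | e3 | eq = probe-edge-toℕ w a d v∈
        colour≡ : N 3 (k ℕ.+ 1) ≡ toℕ s
        colour≡ = ≡.trans (≡.cong (N 3) k+1) co
        test : does (probe-edge (N 2 k) 0 (N 3 k) (1 ℕ.∸ N 3 (k ℕ.+ 1)) ≤? probe-edge (N 2 k) 0 (N 3 k) (N 3 (k ℕ.+ 1))) ≡ D a s
        test = ≡.cong₂ (λ p q → does (p ≤? q))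
          (edge _ (opp s) (≡.trans (≡.cong (1 ℕ.∸_) colour≡) (opp-∸ s))) (edge _ s colour≡)
        check : ∀ d → does (probe-edge (N 2 k) 0 (N 3 k) (1 ℕ.∸ N 3 (k ℕ.+ 1)) ≤? probe-edge (N 2 k) 0 (N 3 k) (N 3 (k ℕ.+ 1))) ≡ d →
          wp (ifThen (activity colourᴱ (lit 1 ⊖ natAt 3 (depthᴱ ⊕ lit 1)) ≤ᴿ activity colourᴱ (natAt 3 (depthᴱ ⊕ lit 1)))
               (set 0 (lit 2)) failC) Reach (mem N₂ (reals m))
             (if d then scan b w a us ((v , s) ∷ P₀) else unwind false b w a ((v , s) ∷ P₀))
        check true  t = inj₁ (t , 0 , 2 , ≡.refl , ≡.refl ,
          at-scan b w a us ((v , s) ∷ P₀) ≡.refl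
            (active-cong (λ _ → ≡.refl) (λ _ → ≡.refl) (λ _ → ≡.refl) (λ _ → ≡.refl) (λ _ _ → ≡.refl) (λ _ → ≡.refl) (λ _ → ≡.refl)
              ≡.refl ≡.refl ≡.refl resumed) e4)
        check false t = inj₂ (t , 4 , 0 , ≡.refl , ≡.refl , 0 , 3 , ≡.refl , ≡.refl ,
          at-unwind false b w a ((v , s) ∷ P₀) ≡.refl ≡.refl
            (active-cong (λ _ → ≡.refl) (λ _ → ≡.refl) (λ _ → ≡.refl) (λ _ → ≡.refl) (λ _ _ → ≡.refl) (λ _ → ≡.refl) (λ _ → ≡.refl)
              ≡.refl ≡.refl ≡.refl resumed))

    step-unwind : ∀ m ok b v a P₀ → nats m 7 0 ≡ 3 → nats m 7 4 ≡ bit ok → Active b v a P₀ (nats m) →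
                  Step unwindC m (unwind ok b v a P₀)
    step-unwind m true  b v a []             md okf ac = step-success m b v a okf ac
    step-unwind m false b v a []             md okf ac = step-failure m b v a okf ac
    step-unwind m ok    b v a ((u , s) ∷ P₀) md okf ac = step-pop m ok b v a u s P₀ md okf ac

    module _
      (time-root  : ∀ L v → 1# + (1# + 1# + scanTime L (neighbors v)) ≤ κ ^ inactive L (neighbors v) * Tᵣ)
      (time-frame : ∀ L v {w} → w ∈ neighbors v → isAct (find L w) ≡ true →
                    1# + (1# + 1# + scanTime L (neighbors v)) ≤ κ ^ inactive L (neighbors v) * Tₛ)
      (h≤g : ∀ D m → revAppend D [] ≡ Λ → Distinct (pin* D []) → OutRep D (nats m) → h m ≤ g D) where

      -- In a recursive call the caller `w` is an active neighbour of `v`: by distinctness, the pins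
      -- laid above it are on other vertices. This is the premise of `time-frame`; at the root no
      -- such neighbour is available.
      time : ∀ b v {N} → Base b v N → find (marks b) v ≡ nothing → Distinct (marks b) →
             (let L = (v , act zero) ∷ marks b in
              1# + (1# + 1# + scanTime L (neighbors v)) ≤ κ ^ inactive L (neighbors v) * callTime b)
      time (root D vs)          v _        free dist = time-root _ v
      time (frame b w a us P₀)  v (v∈ , _) free dist = time-frame _ v (symmetric v∈)
        (≡.cong isAct (≡.trans (find-there (act zero) L (find-≢ L found free)) found))
        where
        L = pin* P₀ ((w , act a) ∷ marks b)
        found : find L w ≡ just (act a)
        found = find-pin* P₀ (marks b) w (act a) dist

      iterate : ∀ m x → Reach m x → (evalB (mode ≤ᴺ lit 3) m ≡ false × ρ₀ + h m ≤ x) ⊎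
                (evalB (mode ≤ᴺ lit 3) m ≡ true × Step body m x)
      iterate m _ (at-halt D md split out dist) = inj₁ (≡.cong (λ x → does (x ℕ.≤? 3)) md ,
        -- `ρ` covers a whole iteration, hence also the single step `ρ₀` that leaves the loop.
        +-mono-≤ (≤-by (*-nonNegative (0≤fromℕ (size body)) 0≤ρ₀) (solve 2 (λ ρ k → ρ :+ k :* ρ := (:1 :+ k) :* ρ) refl ρ₀ (fromℕ (size body))))
                 (h≤g D m split dist out))
      iterate m _ (at-root D vs md dp ht split pos out dist st) = inj₂ (≡.cong (λ x → does (x ℕ.≤? 3)) md , in-body (step-root vs split))
        where
        step-root : ∀ vs → revAppend D vs ≡ Λ → Step rootC m (rootValue vs D)
        step-root []       split = step-root-end m D md split pos out dist
        step-root (v ∷ vs) split = step-root-call m D v vs md dp ht split pos out dist st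
        in-body : ∀ {x} → Step rootC m x → Step body m x
        in-body (y , q , le) = y , inj₁ (≡.cong (λ x → does (x ℕ.≤? 0)) md , q) , le
      iterate m _ (at-start b v md co ht free dist st) = inj₂ (≡.cong (λ x → does (x ℕ.≤? 3)) md ,
        in-body (step-start m b v co ht free dist st (time b v (Common.base co) free dist)))
        where
        in-body : ∀ {x} → Step startC m x → Step body m x
        in-body (y , q , le) = y , inj₂ (≡.cong (λ x → does (x ℕ.≤? 0)) md , inj₁ (≡.cong (λ x → does (x ℕ.≤? 1)) md , q)) , le
      iterate m _ (at-scan b v a us P₀ md ac dr) = inj₂ (≡.cong (λ x → does (x ℕ.≤? 3)) md ,
        in-body (step-scan m b v a us P₀ md ac dr))
        where
        in-body : ∀ {x} → Step scanC m x → Step body m x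
        in-body (y , q , le) = y , inj₂ (≡.cong (λ x → does (x ℕ.≤? 0)) md , inj₂ (≡.cong (λ x → does (x ℕ.≤? 1)) md ,
          inj₁ (≡.cong (λ x → does (x ℕ.≤? 2)) md , q))) , le
      iterate m _ (at-unwind ok b v a P₀ md okf ac) = inj₂ (≡.cong (λ x → does (x ℕ.≤? 3)) md ,
        in-body (step-unwind m ok b v a P₀ md okf ac))
        where
        in-body : ∀ {x} → Step unwindC m x → Step body m x
        in-body (y , q , le) = y , inj₂ (≡.cong (λ x → does (x ℕ.≤? 0)) md , inj₂ (≡.cong (λ x → does (x ℕ.≤? 1)) md ,
          inj₂ (≡.cong (λ x → does (x ℕ.≤? 2)) md , q))) , le

      V≤rootValue : ∀ t → V t (initial sampler) ≤ rootValue Λ []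
      V≤rootValue t = while-sound (mode ≤ᴺ lit 3) body Reach 0≤Reach iterate t _ _
        (at-root [] Λ ≡.refl ≡.refl ≡.refl ≡.refl ≡.refl _ _ (λ _ → ≡.refl))

-- The constants of the running time.

halve : ∀ m → ∃ λ h → m ℕ.≤ h ℕ.+ h × h ℕ.+ h ℕ.≤ suc m
halve zero          = 0 , ℕ.z≤n , ℕ.z≤n
halve (suc zero)    = 1 , ℕ.s≤s ℕ.z≤n , ℕ.≤-refl
halve (suc (suc m)) with halve m
... | h , m≤ , ≤m = suc h , ≡.subst (suc (suc m) ℕ.≤_) eq (ℕ.s≤s (ℕ.s≤s m≤)) , ≡.subst (ℕ._≤ suc (suc (suc m))) eq (ℕ.s≤s (ℕ.s≤s ≤m))
  where
  eq : suc (suc (h ℕ.+ h)) ≡ suc h ℕ.+ suc h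
  eq = ≡.cong suc (≡.sym (ℕ.+-suc h h))

-- With survival at least 1/2 and at most 1/2 expected calls, a top-level trial is paid for if (3 +
-- Δ) + (Tₛ + 1)/2 ≤ Tᵣ/2. This is twice that inequality for Tₛ = 16(4 + Δ) and Tᵣ = 18(4 + Δ), with
-- 1 to spare.
root-budget : ∀ δ → 2 ℕ.* (3 ℕ.+ δ) ℕ.+ 1 ℕ.* (16 ℕ.* (4 ℕ.+ δ) ℕ.+ 1) ℕ.≤ 18 ℕ.* (4 ℕ.+ δ)
root-budget δ = ℕ.m+n≤o⇒m≤o _ {1} (ℕ.≤-reflexive
  (solve 1 (λ δ → con 2 :* (con 3 :+ δ) :+ con 1 :* (con 16 :* (con 4 :+ δ) :+ con 1) :+ con 1 := con 18 :* (con 4 :+ δ)) ≡.refl δ))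
  where open +-*-Solver

-- In a recursive trial survival is at least 9/16, so the condition is (3 + Δ) + (Tₛ + 1)/2 ≤
-- (9/16)Tₛ, here multiplied by 16. It amounts to Tₛ ≥ 16(3 + Δ) + 8, whence the choice 16(4 + Δ).
frame-budget : ∀ δ → 16 ℕ.* (3 ℕ.+ δ) ℕ.+ 8 ℕ.* (16 ℕ.* (4 ℕ.+ δ) ℕ.+ 1) ℕ.≤ 9 ℕ.* (16 ℕ.* (4 ℕ.+ δ))
frame-budget δ = ℕ.m+n≤o⇒m≤o _ {8} (ℕ.≤-reflexive
  (solve 1 (λ δ → con 16 :* (con 3 :+ δ) :+ con 8 :* (con 16 :* (con 4 :+ δ) :+ con 1) :+ con 8 := con 9 :* (con 16 :* (con 4 :+ δ))) ≡.refl δ))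
  where open +-*-Solver

module Times {c ℓ₁ ℓ₂} (F : ArchimedeanOrderedField c ℓ₁ ℓ₂) (I : Over.IsingModel F)
             (Z≉0 : Nondegenerate F I)
             (Δ : ℕ) (1≤Δ : 1 ℕ.≤ Δ) where
  open OrderedField F
  open Products F
  open Solver
  open Conditional F I Z≉0

  ½+½≈1 : ½ + ½ ≈ 1#
  ½+½≈1 = trans (solve 1 (λ h → h :+ h := h :* (:1 :+ (:1 :+ con (0 , 0)))) refl ½) (÷-* 1# (<⇒≉0 (0<fromℕ-suc 1)))

  0<½ : 0# < ½
  0<½ = ≉0⇒< (0≤÷ 0≤1 (0<fromℕ-suc 1)) λ ½≈0 → 0≉1 (trans (sym (+-identityʳ 0#)) (trans (+-cong (sym ½≈0) (sym ½≈0)) ½+½≈1))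

  module _ (degree≤Δ : ∀ v → degree v ℕ.≤ Δ)
           (β-lower : (fromℕ Δ - ½) ÷ fromℕ Δ < β) (β-upper : β < fromℕ Δ ÷ (fromℕ Δ - ½)) where

    private
      d = fromℕ Δ

      1≤d : 1# ≤ d
      1≤d = ≤-respˡ-≈ (+-identityʳ 1#) (fromℕ-mono 1≤Δ)

      0<d : 0# < d
      0<d = <-≤-trans 0<1 1≤d

      0<d-½ : 0# < d - ½
      0<d-½ = <-≤-trans 0<½ (≤-respˡ-≈ (trans (+-congʳ (sym ½+½≈1)) (solve 1 (λ h → h :+ h :- h := h) refl ½)) (+-monoˡ-≤ (- ½) 1≤d))

    q : Carrier
    q = 1# - κ

    0≤q : 0# ≤ q
    0≤q = 0≤1-x κ≤1

    -- κ is β or 1/β, and the interval for β is invariant under inversion: its lower end serves in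
    -- one case, its upper end in the other.
    d-½≤κd : d - ½ ≤ κ * d
    d-½≤κd with κ-cases
    ... | inj₁ (_ , κ≈β) = begin
      d - ½                ≈⟨ ÷-* (d - ½) (<⇒≉0 0<d) ⟨
      (d - ½) ÷ d * d      ≤⟨ *-monoˡ-≤ d (proj₁ 0<d) (proj₁ β-lower) ⟩
      β * d                ≈⟨ *-congʳ κ≈β ⟨
      κ * d                ∎
      where open ≤-Reasoning
    ... | inj₂ (_ , βκ≈1) = begin
      d - ½                      ≈⟨ trans (*-congʳ βκ≈1) (*-identityˡ _) ⟨
      β * κ * (d - ½)            ≈⟨ solve 3 (λ b k x → b :* k :* x := k :* (b :* x)) refl β κ (d - ½) ⟩
      κ * (β * (d - ½))          ≤⟨ *-monoʳ-≤ κ 0≤κ (*-monoˡ-≤ (d - ½) (proj₁ 0<d-½) (proj₁ β-upper)) ⟩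
      κ * (d ÷ (d - ½) * (d - ½)) ≈⟨ *-congˡ (÷-* d (<⇒≉0 0<d-½)) ⟩
      κ * d                      ∎
      where open ≤-Reasoning

    2mq≤1 : ∀ m → m ℕ.≤ Δ → fromℕ 2 * (fromℕ m * q) ≤ 1#
    2mq≤1 m m≤Δ = begin
      fromℕ 2 * (fromℕ m * q)   ≤⟨ *-monoʳ-≤ _ (0≤fromℕ 2) (*-monoˡ-≤ q 0≤q (fromℕ-mono m≤Δ)) ⟩
      fromℕ 2 * (d * (1# - κ))
        ≈⟨ solve 3 (λ d k h → (:1 :+ (:1 :+ con (0 , 0))) :* (d :* (:1 :- k)) := (d :- h) :- k :* d :+ ((d :- h) :- k :* d) :+ (h :+ h)) refl d κ ½ ⟩
      (d - ½) - κ * d + ((d - ½) - κ * d) + (½ + ½)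
        ≤⟨ +-mono-≤ (+-mono-≤ neg neg) (≤-reflexive ½+½≈1) ⟩
      0# + 0# + 1#              ≈⟨ trans (+-congʳ (+-identityˡ 0#)) (+-identityˡ 1#) ⟩
      1#                        ∎
      where
      open ≤-Reasoning
      neg : (d - ½) - κ * d ≤ 0#
      neg = ≤-respʳ-≈ (-‿inverseʳ (κ * d)) (+-monoˡ-≤ (- (κ * d)) d-½≤κd)

    0≤κ^ : ∀ k → 0# ≤ κ ^ k
    0≤κ^ zero    = 0≤1
    0≤κ^ (suc k) = *-nonNegative 0≤κ (0≤κ^ k)

    bernoulli : ∀ k → 1# - fromℕ k * q ≤ κ ^ k
    bernoulli zero    = ≤-reflexive (solve 1 (λ q → :1 :- con (0 , 0) :* q := :1) refl q)
    bernoulli (suc k) = ≤-trans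
      -- The slack of the induction step is `k` times the square of `q`.
      (≤-by (*-nonNegative (0≤fromℕ k) (square-nonNegative q))
        (solve 2 (λ n κ → :1 :- (:1 :+ n) :* (:1 :- κ) :+ n :* ((:1 :- κ) :* (:1 :- κ)) := κ :* (:1 :- n :* (:1 :- κ))) refl (fromℕ k) κ))
      (*-monoʳ-≤ κ 0≤κ (bernoulli k))

    κ^-antitone : ∀ {k l} → k ℕ.≤ l → κ ^ l ≤ κ ^ k
    κ^-antitone {l = zero}  ℕ.z≤n = ≤-refl
    κ^-antitone {l = suc l} ℕ.z≤n = ≤-respʳ-≈ (*-identityˡ 1#) (*-mono-≤ 0≤1 (0≤κ^ l) κ≤1 (κ^-antitone {l = l} ℕ.z≤n))
    κ^-antitone (ℕ.s≤s k≤l)       = *-monoʳ-≤ κ 0≤κ (κ^-antitone k≤l)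

    κ^-+ : ∀ k l → κ ^ (k ℕ.+ l) ≈ κ ^ k * κ ^ l
    κ^-+ zero    l = sym (*-identityˡ _)
    κ^-+ (suc k) l = trans (*-congˡ (κ^-+ k l)) (sym (*-assoc κ _ _))

    1≤2κ^ : ∀ m → m ℕ.≤ Δ → 1# ≤ fromℕ 2 * κ ^ m
    1≤2κ^ m m≤Δ = begin
      1#                                  ≈⟨ solve 1 (λ x → :1 := :1 :+ x :- x) refl (fromℕ 2 * (fromℕ m * q)) ⟩
      1# + fromℕ 2 * (fromℕ m * q) - fromℕ 2 * (fromℕ m * q)
                                          ≤⟨ +-monoˡ-≤ _ (+-monoʳ-≤ 1# (2mq≤1 m m≤Δ)) ⟩
      1# + 1# - fromℕ 2 * (fromℕ m * q)
        ≈⟨ solve 1 (λ y → :1 :+ :1 :- (:1 :+ (:1 :+ con (0 , 0))) :* y := (:1 :+ (:1 :+ con (0 , 0))) :* (:1 :- y)) refl (fromℕ m * q) ⟩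
      fromℕ 2 * (1# - fromℕ m * q)        ≤⟨ *-monoʳ-≤ _ (0≤fromℕ 2) (bernoulli m) ⟩
      fromℕ 2 * κ ^ m                     ∎
      where open ≤-Reasoning

    -- A recursive call has an active neighbour, hence m < Δ; splitting the
    -- exponent in two halves then gives (3/4)², enough above 1/2.
    9≤16κ^ : ∀ m → suc m ℕ.≤ Δ → fromℕ 9 ≤ fromℕ 16 * κ ^ m
    9≤16κ^ m m<Δ with halve m
    ... | k , m≤2k , 2k≤1+m = begin
      fromℕ 9                               ≈⟨ fromℕ-* 3 3 ⟩
      fromℕ 3 * fromℕ 3                     ≤⟨ *-mono-≤ (*-nonNegative (0≤fromℕ 4) (0≤κ^ k)) (0≤fromℕ 3) 3≤4κ^k 3≤4κ^k ⟩
      fromℕ 4 * κ ^ k * (fromℕ 4 * κ ^ k)   ≈⟨ solve 2 (λ x y → x :* y :* (x :* y) := x :* x :* (y :* y)) refl (fromℕ 4) (κ ^ k) ⟩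
      fromℕ 4 * fromℕ 4 * (κ ^ k * κ ^ k)   ≈⟨ *-cong (fromℕ-* 4 4) (κ^-+ k k) ⟨
      fromℕ 16 * κ ^ (k ℕ.+ k)              ≤⟨ *-monoʳ-≤ _ (0≤fromℕ 16) (κ^-antitone m≤2k) ⟩
      fromℕ 16 * κ ^ m                      ∎
      where
      open ≤-Reasoning
      y = fromℕ k * q
      3≤4κ^k : fromℕ 3 ≤ fromℕ 4 * κ ^ k
      3≤4κ^k = begin
        fromℕ 3                                            ≈⟨ solve 1 (λ x → :1 :+ (:1 :+ (:1 :+ con (0 , 0))) := :1 :+ (:1 :+ (:1 :+ con (0 , 0))) :+ x :- x) refl (fromℕ 2 * (fromℕ (k ℕ.+ k) * q)) ⟩
        fromℕ 3 + fromℕ 2 * (fromℕ (k ℕ.+ k) * q) - fromℕ 2 * (fromℕ (k ℕ.+ k) * q)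
                                                           ≤⟨ +-mono-≤ (+-monoʳ-≤ _ (2mq≤1 (k ℕ.+ k) (ℕ.≤-trans 2k≤1+m m<Δ)))
                                                                (≤-reflexive (-‿cong (*-congˡ (*-congʳ (fromℕ-+ k k))))) ⟩
        fromℕ 3 + 1# - fromℕ 2 * ((fromℕ k + fromℕ k) * q)
          ≈⟨ solve 2 (λ k q → :1 :+ (:1 :+ (:1 :+ con (0 , 0))) :+ :1 :- (:1 :+ (:1 :+ con (0 , 0))) :* ((k :+ k) :* q) :=
                              (:1 :+ (:1 :+ (:1 :+ (:1 :+ con (0 , 0))))) :* (:1 :- k :* q)) refl (fromℕ k) q ⟩
        fromℕ 4 * (1# - y)                                 ≤⟨ *-monoʳ-≤ _ (0≤fromℕ 4) (bernoulli k) ⟩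
        fromℕ 4 * κ ^ k                                    ∎

    inactive≤ : ∀ L us → inactive L us ℕ.≤ length us
    inactive≤ L []       = ℕ.z≤n
    inactive≤ L (u ∷ us) with isAct (find L u)
    ... | true  = ℕ.m≤n⇒m≤1+n (inactive≤ L us)
    ... | false = ℕ.s≤s (inactive≤ L us)

    inactive< : ∀ L us {w} → w ∈ us → isAct (find L w) ≡ true → suc (inactive L us) ℕ.≤ length us
    inactive< L (u ∷ us) (here ≡.refl) eq rewrite eq = ℕ.s≤s (inactive≤ L us)
    inactive< L (u ∷ us) (there w∈)    eq with isAct (find L u)
    ... | true  = ℕ.m≤n⇒m≤1+n (inactive< L us w∈ eq)
    ... | false = ℕ.s≤s (inactive< L us w∈ eq)

    Tₛℕ Tᵣℕ : ℕ
    Tₛℕ = 16 ℕ.* (4 ℕ.+ Δ)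
    Tᵣℕ = 18 ℕ.* (4 ℕ.+ Δ)

    Tₛ Tᵣ : Carrier
    Tₛ = fromℕ Tₛℕ
    Tᵣ = fromℕ Tᵣℕ

    trialTime : ℕ → ℕ → Carrier
    trialTime k m = 1# + (1# + 1# + (fromℕ k + fromℕ m * (q * (Tₛ + 1#))))

    private
      -- The scaling by `l * 2` clears the halves: `2mq≤1` then leaves `l * (Tₛ + 1)` for the calls.
      -- It is used with `l = 1` at the root and with `l = 8` in frames.
      budget : ∀ l k m → m ℕ.≤ Δ → k ℕ.≤ Δ →
               fromℕ (l ℕ.* 2) * trialTime k m ≤ fromℕ ((l ℕ.* 2) ℕ.* (3 ℕ.+ Δ) ℕ.+ l ℕ.* (Tₛℕ ℕ.+ 1))
      budget l k m m≤Δ k≤Δ = begin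
        fromℕ (l ℕ.* 2) * trialTime k m
          ≈⟨ solve 4 (λ l k y t → l :* (:1 :+ (:1 :+ :1 :+ (k :+ y :* t))) := l :* (:1 :+ (:1 :+ (:1 :+ k))) :+ l :* (y :* t)) refl (fromℕ (l ℕ.* 2)) (fromℕ k) (fromℕ m) (q * (Tₛ + 1#)) ⟩
        fromℕ (l ℕ.* 2) * fromℕ (3 ℕ.+ k) + fromℕ (l ℕ.* 2) * (fromℕ m * (q * (Tₛ + 1#)))
          ≤⟨ +-mono-≤ (*-monoʳ-≤ _ (0≤fromℕ (l ℕ.* 2)) (fromℕ-mono (ℕ.+-monoʳ-≤ 3 k≤Δ))) calls ⟩
        fromℕ (l ℕ.* 2) * fromℕ (3 ℕ.+ Δ) + fromℕ l * (Tₛ + 1#)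
          ≈⟨ +-cong (fromℕ-* (l ℕ.* 2) (3 ℕ.+ Δ)) (trans (fromℕ-* l (Tₛℕ ℕ.+ 1)) (*-congˡ (trans (fromℕ-+ Tₛℕ 1) (+-congˡ (+-identityʳ 1#))))) ⟨
        fromℕ ((l ℕ.* 2) ℕ.* (3 ℕ.+ Δ)) + fromℕ (l ℕ.* (Tₛℕ ℕ.+ 1))
          ≈⟨ fromℕ-+ ((l ℕ.* 2) ℕ.* (3 ℕ.+ Δ)) (l ℕ.* (Tₛℕ ℕ.+ 1)) ⟨
        fromℕ ((l ℕ.* 2) ℕ.* (3 ℕ.+ Δ) ℕ.+ l ℕ.* (Tₛℕ ℕ.+ 1))  ∎
        where
        open ≤-Reasoning
        calls : fromℕ (l ℕ.* 2) * (fromℕ m * (q * (Tₛ + 1#))) ≤ fromℕ l * (Tₛ + 1#)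
        calls = begin
          fromℕ (l ℕ.* 2) * (fromℕ m * (q * (Tₛ + 1#)))     ≈⟨ *-congʳ (fromℕ-* l 2) ⟩
          fromℕ l * fromℕ 2 * (fromℕ m * (q * (Tₛ + 1#)))   ≈⟨ solve 5 (λ l two m q t → l :* two :* (m :* (q :* t)) := l :* (two :* (m :* q) :* t)) refl (fromℕ l) (fromℕ 2) (fromℕ m) q (Tₛ + 1#) ⟩
          fromℕ l * (fromℕ 2 * (fromℕ m * q) * (Tₛ + 1#))   ≤⟨ *-monoʳ-≤ _ (0≤fromℕ l) (*-monoˡ-≤ _ (+-nonNegative (0≤fromℕ Tₛℕ) 0≤1) (2mq≤1 m m≤Δ)) ⟩
          fromℕ l * (1# * (Tₛ + 1#))                        ≈⟨ *-congˡ (*-identityˡ _) ⟩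
          fromℕ l * (Tₛ + 1#)                               ∎

    time-root : ∀ L v → trialTime (degree v) (inactive L (neighbors v)) ≤ κ ^ inactive L (neighbors v) * Tᵣ
    time-root L v = *-cancelˡ-≤ (fromℕ 2) (0<fromℕ-suc 1) (begin
      fromℕ 2 * trialTime (degree v) m   ≤⟨ budget 1 (degree v) m m≤Δ (degree≤Δ v) ⟩
      fromℕ (2 ℕ.* (3 ℕ.+ Δ) ℕ.+ 1 ℕ.* (Tₛℕ ℕ.+ 1))  ≤⟨ fromℕ-mono (root-budget Δ) ⟩
      Tᵣ                                 ≈⟨ *-identityˡ Tᵣ ⟨
      1# * Tᵣ                            ≤⟨ *-monoˡ-≤ Tᵣ (0≤fromℕ Tᵣℕ) (1≤2κ^ m m≤Δ) ⟩
      fromℕ 2 * κ ^ m * Tᵣ               ≈⟨ *-assoc _ _ _ ⟩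
      fromℕ 2 * (κ ^ m * Tᵣ)             ∎)
      where
      open ≤-Reasoning
      m = inactive L (neighbors v)
      m≤Δ : m ℕ.≤ Δ
      m≤Δ = ℕ.≤-trans (inactive≤ L (neighbors v)) (degree≤Δ v)

    time-frame : ∀ L v {w} → w ∈ neighbors v → isAct (find L w) ≡ true →
                 trialTime (degree v) (inactive L (neighbors v)) ≤ κ ^ inactive L (neighbors v) * Tₛ
    time-frame L v w∈ eq = *-cancelˡ-≤ (fromℕ 16) (0<fromℕ-suc 15) (begin
      fromℕ 16 * trialTime (degree v) m   ≤⟨ budget 8 (degree v) m (ℕ.<⇒≤ m<Δ) (degree≤Δ v) ⟩
      fromℕ (16 ℕ.* (3 ℕ.+ Δ) ℕ.+ 8 ℕ.* (Tₛℕ ℕ.+ 1))  ≤⟨ fromℕ-mono (frame-budget Δ) ⟩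
      fromℕ (9 ℕ.* Tₛℕ)                   ≈⟨ fromℕ-* 9 Tₛℕ ⟩
      fromℕ 9 * Tₛ                        ≤⟨ *-monoˡ-≤ Tₛ (0≤fromℕ Tₛℕ) (9≤16κ^ m m<Δ) ⟩
      fromℕ 16 * κ ^ m * Tₛ               ≈⟨ *-assoc _ _ _ ⟩
      fromℕ 16 * (κ ^ m * Tₛ)             ∎)
      where
      open ≤-Reasoning
      m = inactive L (neighbors v)
      m<Δ : suc m ℕ.≤ Δ
      m<Δ = ℕ.≤-trans (inactive< L (neighbors v) w∈ eq) (degree≤Δ v)

-- The law of the output.

revAppend-∈ : ∀ {n} (D : Pins n) vs {v} → v ∈ revAppend D vs →
              (∃ λ s → find (pin* D []) v ≡ just (pin s)) ⊎ v ∈ vs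
revAppend-∈ []            vs v∈ = inj₂ v∈
revAppend-∈ ((u , s) ∷ D) vs {v} v∈ with u Fin.≟ v
... | yes _ = inj₁ (s , ≡.refl)
... | no u≢v with revAppend-∈ D (u ∷ vs) v∈
...   | inj₁ found            = inj₁ found
...   | inj₂ (here v≡u)       = ⊥-elim (u≢v (≡.sym v≡u))
...   | inj₂ (there v∈vs)     = inj₂ v∈vs

revAppend-out : ∀ {n} (D : Pins n) vs {N} i → Distinct (pin* D []) → OutRep D N → i ℕ.< length D →
  ∃ λ v → ∃ λ s → revAppend D vs ‼ i ≡ just v × find (pin* D []) v ≡ just (pin s) × N 0 i ≡ toℕ s
revAppend-out ((u , s) ∷ D) vs i (fresh , dist) (e , out) (ℕ.s≤s i≤) with ℕ.m≤n⇒m<n∨m≡n i≤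
... | inj₂ ≡.refl = u , s , revAppend-‼ D u vs , find-here u (pin s) (pin* D []) , e
... | inj₁ i< with revAppend-out D (u ∷ vs) i dist out i<
...   | v , s′ , at , found , e′ = v , s′ , at ,
        ≡.trans (find-there (pin s) (pin* D []) (find-≢ (pin* D []) found fresh)) found , e′

‼-lookup : ∀ {a} {A : Set a} (xs : List A) i → xs ‼ toℕ i ≡ just (lookup (Vec.fromList xs) i)
‼-lookup (x ∷ xs) zero    = ≡.refl
‼-lookup (x ∷ xs) (suc i) = ‼-lookup xs i

map-fromList-cong : ∀ {a b} {A : Set a} {B : Set b} {f g : A → B} xs → (∀ x → x ∈ xs → f x ≡ g x) →
                    Vec.map f (Vec.fromList xs) ≡ Vec.map g (Vec.fromList xs)
map-fromList-cong []       eq = ≡.refl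
map-fromList-cong (x ∷ xs) eq = ≡.cong₂ Vec._∷_ (eq x (here ≡.refl)) (map-fromList-cong xs (λ y y∈ → eq y (there y∈)))

lookup-ext : ∀ {a} {A : Set a} {n} (xs ys : Vec A n) → (∀ i → lookup xs i ≡ lookup ys i) → xs ≡ ys
lookup-ext Vec.[]       Vec.[]       eq = ≡.refl
lookup-ext (x Vec.∷ xs) (y Vec.∷ ys) eq = ≡.cong₂ Vec._∷_ (eq zero) (lookup-ext xs ys (eq ∘ suc))

spinOf : Maybe Mark → Spin
spinOf nothing  = zero
spinOf (just m) = colour m

module Output {c ℓ₁ ℓ₂} (F : ArchimedeanOrderedField c ℓ₁ ℓ₂) (I : Over.IsingModel F)
              (Z≉0 : Nondegenerate F I)
              (Λ : List (Fin (Over.IsingModel.n I))) (unique-Λ : Unique Λ) where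
  open OrderedField F
  open Products F
  open Solver
  open Over F
  open Conditional F I Z≉0
  open Run I Λ
  open Memory

  readout : Pins n → Vec Spin (length Λ)
  readout D = Vec.map (λ v → spinOf (find (pin* D []) v)) (Vec.fromList Λ)

  outputs-readout : ∀ D m → revAppend D [] ≡ Λ → Distinct (pin* D []) → OutRep D (nats m) → Outputs (readout D) m
  outputs-readout D m split dist out i with revAppend-out D [] (toℕ i) dist out
    (≡.subst (toℕ i ℕ.<_) (≡.trans (≡.cong length (≡.sym split)) (≡.trans (length-revAppend D []) (ℕ.+-identityʳ _))) (Fin.toℕ<n i))
  ... | v , s , at , found , e = ≡.trans e (≡.cong toℕ (≡.sym (≡.trans (Vec.lookup-map i _ (Vec.fromList Λ))
          (≡.cong spinOf (≡.trans (≡.cong (find (pin* D [])) same) found)))))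
    where
    just-injective : ∀ {x y : Fin n} → just x ≡ just y → x ≡ y
    just-injective ≡.refl = ≡.refl
    same : lookup (Vec.fromList Λ) i ≡ v
    same = just-injective (≡.trans (≡.sym (‼-lookup Λ i)) (≡.trans (≡.cong (_‼ toℕ i) (≡.sym split)) at))

  outputs?-readout : ∀ D m τ → revAppend D [] ≡ Λ → Distinct (pin* D []) → OutRep D (nats m) →
                     does (outputs? τ m) ≡ does (≡-dec Fin._≟_ (readout D) τ)
  outputs?-readout D m τ split dist out with ≡-dec Fin._≟_ (readout D) τ
  ... | yes ≡.refl = dec-true (outputs? τ m) (outputs-readout D m split dist out)
  ... | no  ne     = dec-false (outputs? τ m) λ o → ne (lookup-ext _ _ λ i →
          Fin.toℕ-injective (≡.trans (≡.sym (outputs-readout D m split dist out i)) (o i)))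

  module RootValue (ρ Tₛ Tᵣ : Carrier) (0≤ρ : 0# ≤ ρ) (0≤Tₛ : 0# ≤ Tₛ) (0≤Tᵣ : 0# ≤ Tᵣ)
                   (G : Vec Spin (length Λ) → Carrier) (0≤G : ∀ τ → 0# ≤ G τ) where
    open Potential F I Z≉0
    open Bounds ρ Tₛ Tᵣ 0≤ρ 0≤Tₛ 0≤Tᵣ (λ D → G (readout D)) (λ D → 0≤G (readout D))

    -- Every vertex of Λ is charged the same time whatever its spin, so the times add up, while the
    -- reward follows the chain rule `E-split`. At the end the pins determine `σ ↾ Λ`, and the
    -- conditional expectation is the value of `G` at the readout.
    rootValue≈ : ∀ vs D → revAppend D vs ≡ Λ →
      rootValue vs D ≈ ρ * (fromℕ (length vs) * (1# + Tᵣ) + (1# + 1#)) + E (λ σ → G (σ ↾ Λ)) (pin* D [])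
    rootValue≈ [] D split = trans
        (solve 3 (λ ρ T g → ρ :+ (ρ :+ g) := ρ :* (con (0 , 0) :* (:1 :+ T) :+ (:1 :+ :1)) :+ g) refl ρ Tᵣ _)
        (+-congˡ (sym constant))
      where
      L = pin* D []
      read : ∀ σ → Satisfies L σ → σ ↾ Λ ≡ readout D
      read σ sat = map-fromList-cong Λ λ v v∈ → agrees v (revAppend-∈ D [] (≡.subst (v ∈_) (≡.sym split) v∈))
        where
        agrees : ∀ v → (∃ λ s → find L v ≡ just (pin s)) ⊎ v ∈ [] → lookup σ v ≡ spinOf (find L v)
        agrees v (inj₁ (s , found)) = ≡.trans (≡.subst (Agrees (lookup σ v)) found (sat v)) (≡.cong spinOf (≡.sym found))
      constant : E (λ σ → G (σ ↾ Λ)) L ≈ G (readout D)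
      constant = trans (E-cong L {g = λ _ → G (readout D) * 1#} λ σ sat → trans (reflexive (≡.cong G (read σ sat))) (sym (*-identityʳ _)))
        (trans (E-* L (G (readout D)) (λ _ → 1#)) (trans (*-congˡ (E-one L)) (*-identityʳ _)))
    rootValue≈ (v ∷ vs) D split = begin-equality
      ρ + (ρ * Tᵣ + average L v (λ s → rootValue vs ((v , s) ∷ D)))
        ≈⟨ +-congˡ (+-congˡ (Σ₂-cong {λ s → P L v s * rootValue vs ((v , s) ∷ D)} {λ s → P L v s * (R + e s)} λ s → *-congˡ {P L v s} (rootValue≈ vs ((v , s) ∷ D) split))) ⟩
      ρ + (ρ * Tᵣ + Σ₂ (λ s → P L v s * (R + e s)))
        ≈⟨ solve 7 (λ ρ T R p p′ e e′ → ρ :+ (ρ :* T :+ (p :* (R :+ e) :+ p′ :* (R :+ e′))) :=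
                     ρ :* (:1 :+ T) :+ (p :+ p′) :* R :+ (p :* e :+ p′ :* e′)) refl ρ Tᵣ R _ _ _ _ ⟩
      ρ * (1# + Tᵣ) + Σ₂ (P L v) * R + Σ₂ (λ s → P L v s * e s)
        ≈⟨ +-cong (+-congˡ (*-congʳ (ΣP≈1 L v fresh))) (sym (E-split L v _ fresh)) ⟩
      ρ * (1# + Tᵣ) + 1# * R + E (λ σ → G (σ ↾ Λ)) L
        ≈⟨ +-congʳ (solve 3 (λ ρ T l → ρ :* (:1 :+ T) :+ :1 :* (ρ :* (l :* (:1 :+ T) :+ (:1 :+ :1))) :=
                                       ρ :* ((:1 :+ l) :* (:1 :+ T) :+ (:1 :+ :1))) refl ρ Tᵣ (fromℕ (length vs))) ⟩
      ρ * (fromℕ (length (v ∷ vs)) * (1# + Tᵣ) + (1# + 1#)) + E (λ σ → G (σ ↾ Λ)) L  ∎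
      where
      open ≤-Reasoning
      L = pin* D []
      R = ρ * (fromℕ (length vs) * (1# + Tᵣ) + (1# + 1#))
      e : Spin → Carrier
      e s = E (λ σ → G (σ ↾ Λ)) ((v , pin s) ∷ L)
      fresh : find L v ≡ nothing
      fresh = proj₂ (unique-revAppend D (v ∷ vs) (≡.subst Unique (≡.sym split) unique-Λ)) v (here ≡.refl)

-- Output probabilities and expected time as rewards.

module Runs {c ℓ₁ ℓ₂} (F : ArchimedeanOrderedField c ℓ₁ ℓ₂) (I : Over.IsingModel F)
            (Λ : List (Fin (Over.IsingModel.n I))) where
  open OrderedField F
  open Solver
  open Over F
  open Run I Λ
  open Reward F I Λ

  private
    mix-cong : ∀ p {x x′ y y′} → x ≈ x′ → y ≈ y′ → mix p x y ≈ mix p x′ y′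
    mix-cong p x≈ y≈ = +-cong (*-congˡ x≈) (*-congˡ y≈)

  𝔼-running-≤1 : ∀ t s → 𝔼 t running s ≤ 1#
  𝔼-running-≤1 zero    ([]    , m) = 0≤1
  𝔼-running-≤1 zero    (_ ∷ _ , m) = ≤-refl
  𝔼-running-≤1 (suc t) ([]    , m) = 0≤1
  𝔼-running-≤1 (suc t) (setNat a i e   ∷ k , m) = 𝔼-running-≤1 t _
  𝔼-running-≤1 (suc t) (setReal a i e  ∷ k , m) = 𝔼-running-≤1 t _
  𝔼-running-≤1 (suc t) (flip a i p     ∷ k , m) = ≤-trans (mix-mono (0≤clip _) (clip≤1 _) (𝔼-running-≤1 t _) (𝔼-running-≤1 t _))
    (≤-reflexive (solve 1 (λ p → p :* :1 :+ (:1 :- p) :* :1 := :1) refl _))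
  𝔼-running-≤1 (suc t) ((c₁ ⨾ c₂)      ∷ k , m) = 𝔼-running-≤1 t _
  𝔼-running-≤1 (suc t) (ifThen b c₁ c₂ ∷ k , m) = 𝔼-running-≤1 t _
  𝔼-running-≤1 (suc t) (while b c₁     ∷ k , m) = 𝔼-running-≤1 t _

  𝔼-running-antitone : ∀ t s → 𝔼 (suc t) running s ≤ 𝔼 t running s
  𝔼-running-antitone zero    ([]    , m) = ≤-refl
  𝔼-running-antitone zero    (c ∷ k , m) = 𝔼-running-≤1 1 (c ∷ k , m)
  𝔼-running-antitone (suc t) ([]    , m) = ≤-refl
  𝔼-running-antitone (suc t) (setNat a i e   ∷ k , m) = 𝔼-running-antitone t _
  𝔼-running-antitone (suc t) (setReal a i e  ∷ k , m) = 𝔼-running-antitone t _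
  𝔼-running-antitone (suc t) (flip a i p     ∷ k , m) =
    mix-mono (0≤clip _) (clip≤1 _) (𝔼-running-antitone t _) (𝔼-running-antitone t _)
  𝔼-running-antitone (suc t) ((c₁ ⨾ c₂)      ∷ k , m) = 𝔼-running-antitone t _
  𝔼-running-antitone (suc t) (ifThen b c₁ c₂ ∷ k , m) = 𝔼-running-antitone t _
  𝔼-running-antitone (suc t) (while b c₁     ∷ k , m) = 𝔼-running-antitone t _

  𝔼-running-≤ : ∀ {t t′} s → t ℕ.≤ t′ → 𝔼 t′ running s ≤ 𝔼 t running s
  𝔼-running-≤ {t} {t′} s t≤t′ with ℕ.m≤n⇒m<n∨m≡n t≤t′
  ... | inj₂ ≡.refl = ≤-refl
  𝔼-running-≤ {t} {suc t′} s t≤t′ | inj₁ (ℕ.s≤s t≤t″) = ≤-trans (𝔼-running-antitone t′ s) (𝔼-running-≤ s t≤t″)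

  ∑-applyUpTo : ∀ N (g : ℕ → ℕ) f → ∑ (List.applyUpTo g N) f ≈ ∑ (List.upTo N) (λ t → f (g t))
  ∑-applyUpTo zero    g f = refl
  ∑-applyUpTo (suc N) g f = +-congˡ (trans (∑-applyUpTo N (g ∘ suc) f) (sym (∑-applyUpTo N suc (f ∘ g))))

  ∑-upTo-suc : ∀ N f → ∑ (List.upTo (suc N)) f ≈ f 0 + ∑ (List.upTo N) (λ t → f (suc t))
  ∑-upTo-suc N f = +-congˡ (∑-applyUpTo N suc f)

  ∑-upTo-lower : ∀ N f {x} → (∀ i → i ℕ.< N → x ≤ f i) → fromℕ N * x ≤ ∑ (List.upTo N) f
  ∑-upTo-lower zero    f {x} x≤f = ≤-reflexive (zeroˡ x)
  ∑-upTo-lower (suc N) f {x} x≤f = begin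
    (1# + fromℕ N) * x                              ≈⟨ solve 2 (λ n x → (:1 :+ n) :* x := x :+ n :* x) refl (fromℕ N) x ⟩
    x + fromℕ N * x                                 ≤⟨ +-mono-≤ (x≤f 0 (ℕ.s≤s ℕ.z≤n)) (∑-upTo-lower N (f ∘ suc) (λ i i<N → x≤f (suc i) (ℕ.s≤s i<N))) ⟩
    f 0 + ∑ (List.upTo N) (λ t → f (suc t))         ≈⟨ ∑-upTo-suc N f ⟨
    ∑ (List.upTo (suc N)) f                         ∎
    where open ≤-Reasoning

  ∑-mix : ∀ N p f g → ∑ (List.upTo N) (λ t → mix p (f t) (g t)) ≈ mix p (∑ (List.upTo N) f) (∑ (List.upTo N) g)
  ∑-mix N p f g = trans (∑-+ (List.upTo N) (λ t → p * f t) (λ t → (1# - p) * g t))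
    (+-cong (∑-*ˡ (List.upTo N) p f) (∑-*ˡ (List.upTo N) (1# - p) g))

  module Time = Value 1# (λ _ → 0#) 0≤1 (λ _ → ≤-refl)

  -- Both sides are the expectation of min(T, N): on the left as a sum of tails, on the right by
  -- paying 1 for each step before halting.
  expectedTime≈V : ∀ N s → ∑ (List.upTo N) (λ t → 𝔼 t running s) ≈ Time.V N s
  expectedTime≈V zero    ([]    , m) = refl
  expectedTime≈V zero    (_ ∷ _ , m) = refl
  expectedTime≈V (suc N) s@([]  , m) = trans (∑-cong (List.upTo (suc N)) halted) (∑-zero (List.upTo (suc N)))
    where
    halted : ∀ t → 𝔼 t running ([] , m) ≈ 0#
    halted zero    = refl
    halted (suc t) = refl
  expectedTime≈V (suc N) (setNat a i e   ∷ k , m) = trans (∑-upTo-suc N _) (+-congˡ (expectedTime≈V N _))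
  expectedTime≈V (suc N) (setReal a i e  ∷ k , m) = trans (∑-upTo-suc N _) (+-congˡ (expectedTime≈V N _))
  expectedTime≈V (suc N) (flip a i p     ∷ k , m) = trans (∑-upTo-suc N _) (+-congˡ (trans (∑-mix N _ _ _)
    (mix-cong _ (expectedTime≈V N _) (expectedTime≈V N _))))
  expectedTime≈V (suc N) ((c₁ ⨾ c₂)      ∷ k , m) = trans (∑-upTo-suc N _) (+-congˡ (expectedTime≈V N _))
  expectedTime≈V (suc N) (ifThen b c₁ c₂ ∷ k , m) = trans (∑-upTo-suc N _) (+-congˡ (expectedTime≈V N _))
  expectedTime≈V (suc N) (while b c₁     ∷ k , m) = trans (∑-upTo-suc N _) (+-congˡ (expectedTime≈V N _))

  module _ (τ : Vec Spin (length Λ)) where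

    agreement disagreement : Bool → Carrier
    agreement    b = if b then 1# else 0#
    disagreement b = if b then 0# else 1#

    0≤agreement : ∀ b → 0# ≤ agreement b
    0≤agreement true  = 0≤1
    0≤agreement false = ≤-refl

    0≤disagreement : ∀ b → 0# ≤ disagreement b
    0≤disagreement true  = ≤-refl
    0≤disagreement false = 0≤1

    agreement+disagreement : ∀ b → agreement b + disagreement b ≈ 1#
    agreement+disagreement true  = +-identityʳ 1#
    agreement+disagreement false = +-identityˡ 1#

    module Hit  = Value 0# (λ m → agreement (does (outputs? τ m))) ≤-refl (λ m → 0≤agreement _)
    module Miss = Value 0# (λ m → disagreement (does (outputs? τ m))) ≤-refl (λ m → 0≤disagreement _)

    output≈V : ∀ t s → 𝔼 t (halted-with τ) s ≈ Hit.V t s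
    output≈V zero    ([]    , m) = refl
    output≈V zero    (_ ∷ _ , m) = refl
    output≈V (suc t) ([]    , m) = refl
    output≈V (suc t) (setNat a i e   ∷ k , m) = trans (output≈V t _) (sym (+-identityˡ _))
    output≈V (suc t) (setReal a i e  ∷ k , m) = trans (output≈V t _) (sym (+-identityˡ _))
    output≈V (suc t) (flip a i p     ∷ k , m) = trans (mix-cong _ (output≈V t _) (output≈V t _)) (sym (+-identityˡ _))
    output≈V (suc t) ((c₁ ⨾ c₂)      ∷ k , m) = trans (output≈V t _) (sym (+-identityˡ _))
    output≈V (suc t) (ifThen b c₁ c₂ ∷ k , m) = trans (output≈V t _) (sym (+-identityˡ _))
    output≈V (suc t) (while b c₁     ∷ k , m) = trans (output≈V t _) (sym (+-identityˡ _))

    totalMass : ∀ t s → 𝔼 t (halted-with τ) s + Miss.V t s + 𝔼 t running s ≈ 1#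
    totalMass zero    ([]    , m) = trans (+-identityʳ _) (agreement+disagreement (does (outputs? τ m)))
    totalMass zero    (_ ∷ _ , m) = trans (+-congʳ (+-identityʳ 0#)) (+-identityˡ 1#)
    totalMass (suc t) ([]    , m) = trans (+-identityʳ _) (agreement+disagreement (does (outputs? τ m)))
    totalMass (suc t) (setNat a i e   ∷ k , m) = trans (+-congʳ (+-congˡ (+-identityˡ _))) (totalMass t _)
    totalMass (suc t) (setReal a i e  ∷ k , m) = trans (+-congʳ (+-congˡ (+-identityˡ _))) (totalMass t _)
    totalMass (suc t) (flip a i p     ∷ k , m) = trans
      (solve 7 (λ p x x′ y y′ z z′ →
         (p :* x :+ (:1 :- p) :* x′) :+ (con (0 , 0) :+ (p :* y :+ (:1 :- p) :* y′)) :+ (p :* z :+ (:1 :- p) :* z′) :=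
         p :* (x :+ y :+ z) :+ (:1 :- p) :* (x′ :+ y′ :+ z′)) refl _ _ _ _ _ _ _)
      (trans (mix-cong _ (totalMass t _) (totalMass t _)) (solve 1 (λ p → p :* :1 :+ (:1 :- p) :* :1 := :1) refl _))
    totalMass (suc t) ((c₁ ⨾ c₂)      ∷ k , m) = trans (+-congʳ (+-congˡ (+-identityˡ _))) (totalMass t _)
    totalMass (suc t) (ifThen b c₁ c₂ ∷ k , m) = trans (+-congʳ (+-congˡ (+-identityˡ _))) (totalMass t _)
    totalMass (suc t) (while b c₁     ∷ k , m) = trans (+-congʳ (+-congˡ (+-identityˡ _))) (totalMass t _)

-- Exactness and linear expected time.

-- With l = |Λ|, the number of iterations l(1 + 18(4 + Δ)) + 2 equals 73l + 18Δl + 2, which is at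
-- most 91Δl + 2 because l ≤ Δl. The summand 2, all that remains for empty Λ, is absorbed by `⊔ 1`;
-- hence 93 = 91 + 2.
timeConstant : ℕ
timeConstant = suc (size body) ℕ.* 93

linear-time : ∀ K Δ l → 1 ℕ.≤ Δ →
  K ℕ.* (l ℕ.* (1 ℕ.+ 18 ℕ.* (4 ℕ.+ Δ)) ℕ.+ 2) ℕ.≤ K ℕ.* 93 ℕ.* ((Δ ℕ.* l) ℕ.⊔ 1)
linear-time K Δ l 1≤Δ = ≡.subst (K ℕ.* (l ℕ.* (1 ℕ.+ 18 ℕ.* (4 ℕ.+ Δ)) ℕ.+ 2) ℕ.≤_) (≡.sym (ℕ.*-assoc K 93 ((Δ ℕ.* l) ℕ.⊔ 1))) (ℕ.*-monoʳ-≤ K (begin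
  l ℕ.* (1 ℕ.+ 18 ℕ.* (4 ℕ.+ Δ)) ℕ.+ 2
    ≡⟨ solve 2 (λ l δ → l :* (con 1 :+ con 18 :* (con 4 :+ δ)) :+ con 2 := con 73 :* (con 1 :* l) :+ con 18 :* (δ :* l) :+ con 2) ≡.refl l Δ ⟩
  73 ℕ.* (1 ℕ.* l) ℕ.+ 18 ℕ.* (Δ ℕ.* l) ℕ.+ 2
    ≤⟨ ℕ.+-monoˡ-≤ 2 (ℕ.+-monoˡ-≤ (18 ℕ.* (Δ ℕ.* l)) (ℕ.*-monoʳ-≤ 73 (ℕ.*-monoˡ-≤ l 1≤Δ))) ⟩
  73 ℕ.* (Δ ℕ.* l) ℕ.+ 18 ℕ.* (Δ ℕ.* l) ℕ.+ 2
    ≡⟨ solve 1 (λ x → con 73 :* x :+ con 18 :* x :+ con 2 := con 91 :* x :+ con 2 :* con 1) ≡.refl (Δ ℕ.* l) ⟩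
  91 ℕ.* (Δ ℕ.* l) ℕ.+ 2 ℕ.* 1
    ≤⟨ ℕ.+-mono-≤ (ℕ.*-monoʳ-≤ 91 (ℕ.m≤m⊔n (Δ ℕ.* l) 1)) (ℕ.*-monoʳ-≤ 2 (ℕ.m≤n⊔m (Δ ℕ.* l) 1)) ⟩
  91 ℕ.* ((Δ ℕ.* l) ℕ.⊔ 1) ℕ.+ 2 ℕ.* ((Δ ℕ.* l) ℕ.⊔ 1)
    ≡⟨ ℕ.*-distribʳ-+ ((Δ ℕ.* l) ℕ.⊔ 1) 91 2 ⟨
  93 ℕ.* ((Δ ℕ.* l) ℕ.⊔ 1)  ∎))
  where
  open ℕ.≤-Reasoning
  open +-*-Solver

module Main {c ℓ₁ ℓ₂} (F : ArchimedeanOrderedField c ℓ₁ ℓ₂) (I : Over.IsingModel F)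
            (Z≉0 : Nondegenerate F I)
            (Λ : List (Fin (Over.IsingModel.n I))) (unique-Λ : Unique Λ) (Δ : ℕ) (1≤Δ : 1 ℕ.≤ Δ) where
  open OrderedField F
  open Solver
  open Over F
  open Conditional F I Z≉0
  open Run I Λ
  open Reward F I Λ
  open Runs F I Λ
  open Output F I Z≉0 Λ unique-Λ
  open Times F I Z≉0 Δ 1≤Δ
  open Simulation F I Z≉0 Λ unique-Λ using (V≤rootValue)

  module _ (degree≤Δ : ∀ v → degree v ℕ.≤ Δ)
           (β-lower : (fromℕ Δ - ½) ÷ fromℕ Δ < β) (β-upper : β < fromℕ Δ ÷ (fromℕ Δ - ½)) where

    private
      S R : Carrier
      S = Tₛ degree≤Δ β-lower β-upper
      R = Tᵣ degree≤Δ β-lower β-upper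

      0≤S : 0# ≤ S
      0≤S = 0≤fromℕ (16 ℕ.* (4 ℕ.+ Δ))
      0≤R : 0# ≤ R
      0≤R = 0≤fromℕ (18 ℕ.* (4 ℕ.+ Δ))

    -- The single estimate behind both claims: `ρ₀ = 1` without final reward bounds the time, and
    -- `ρ₀ = 0` with the indicator of an output event as reward bounds its probability.
    V-bound : ∀ ρ₀ (h : Memory → Carrier) (0≤ρ₀ : 0# ≤ ρ₀) (0≤h : ∀ m → 0# ≤ h m) (G : Vec Spin (length Λ) → Carrier) (0≤G : ∀ τ → 0# ≤ G τ) →
      (∀ D m → revAppend D [] ≡ Λ → Distinct (pin* D []) → OutRep D (Memory.nats m) → h m ≤ G (readout D)) →
      ∀ t → Value.V ρ₀ h 0≤ρ₀ 0≤h t (initial sampler) ≤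
            fromℕ (suc (size body)) * ρ₀ * (fromℕ (length Λ) * (1# + R) + (1# + 1#)) + E (λ σ → G (σ ↾ Λ)) []
    V-bound ρ₀ h 0≤ρ₀ 0≤h G 0≤G h≤G t = ≤-trans
      (V≤rootValue ρ₀ h 0≤ρ₀ 0≤h S R 0≤S 0≤R (λ D → G (readout D)) (λ D → 0≤G (readout D))
        (time-root degree≤Δ β-lower β-upper) (time-frame degree≤Δ β-lower β-upper) h≤G t)
      (≤-reflexive (RootValue.rootValue≈ _ S R (*-nonNegative (0≤fromℕ (suc (size body))) 0≤ρ₀) 0≤S 0≤R G 0≤G Λ [] ≡.refl))

    expectedTime : ExpectedTime≤ sampler (fromℕ (timeConstant ℕ.* ((Δ ℕ.* length Λ) ℕ.⊔ 1)))
    expectedTime N = begin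
      ∑ (List.upTo N) (Pr-running sampler)
        ≈⟨ expectedTime≈V N (initial sampler) ⟩
      Time.V N (initial sampler)
        ≤⟨ V-bound 1# (λ _ → 0#) 0≤1 (λ _ → ≤-refl) (λ _ → 0#) (λ _ → ≤-refl) (λ _ _ _ _ _ → ≤-refl) N ⟩
      fromℕ K * 1# * (fromℕ (length Λ) * (1# + R) + (1# + 1#)) + E (λ _ → 0#) []
        ≈⟨ +-cong (*-cong (*-identityʳ _) (+-congˡ (solve 0 (:1 :+ :1 := :1 :+ (:1 :+ con (0 , 0))) refl))) null ⟩
      fromℕ K * (fromℕ (length Λ) * fromℕ (1 ℕ.+ 18 ℕ.* (4 ℕ.+ Δ)) + fromℕ 2) + 0#
        ≈⟨ trans (+-identityʳ _) (*-congˡ (+-congʳ (sym (fromℕ-* (length Λ) (1 ℕ.+ 18 ℕ.* (4 ℕ.+ Δ)))))) ⟩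
      fromℕ K * (fromℕ (length Λ ℕ.* (1 ℕ.+ 18 ℕ.* (4 ℕ.+ Δ))) + fromℕ 2)
        ≈⟨ trans (*-congˡ (sym (fromℕ-+ (length Λ ℕ.* (1 ℕ.+ 18 ℕ.* (4 ℕ.+ Δ))) 2))) (sym (fromℕ-* K (length Λ ℕ.* (1 ℕ.+ 18 ℕ.* (4 ℕ.+ Δ)) ℕ.+ 2))) ⟩
      fromℕ (K ℕ.* (length Λ ℕ.* (1 ℕ.+ 18 ℕ.* (4 ℕ.+ Δ)) ℕ.+ 2))
        ≤⟨ fromℕ-mono (linear-time K Δ (length Λ) 1≤Δ) ⟩
      fromℕ (timeConstant ℕ.* ((Δ ℕ.* length Λ) ℕ.⊔ 1))  ∎
      where
      open ≤-Reasoning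
      K = suc (size body)
      null : E (λ _ → 0#) [] ≈ 0#
      null = trans (E-cong [] {g = λ _ → 0# * 1#} (λ _ _ → sym (zeroˡ 1#))) (trans (E-* [] 0# (λ _ → 1#)) (zeroˡ _))

    -- Since Pr[T > t] is antitone and its partial sums are bounded, it is
    -- O(1/t).
    running-vanishes : ∀ ε → 0# < ε → ∃ λ N → ∀ t → N ℕ.≤ t → Pr-running sampler t ≤ ε
    running-vanishes ε 0<ε = N , small
      where
      open ≤-Reasoning
      B = fromℕ (timeConstant ℕ.* ((Δ ℕ.* length Λ) ℕ.⊔ 1))
      N = proj₁ (archimedean (B ÷ ε))
      B≤Nε : B ≤ fromℕ N * ε
      B≤Nε = ≤-respˡ-≈ (÷-* B (<⇒≉0 0<ε)) (*-monoˡ-≤ ε (proj₁ 0<ε) (proj₂ (archimedean (B ÷ ε))))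
      partial : ∀ t → fromℕ (suc t) * Pr-running sampler t ≤ ∑ (List.upTo (suc t)) (Pr-running sampler)
      partial t = ∑-upTo-lower (suc t) (Pr-running sampler) (λ i i<1+t → 𝔼-running-≤ (initial sampler) (ℕ.s≤s⁻¹ i<1+t))
      small : ∀ t → N ℕ.≤ t → Pr-running sampler t ≤ ε
      small t N≤t = *-cancelˡ-≤ (fromℕ (suc t)) (0<fromℕ-suc t) (begin
        fromℕ (suc t) * Pr-running sampler t        ≤⟨ partial t ⟩
        ∑ (List.upTo (suc t)) (Pr-running sampler)  ≤⟨ expectedTime (suc t) ⟩
        B                                           ≤⟨ B≤Nε ⟩
        fromℕ N * ε                                 ≤⟨ *-monoˡ-≤ ε (proj₁ 0<ε) (fromℕ-mono (ℕ.m≤n⇒m≤1+n N≤t)) ⟩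
        fromℕ (suc t) * ε                           ∎)

    perfectSampler : PerfectSampler sampler
    perfectSampler τ ε 0<ε = proj₁ (running-vanishes ε 0<ε) , λ t N≤t → above t , below t N≤t
      where
      open ≤-Reasoning
      G₁ G₀ : Vec Spin (length Λ) → Carrier
      G₁ τ′ = agreement τ (does (≡-dec Fin._≟_ τ′ τ))
      G₀ τ′ = disagreement τ (does (≡-dec Fin._≟_ τ′ τ))
      p₁ p₀ : Carrier
      p₁ = E (λ σ → G₁ (σ ↾ Λ)) []
      p₀ = E (λ σ → G₀ (σ ↾ Λ)) []
      marginal≈p₁ : marginal Λ τ ≈ p₁
      marginal≈p₁ = trans (∑-filter (λ σ → ≡-dec Fin._≟_ (σ ↾ Λ) τ) (configurations n) μ) (sym (E-empty _))
      p₁+p₀≈1 : p₁ + p₀ ≈ 1#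
      p₁+p₀≈1 = trans (sym (E-+ [] _ _)) (trans
        (E-cong [] {g = λ _ → 1#} λ σ _ → agreement+disagreement τ (does (≡-dec Fin._≟_ (σ ↾ Λ) τ))) (E-one []))
      free : ∀ {x y} → x ≤ fromℕ (suc (size body)) * 0# * (fromℕ (length Λ) * (1# + R) + (1# + 1#)) + y → x ≤ y
      free = ≤-respʳ-≈ (solve 3 (λ k l y → k :* con (0 , 0) :* l :+ y := y) refl _ _ _)
      hit≤ : ∀ t → Pr-output sampler τ t ≤ p₁
      hit≤ t = ≤-trans (≤-reflexive (output≈V τ t (initial sampler)))
        (free (V-bound 0# _ ≤-refl (λ m → 0≤agreement τ _) G₁ (λ τ′ → 0≤agreement τ _)
          (λ D m split dist out → ≤-reflexive (reflexive (≡.cong (agreement τ) (outputs?-readout D m τ split dist out)))) t))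
      miss≤ : ∀ t → Miss.V τ t (initial sampler) ≤ p₀
      miss≤ t = free (V-bound 0# _ ≤-refl (λ m → 0≤disagreement τ _) G₀ (λ τ′ → 0≤disagreement τ _)
          (λ D m split dist out → ≤-reflexive (reflexive (≡.cong (disagreement τ) (outputs?-readout D m τ split dist out)))) t)
      above : ∀ t → Pr-output sampler τ t - marginal Λ τ ≤ ε
      above t = begin
        Pr-output sampler τ t - marginal Λ τ   ≤⟨ +-monoˡ-≤ _ (hit≤ t) ⟩
        p₁ - marginal Λ τ                      ≈⟨ trans (+-congˡ (-‿cong marginal≈p₁)) (-‿inverseʳ p₁) ⟩
        0#                                     ≤⟨ proj₁ 0<ε ⟩
        ε                                      ∎
      below : ∀ t → proj₁ (running-vanishes ε 0<ε) ℕ.≤ t → marginal Λ τ - Pr-output sampler τ t ≤ ε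
      below t N≤t = begin
        marginal Λ τ - o       ≈⟨ +-congʳ marginal≈p₁ ⟩
        p₁ - o                 ≈⟨ solve 3 (λ p q o → p :- o := (p :+ q) :- q :- o) refl p₁ p₀ o ⟩
        -- Both `p₁ + p₀` and `o + x + r` are 1; exchanging them brings in `x`, for which an upper
        -- bound is known.
        (p₁ + p₀) - p₀ - o     ≈⟨ +-congʳ (+-congʳ (trans p₁+p₀≈1 (sym (totalMass τ t (initial sampler))))) ⟩
        o + x + r - p₀ - o     ≤⟨ +-monoˡ-≤ _ (+-monoˡ-≤ _ (+-monoˡ-≤ r (+-monoʳ-≤ o (miss≤ t)))) ⟩
        o + p₀ + r - p₀ - o    ≈⟨ solve 3 (λ o p r → o :+ p :+ r :- p :- o := r) refl o p₀ r ⟩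
        r                      ≤⟨ proj₂ (running-vanishes ε 0<ε) t N≤t ⟩
        ε                      ∎
        where
        o = Pr-output sampler τ t
        x = Miss.V τ t (initial sampler)
        r = Pr-running sampler t

open import Data.Fin using (Fin)
open import Data.List using (List; length)
open import Data.List.Relation.Unary.Unique.Propositional using (Unique)
open import Data.Nat using (ℕ; _≤_; _*_; _⊔_)
open import Data.Product using (Σ; _×_)
open import Relation.Nullary using (¬_)

corollary1p3 : ∀ {c ℓ₁ ℓ₂} (F : ArchimedeanOrderedField c ℓ₁ ℓ₂) →
    let module F = ArchimedeanOrderedField F in
    let open Over F in
    Σ Cmd λ alg → Σ ℕ λ C →
    (I : IsingModel) →
    let open IsingModel I in
    ¬ (Z F.≈ F.0#) →
    (Δ : ℕ) → 1 ≤ Δ → MaxDegree graph Δ →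
    (F.fromℕ Δ F.- F.½) F.÷ F.fromℕ Δ F.< β →
    β F.< F.fromℕ Δ F.÷ (F.fromℕ Δ F.- F.½) →
    (Λ : List (Fin n)) → Unique Λ →
    Run.PerfectSampler I Λ alg ×
    Run.ExpectedTime≤ I Λ alg (F.fromℕ (C * ((Δ * length Λ) ⊔ 1)))
corollary1p3 F = sampler , timeConstant ,
  λ I Z≉0 Δ 1≤Δ (degree≤Δ , _) β-lower β-upper Λ unique-Λ →
    Main.perfectSampler F I Z≉0 Λ unique-Λ Δ 1≤Δ degree≤Δ β-lower β-upper ,
    Main.expectedTime F I Z≉0 Λ unique-Λ Δ 1≤Δ degree≤Δ β-lower β-upper
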